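{- There exists $M$ such that for every integer $r>M$: if $r$ is even then there exists an $r$-partite $r$-uniform intersecting hypergraph $\mathcal{H}$ with $\tau(\mathcal{H})\ge r-3$, and if $r$ is odd then there exists an $r$-partite $r$-uniform intersecting hypergraph $\mathcal{H}$ with $\tau(\mathcal{H})\ge r-4$.
   Context: A hypergraph is $r$-partite if its vertex set has a partition into $r$ classes such that every edge contains at most one vertex of each class; it is $r$-uniform if every edge has exactly $r$ vertices; it is intersecting if every two edges share a vertex. $\tau(\mathcal{H})$ denotes the minimum size of a vertex cover (a set of vertices meeting every edge). -}

module Defs where

open import Data.Nat using (ℕ; _≥_)
open import Data.Fin using (Fin)
open import Data.Fin.Subset using (Subset; ∣_∣) renaming (_∈_ to _∈ₛ_)
open import Data.List using (List)
open import Data.List.Membership.Propositional using (_∈_)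
open import Data.Product using (Σ; ∃; _×_)
open import Relation.Binary.PropositionalEquality using (_≡_)

record Hypergraph : Set where
  field
    numVertices : ℕ
    edges       : List (Subset numVertices)
open Hypergraph public

Uniform : ℕ → Hypergraph → Set
Uniform r H = ∀ {e} → e ∈ edges H → ∣ e ∣ ≡ r

Partite : ℕ → Hypergraph → Set
Partite r H = Σ (Fin (numVertices H) → Fin r) λ c →
  ∀ {e} → e ∈ edges H → ∀ u v → u ∈ₛ e → v ∈ₛ e → c u ≡ c v → u ≡ v

Intersecting : Hypergraph → Set
Intersecting H = ∀ {e f} → e ∈ edges H → f ∈ edges H →
  ∃ λ v → v ∈ₛ e × v ∈ₛ f

IsCover : (H : Hypergraph) → Subset (numVertices H) → Set
IsCover H C = ∀ {e} → e ∈ edges H → ∃ λ v → v ∈ₛ e × v ∈ₛ C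

τ≥ : Hypergraph → ℕ → Set
τ≥ H k = ∀ C → IsCover H C → ∣ C ∣ ≥ k

{-# OPTIONS --safe #-}

-- Dually, a hypergraph is a set of points with r partitions such that any two points
-- share a part, and a cover is a family of parts. The affine plane of order q has q + 1
-- partitions into parallel lines and cannot be covered by fewer than q lines. Remove a
-- point P of it and place a copy of a smaller system, with r′ partitions and cover
-- number τ′, on every line through P, which is thereby broken; all these copies share
-- the same new partitions. The result has q + r′ partitions and, by Jamison's bound of
-- 2(q - 1) on the number of lines covering all points but P, its cheapest covers are
-- the parallels of a broken line together with a cover of the copy on it. They have
-- q - 1 + τ′ parts, so that r - τ grows by one in each step.
--
-- To avoid this growth one more line of every parallel class is split up: a tangent of
-- a parabola, respectively the line x = 1. A point lies on at most two tangents, so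
-- that two reserved partitions g₁, g₂ suffice to see the points of the split tangents,
-- and g₃ serves the line x = 1. Only points that have no use for g₁, g₂, g₃ themselves
-- (the free ones) may be placed on these lines; there are always enough of them, since
-- the tangents miss about half of each broken line. Now r - τ = 3 is preserved by the
-- step from r′ to q + r′ for every prime q slightly larger than r′, and a version of
-- Bertrand's postulate provides such steps towards every large r.

module Submission where

open import Defs
open import Data.Nat using (ℕ; _>_; _∸_)
open import Data.Nat.Divisibility using (_∣_; _∤_)
open import Data.Product using (Σ; ∃; _×_)
open import Data.Nat using (suc; _*_)
open import Data.Product using (∃₂; _,_; proj₁; proj₂)
open import Data.Sum using (_⊎_; inj₁; inj₂)
open import Data.Fin using (Fin)
open import Data.List using (List; []; _∷_; length)
open import Data.List.Membership.Propositional using (_∈_)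
open import Data.List.Relation.Unary.Any using (Any; here; there)
open import Data.List.Relation.Unary.All using (All; []; _∷_)
open import Data.List.Relation.Unary.AllPairs using ([]; _∷_)
open import Data.List.Relation.Unary.Unique.Propositional using (Unique)
open import Function using (_∘_)
open import Relation.Nullary using (¬_; Dec; yes; no)
open import Relation.Nullary.Negation using (contradiction)
open import Relation.Unary using (Decidable)
open import Relation.Binary.PropositionalEquality hiding ([_])

-- The induction carries a second number, the cost `t₁` of covering the free points alone: a
-- position of the plane can be left to the vertices living on its broken line only if these number
-- at least `t₁`. Three such broken lines cost more than `t` together, so a cheap cover has at most
-- two of them. If neither carries `t` vertices, lines have to cover all their positions apart from
-- the split lines; joining the missing positions of one to those of the other costs only about q/2
-- lines, and Jamison's bound then applies to lines alone. Counting thus gives q + t in every case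
-- but one: q - 1 parallels and `t` vertices on a single broken line. Splitting a line of each
-- parallel class costs the missing vertex exactly there. The new `t₁` is again about half of the
-- new `t`, with an error that grows by a constant per step while the number of partitions doubles.
-- The remaining inequalities ask for a prime q somewhat above k, so q + k takes every large value
-- once (n, 2n] is known to contain primes with some room above n.

module FiniteFields where

  -- Finite fields and residues modulo a prime.

  open import Algebra.Structures using (IsCommutativeRing)
  open import Algebra.Bundles using (CommutativeRing)
  import Algebra.Solver.Ring
  open import Algebra.Solver.Ring.AlmostCommutativeRing using (_-Raw-AlmostCommutative⟶_; fromCommutativeRing)
  open import Data.Nat as ℕ using (_≤_; _<_; NonZero; z≤n; s≤s)
  import Data.Nat.Properties as ℕ
  import Data.Nat.Divisibility as ℕ∣
  open import Data.Nat.Primality using (Prime; prime⇒nonZero; prime⇒nonTrivial; prime⇒irreducible)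
  import Data.Nat.GCD as GCD
  open import Data.Nat.Coprimality using (Coprime; coprime⇒GCD≡1)
  open import Data.Integer as ℤ using (ℤ; +_)
  import Data.Integer.Properties as ℤ
  open import Data.Integer.DivMod using (_%ℕ_; _/ℕ_; n%ℕd<d; a≡a%ℕn+[a/ℕn]*n)
  open import Data.Integer.Divisibility.Signed using (_∣_; divides; ∣⇒∣ᵤ)
  open import Data.Integer.Tactic.RingSolver using (solve-∀)
  open import Data.Fin as Fin using (toℕ; fromℕ<)
  open import Data.Fin.Properties using (toℕ-injective; toℕ<n; toℕ-fromℕ<)
  open import Data.Maybe using (Maybe; just; nothing)
  open import Level using (0ℓ)

  -- The homomorphism `π` supplies integer coefficients to the ring solver. `jamison` is a component
  -- because its proof works with natural representatives modulo a prime, whereas the geometry uses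
  -- nothing but field laws.
  record Field (q : ℕ) : Set where
    infixl 6 _⊕_ _⊖_
    infixl 7 _⊗_
    field
      _⊕_ _⊗_ : Fin q → Fin q → Fin q
      neg : Fin q → Fin q
      𝟘 𝟙 : Fin q
      isCommutativeRing : IsCommutativeRing _≡_ _⊕_ _⊗_ neg 𝟘 𝟙
      π : ℤ → Fin q
      π-+ : ∀ a b → π (a ℤ.+ b) ≡ π a ⊕ π b
      π-* : ∀ a b → π (a ℤ.* b) ≡ π a ⊗ π b
      π-neg : ∀ a → π (ℤ.- a) ≡ neg (π a)
      π-0 : π (+ 0) ≡ 𝟘
      π-1 : π (+ 1) ≡ 𝟙
      inverse : ∀ x → x ≢ 𝟘 → ∃ λ y → x ⊗ y ≡ 𝟙
      𝟙≢𝟘 : 𝟙 ≢ 𝟘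
      -- A triple (α, β, γ) is the line α + β x + γ y = 0; a nonzero α says that it misses the
      -- origin.
      jamison : (ls : List (Fin q × Fin q × Fin q)) →
        All (λ l → proj₁ l ≢ 𝟘) ls →
        (∀ x y → ¬ (x ≡ 𝟘 × y ≡ 𝟘) → Any (λ (l : Fin q × Fin q × Fin q) → (proj₁ l ⊕ proj₁ (proj₂ l) ⊗ x) ⊕ proj₂ (proj₂ l) ⊗ y ≡ 𝟘) ls) →
        2 ℕ.* (q ℕ.∸ 1) ≤ length ls

    _⊖_ : Fin q → Fin q → Fin q
    x ⊖ y = x ⊕ neg y

    commutativeRing : CommutativeRing 0ℓ 0ℓ
    commutativeRing = record { isCommutativeRing = isCommutativeRing }

    private
      acr = fromCommutativeRing commutativeRing
      homomorphism : CommutativeRing.rawRing ℤ.+-*-commutativeRing -Raw-AlmostCommutative⟶ acr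
      homomorphism = record
        { ⟦_⟧ = π ; +-homo = π-+ ; *-homo = π-* ; -‿homo = π-neg ; 0-homo = π-0 ; 1-homo = π-1 }
      decide : ∀ a b → Maybe (π a ≡ π b)
      decide a b with a ℤ.≟ b
      ... | yes eq = just (cong π eq)
      ... | no _ = nothing

    module Solver = Algebra.Solver.Ring (CommutativeRing.rawRing ℤ.+-*-commutativeRing) acr homomorphism decide

  module Residues (p : ℕ) (prime : Prime p) where

    instance
      nonZero : NonZero p
      nonZero = prime⇒nonZero prime

    1<p : 1 < p
    1<p = ℕ.nonTrivial⇒n>1 p where instance _ = prime⇒nonTrivial prime

    infix 4 _≈_
    -- With `a` alone on the left, matching `equation` against `refl` eliminates `a`, and the laws
    -- of congruence become integer identities for the solver.
    record _≈_ (a b : ℤ) : Set where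
      constructor _,_
      field
        multiple : ℤ
        equation : a ≡ b ℤ.+ multiple ℤ.* + p

    ≈-trans : ∀ {a b c} → a ≈ b → b ≈ c → a ≈ c
    ≈-trans {c = c} (k , refl) (l , refl) = l ℤ.+ k , lemma c k l (+ p)
      where
      lemma : ∀ c k l p → (c ℤ.+ l ℤ.* p) ℤ.+ k ℤ.* p ≡ c ℤ.+ (l ℤ.+ k) ℤ.* p
      lemma = solve-∀

    ≈-sym : ∀ {a b} → a ≈ b → b ≈ a
    ≈-sym {b = b} (k , refl) = ℤ.- k , lemma b k (+ p)
      where
      lemma : ∀ c k p → c ≡ (c ℤ.+ k ℤ.* p) ℤ.+ (ℤ.- k) ℤ.* p
      lemma = solve-∀

    ≈-+ : ∀ {a b c d} → a ≈ b → c ≈ d → a ℤ.+ c ≈ b ℤ.+ d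
    ≈-+ {b = b} {d = d} (k , refl) (l , refl) = k ℤ.+ l , lemma b d k l (+ p)
      where
      lemma : ∀ b d k l p → (b ℤ.+ k ℤ.* p) ℤ.+ (d ℤ.+ l ℤ.* p) ≡ (b ℤ.+ d) ℤ.+ (k ℤ.+ l) ℤ.* p
      lemma = solve-∀

    ≈-* : ∀ {a b c d} → a ≈ b → c ≈ d → a ℤ.* c ≈ b ℤ.* d
    ≈-* {b = b} {d = d} (k , refl) (l , refl) = b ℤ.* l ℤ.+ k ℤ.* d ℤ.+ k ℤ.* l ℤ.* + p , lemma b d k l (+ p)
      where
      lemma : ∀ b d k l p → (b ℤ.+ k ℤ.* p) ℤ.* (d ℤ.+ l ℤ.* p) ≡ (b ℤ.* d) ℤ.+ (b ℤ.* l ℤ.+ k ℤ.* d ℤ.+ k ℤ.* l ℤ.* p) ℤ.* p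
      lemma = solve-∀

    ≈-neg : ∀ {a b} → a ≈ b → ℤ.- a ≈ ℤ.- b
    ≈-neg {b = b} (k , refl) = ℤ.- k , lemma b k (+ p)
      where
      lemma : ∀ b k p → ℤ.- (b ℤ.+ k ℤ.* p) ≡ ℤ.- b ℤ.+ (ℤ.- k) ℤ.* p
      lemma = solve-∀

    ≡⇒≈ : ∀ {a b} → a ≡ b → a ≈ b
    ≡⇒≈ {a} refl = + 0 , sym (trans (cong (λ z → a ℤ.+ z) (ℤ.*-zeroˡ (+ p))) (ℤ.+-identityʳ a))

    ι : Fin p → ℤ
    ι x = + toℕ x

    -- Sealed so that remainders never unfold; `toℕ-π` is all that is used about them.
    abstract
      π : ℤ → Fin p
      π z = fromℕ< (n%ℕd<d z p)

      toℕ-π : ∀ z → toℕ (π z) ≡ z %ℕ p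
      toℕ-π z = toℕ-fromℕ< (n%ℕd<d z p)

    ι-π : ∀ z → ι (π z) ≈ z
    ι-π z = ≈-sym (z /ℕ p , trans (a≡a%ℕn+[a/ℕn]*n z p)
      (cong (λ r → + r ℤ.+ (z /ℕ p) ℤ.* + p) (sym (toℕ-π z))))

    -- The difference of two representatives is a multiple of `p` whose absolute value is below `p`.
    ι-injective : ∀ {x y} → ι x ≈ ι y → x ≡ y
    ι-injective {x} {y} (k , eq) = toℕ-injective (ℤ.+-injective (ℤ.i-j≡0⇒i≡j (ι x) (ι y) (ℤ.∣i∣≡0⇒i≡0 zero-abs)))
      where
      lemma : ∀ b k p → (b ℤ.+ k ℤ.* p) ℤ.- b ≡ k ℤ.* p
      lemma = solve-∀
      p∣ : p ℕ∣.∣ ℤ.∣ ι x ℤ.- ι y ∣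
      p∣ = ∣⇒∣ᵤ (divides k (trans (cong (ℤ._- ι y) eq) (lemma (ι y) k (+ p))))
      bound : ℤ.∣ ι x ℤ.- ι y ∣ < p
      bound = ℕ.≤-<-trans (subst (λ z → ℤ.∣ z ∣ ≤ toℕ x ℕ.⊔ toℕ y) (sym (ℤ.m-n≡m⊖n (toℕ x) (toℕ y))) (ℤ.∣m⊝n∣≤m⊔n (toℕ x) (toℕ y)))
        (ℕ.⊔-lub (toℕ<n x) (toℕ<n y))
      zero-abs : ℤ.∣ ι x ℤ.- ι y ∣ ≡ 0
      zero-abs with ℤ.∣ ι x ℤ.- ι y ∣ ℕ.≟ 0
      ... | yes e = e
      ... | no ne = contradiction (ℕ∣.∣⇒≤ {{ℕ.≢-nonZero ne}} p∣) (ℕ.<⇒≱ bound)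

    π-cong : ∀ {a b} → a ≈ b → π a ≡ π b
    π-cong {a} {b} e = ι-injective (≈-trans (ι-π a) (≈-trans e (≈-sym (ι-π b))))

    π-ι : ∀ x → π (ι x) ≡ x
    π-ι x = ι-injective (ι-π (ι x))

    infixl 6 _⊕_
    infixl 7 _⊗_
    _⊕_ _⊗_ : Fin p → Fin p → Fin p
    x ⊕ y = π (ι x ℤ.+ ι y)
    x ⊗ y = π (ι x ℤ.* ι y)

    neg : Fin p → Fin p
    neg x = π (ℤ.- ι x)

    𝟘 𝟙 : Fin p
    𝟘 = π (+ 0)
    𝟙 = π (+ 1)

    π-+ : ∀ a b → π (a ℤ.+ b) ≡ π a ⊕ π b
    π-+ a b = π-cong (≈-+ (≈-sym (ι-π a)) (≈-sym (ι-π b)))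

    π-* : ∀ a b → π (a ℤ.* b) ≡ π a ⊗ π b
    π-* a b = π-cong (≈-* (≈-sym (ι-π a)) (≈-sym (ι-π b)))

    π-neg : ∀ a → π (ℤ.- a) ≡ neg (π a)
    π-neg a = π-cong (≈-neg (≈-sym (ι-π a)))

    private
      -- Pulls a nested sum under a single `π`, where the ring laws are those of the integers.
      +-lift : ∀ {x y} {a b} → π a ≡ x → π b ≡ y → x ⊕ y ≡ π (a ℤ.+ b)
      +-lift {a = a} {b} e e′ = sym (trans (π-+ a b) (cong₂ _⊕_ e e′))
      *-lift : ∀ {x y} {a b} → π a ≡ x → π b ≡ y → x ⊗ y ≡ π (a ℤ.* b)
      *-lift {a = a} {b} e e′ = sym (trans (π-* a b) (cong₂ _⊗_ e e′))

      +-assoc : ∀ x y z → (x ⊕ y) ⊕ z ≡ x ⊕ (y ⊕ z)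
      +-assoc x y z = trans (+-lift refl (π-ι z)) (trans (cong π (ℤ.+-assoc (ι x) (ι y) (ι z))) (sym (+-lift (π-ι x) refl)))
      +-comm : ∀ x y → x ⊕ y ≡ y ⊕ x
      +-comm x y = cong π (ℤ.+-comm (ι x) (ι y))
      +-idˡ : ∀ x → 𝟘 ⊕ x ≡ x
      +-idˡ x = trans (+-lift refl (π-ι x)) (trans (cong π (ℤ.+-identityˡ (ι x))) (π-ι x))
      +-invˡ : ∀ x → neg x ⊕ x ≡ 𝟘
      +-invˡ x = trans (+-lift refl (π-ι x)) (cong π (ℤ.+-inverseˡ (ι x)))
      *-assoc : ∀ x y z → (x ⊗ y) ⊗ z ≡ x ⊗ (y ⊗ z)
      *-assoc x y z = trans (*-lift refl (π-ι z)) (trans (cong π (ℤ.*-assoc (ι x) (ι y) (ι z))) (sym (*-lift (π-ι x) refl)))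
      *-comm : ∀ x y → x ⊗ y ≡ y ⊗ x
      *-comm x y = cong π (ℤ.*-comm (ι x) (ι y))
      *-idˡ : ∀ x → 𝟙 ⊗ x ≡ x
      *-idˡ x = trans (*-lift refl (π-ι x)) (trans (cong π (ℤ.*-identityˡ (ι x))) (π-ι x))
      distribˡ : ∀ x y z → x ⊗ (y ⊕ z) ≡ x ⊗ y ⊕ x ⊗ z
      distribˡ x y z = trans (*-lift (π-ι x) refl) (trans (cong π (ℤ.*-distribˡ-+ (ι x) (ι y) (ι z))) (sym (+-lift refl refl)))
      distribʳ : ∀ x y z → (y ⊕ z) ⊗ x ≡ y ⊗ x ⊕ z ⊗ x
      distribʳ x y z = trans (*-comm (y ⊕ z) x) (trans (distribˡ x y z) (cong₂ _⊕_ (*-comm x y) (*-comm x z)))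

    isCommutativeRing : IsCommutativeRing _≡_ _⊕_ _⊗_ neg 𝟘 𝟙
    isCommutativeRing = record
      { isRing = record
        { +-isAbelianGroup = record
          { isGroup = record
            { isMonoid = record
              { isSemigroup = record
                { isMagma = record { isEquivalence = isEquivalence ; ∙-cong = cong₂ _⊕_ }
                ; assoc = +-assoc }
              ; identity = +-idˡ , λ x → trans (+-comm x 𝟘) (+-idˡ x) }
            ; inverse = +-invˡ , λ x → trans (+-comm x (neg x)) (+-invˡ x)
            ; ⁻¹-cong = cong neg }
          ; comm = +-comm }
        ; *-cong = cong₂ _⊗_
        ; *-assoc = *-assoc
        ; *-identity = *-idˡ , λ x → trans (*-comm x 𝟙) (*-idˡ x)
        ; distrib = distribˡ , distribʳ }
      ; *-comm = *-comm }

    toℕ-𝟘 : toℕ 𝟘 ≡ 0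
    toℕ-𝟘 = trans (toℕ-π (+ 0)) (ℕ.n≤0⇒n≡0 (ℕ.≤-reflexive (0%p)))
      where
      import Data.Nat.DivMod as DM
      0%p : (+ 0) %ℕ p ≡ 0
      0%p = DM.m<n⇒m%n≡m (ℕ.<-trans (s≤s z≤n) 1<p)

    𝟙≢𝟘 : 𝟙 ≢ 𝟘
    𝟙≢𝟘 e with trans (sym toℕ-𝟙) (trans (cong toℕ e) toℕ-𝟘)
      where
      import Data.Nat.DivMod as DM
      toℕ-𝟙 : toℕ 𝟙 ≡ 1
      toℕ-𝟙 = trans (toℕ-π (+ 1)) (DM.m<n⇒m%n≡m 1<p)
    ... | ()

    π≡𝟘⇒∣ : ∀ n → π (+ n) ≡ 𝟘 → p ℕ∣.∣ n
    π≡𝟘⇒∣ n e with ≈-trans (≈-sym (ι-π (+ n))) (≈-trans (≡⇒≈ (cong ι e)) (≡⇒≈ (cong +_ toℕ-𝟘)))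
    ... | k , eq = ∣⇒∣ᵤ (divides k (trans eq (ℤ.+-identityˡ (k ℤ.* + p))))

    nonzero⇒∤ : ∀ x → x ≢ 𝟘 → ¬ p ℕ∣.∣ toℕ x
    nonzero⇒∤ x x≢0 p∣x with toℕ x ℕ.≟ 0
    ... | yes e = x≢0 (toℕ-injective (trans e (sym toℕ-𝟘)))
    ... | no ne = ℕ.<⇒≱ (toℕ<n x) (ℕ∣.∣⇒≤ {{ℕ.≢-nonZero ne}} p∣x)

    coprime : ∀ x → x ≢ 𝟘 → Coprime (toℕ x) p
    coprime x x≢0 {d} (d∣x , d∣p) with prime⇒irreducible prime d∣p
    ... | inj₁ d≡1 = d≡1
    ... | inj₂ refl = contradiction d∣x (nonzero⇒∤ x x≢0)

    inverse : ∀ x → x ≢ 𝟘 → ∃ λ y → x ⊗ y ≡ 𝟙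
    inverse x x≢0 with GCD.Bézout.identity (coprime⇒GCD≡1 (coprime x x≢0))
    ... | GCD.Bézout.+- a b eq = π (+ a) , trans (*-lift (π-ι x) refl) (π-cong (+ b ,
           trans (sym (ℤ.pos-* (toℕ x) a)) (trans (cong +_ (trans (ℕ.*-comm (toℕ x) a) (sym eq))) (trans (ℤ.pos-+ 1 (b ℕ.* p)) (cong (λ z → + 1 ℤ.+ z) (ℤ.pos-* b p))))))
    -- Here 1 + a x = b p, so the inverse is - a.
    ... | GCD.Bézout.-+ a b eq = π (ℤ.- + a) , trans (*-lift (π-ι x) refl) (π-cong (ℤ.- (+ b) ,
           lemma (ι x) (+ a) (+ b) (+ p) (trans (cong (λ z → + 1 ℤ.+ z) (sym (ℤ.pos-* a (toℕ x)))) (trans (sym (ℤ.pos-+ 1 (a ℕ.* toℕ x))) (trans (cong +_ eq) (ℤ.pos-* b p))))))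
      where
      lemma : ∀ x a b p → + 1 ℤ.+ a ℤ.* x ≡ b ℤ.* p → x ℤ.* (ℤ.- a) ≡ + 1 ℤ.+ (ℤ.- b) ℤ.* p
      lemma x a b p e = trans (l1 x a) (trans (cong (λ z → + 1 ℤ.+ (ℤ.- z)) e) (cong (λ z → + 1 ℤ.+ z) (ℤ.neg-distribˡ-* b p)))
        where
        l1 : ∀ x a → x ℤ.* (ℤ.- a) ≡ + 1 ℤ.+ ℤ.- (+ 1 ℤ.+ a ℤ.* x)
        l1 = solve-∀

open FiniteFields using (Field)

-- Jamison's bound for lines covering all points but one.

module Jamison where

  open FiniteFields
  open import Data.Nat
  open import Data.Nat.Properties
  open import Data.Nat.Divisibility
  open import Data.Nat.Combinatorics using (_C_; nCk+nC[k+1]≡[n+1]C[k+1]; k>n⇒nCk≡0; nC1≡n)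
  open import Data.Nat.Primality using (Prime; euclidsLemma)
  open import Data.Nat.Tactic.RingSolver using (solve-∀)
  import Data.Integer as ℤ
  import Data.Integer.Properties as ℤ
  open import Data.Fin using (toℕ; fromℕ<)
  open import Data.Fin.Properties using (toℕ-fromℕ<)

  Σ[_<] : ℕ → (ℕ → ℕ) → ℕ
  Σ[ zero <] f = 0
  Σ[ suc n <] f = Σ[ n <] f + f n

  Σ-cong : ∀ n {f g : ℕ → ℕ} → (∀ i → f i ≡ g i) → Σ[ n <] f ≡ Σ[ n <] g
  Σ-cong zero e = refl
  Σ-cong (suc n) e = cong₂ _+_ (Σ-cong n e) (e n)

  Σ-+ : ∀ n (f g : ℕ → ℕ) → Σ[ n <] (λ i → f i + g i) ≡ Σ[ n <] f + Σ[ n <] g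
  Σ-+ zero f g = refl
  Σ-+ (suc n) f g = trans (cong (_+ (f n + g n)) (Σ-+ n f g)) (lemma (Σ[ n <] f) (Σ[ n <] g) (f n) (g n))
    where
    lemma : ∀ a b c d → (a + b) + (c + d) ≡ (a + c) + (b + d)
    lemma = solve-∀

  Σ-* : ∀ n c (f : ℕ → ℕ) → Σ[ n <] (λ i → c * f i) ≡ c * Σ[ n <] f
  Σ-* zero c f = sym (*-zeroʳ c)
  Σ-* (suc n) c f = trans (cong (_+ c * f n) (Σ-* n c f)) (sym (*-distribˡ-+ c (Σ[ n <] f) (f n)))

  ∣-Σ : ∀ {d} n {f : ℕ → ℕ} → (∀ i → i < n → d ∣ f i) → d ∣ Σ[ n <] f
  ∣-Σ {d} zero h = d ∣0
  ∣-Σ (suc n) h = ∣m∣n⇒∣m+n (∣-Σ n (λ i i<n → h i (m<n⇒m<1+n i<n))) (h n (n<1+n n))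

  ∣-Σ-head : ∀ {d} n {f : ℕ → ℕ} → d ∣ Σ[ suc n <] f → (∀ i → 0 < i → i < suc n → d ∣ f i) → d ∣ f 0
  ∣-Σ-head zero d∣ h = d∣
  ∣-Σ-head {d} (suc n) {f} d∣ h = ∣-Σ-head n (∣m+n∣n⇒∣m {m = Σ[ suc n <] f} d∣ (h (suc n) (s≤s z≤n) (n<1+n (suc n)))) (λ i 0<i i< → h i 0<i (m<n⇒m<1+n i<))
    where
    ∣m+n∣n⇒∣m : ∀ {m k} → d ∣ m + k → d ∣ k → d ∣ m
    ∣m+n∣n⇒∣m {m} {k} = ∣m+n∣m⇒∣n ∘ subst (d ∣_) (+-comm m k)

  hockeyStick : ∀ n a → Σ[ n <] (_C a) ≡ n C suc a
  hockeyStick zero a = sym (k>n⇒nCk≡0 {n = zero} {suc a} (s≤s z≤n))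
  hockeyStick (suc n) a = trans (cong (_+ n C a) (hockeyStick n a)) (trans (+-comm (n C suc a) (n C a)) (nCk+nC[k+1]≡[n+1]C[k+1] n a))

  -- In the basis of binomials, multiplication by the variable raises the degree by at most one;
  -- this replaces the product of monomials in `vanish`.
  n*nCk : ∀ n k → n * (n C k) ≡ suc k * (n C suc k) + k * (n C k)
  n*nCk zero k = sym (cong₂ _+_ (trans (cong (suc k *_) (k>n⇒nCk≡0 {n = zero} {suc k} (s≤s z≤n))) (*-zeroʳ (suc k))) (kz k))
    where
    kz : ∀ k → k * (0 C k) ≡ 0
    kz zero = refl
    kz (suc k) = trans (cong (suc k *_) (k>n⇒nCk≡0 {n = zero} {suc k} (s≤s z≤n))) (*-zeroʳ (suc k))
  n*nCk (suc n) zero = trans (*-identityʳ (suc n)) (sym (trans (+-identityʳ _) (trans (*-identityˡ _) (nC1≡n (suc n)))))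
  n*nCk (suc n) (suc k) rewrite sym (nCk+nC[k+1]≡[n+1]C[k+1] n k) | sym (nCk+nC[k+1]≡[n+1]C[k+1] n (suc k)) =
    trans (lemma₁ n (n C k) (n C suc k)) (trans (cong₂ (λ s t → s + t + (n C k + n C suc k)) (n*nCk n k) (n*nCk n (suc k))) (lemma₂ k (n C k) (n C suc k) (n C suc (suc k))))
    where
    lemma₁ : ∀ n x y → suc n * (x + y) ≡ n * x + n * y + (x + y)
    lemma₁ = solve-∀
    lemma₂ : ∀ k x y z → suc k * y + k * x + (suc (suc k) * z + suc k * y) + (x + y) ≡ suc (suc k) * (y + z) + suc k * (x + y)
    lemma₂ = solve-∀

  [k+1]*[n+1]C[k+1] : ∀ n k → suc k * (suc n C suc k) ≡ suc n * (n C k)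
  [k+1]*[n+1]C[k+1] n k = begin
    suc k * (suc n C suc k)                     ≡⟨ cong (suc k *_) (nCk+nC[k+1]≡[n+1]C[k+1] n k) ⟨
    suc k * (n C k + n C suc k)                 ≡⟨ lemma k (n C k) (n C suc k) ⟩
    n C k + (suc k * (n C suc k) + k * (n C k)) ≡⟨ cong (n C k +_) (n*nCk n k) ⟨
    suc n * (n C k)                             ∎
    where
    open ≡-Reasoning
    lemma : ∀ k x y → suc k * (x + y) ≡ x + (suc k * y + k * x)
    lemma = solve-∀

  -- By absorption `p` divides k C(p, k), and it does not divide k < p.
  prime∣pCk : ∀ {p} → Prime p → ∀ k → 0 < k → k < p → p ∣ p C k
  prime∣pCk {suc p} pr (suc k) _ k<p with euclidsLemma (suc k) (suc p C suc k) pr (subst (suc p ∣_) (sym ([k+1]*[n+1]C[k+1] p k)) (m∣m*n (p C k)))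
  ... | inj₁ p∣k = contradiction (∣⇒≤ p∣k) (<⇒≱ k<p)
  ... | inj₂ p∣C = p∣C

  Form : Set
  Form = ℕ × ℕ × ℕ

  value : Form → ℕ → ℕ → ℕ
  value (α , β , γ) x y = α + β * x + γ * y

  values : List Form → ℕ → ℕ → ℕ
  values [] x y = 1
  values (l ∷ ls) x y = value l x y * values ls x y

  module _ {p : ℕ} (pr : Prime p) where

    -- A product of few linear forms sums to zero over the plane; the monomials
    -- are replaced by binomials since these have sums C(p, a+1).
    private
      Vanishes : (ℕ → ℕ → ℕ) → Set
      Vanishes g = p ∣ Σ[ p <] (λ x → Σ[ p <] (λ y → g x y))

      vanishes-cong : ∀ {f g} → (∀ x y → f x y ≡ g x y) → Vanishes g → Vanishes f
      vanishes-cong e = subst (p ∣_) (sym (Σ-cong p (λ x → Σ-cong p (e x))))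

      vanishes-+ : ∀ {f g} → Vanishes f → Vanishes g → Vanishes (λ x y → f x y + g x y)
      vanishes-+ {f} {g} vf vg = subst (p ∣_) (sym (trans (Σ-cong p (λ x → Σ-+ p (f x) (g x))) (Σ-+ p _ _))) (∣m∣n⇒∣m+n vf vg)

      vanishes-* : ∀ c {f} → Vanishes f → Vanishes (λ x y → c * f x y)
      vanishes-* c {f} vf = subst (p ∣_) (sym (trans (Σ-cong p (λ x → Σ-* p c (f x))) (Σ-* p c _))) (∣n⇒∣m*n c vf)

    vanish : ∀ ls a b → a + b + length ls < 2 * (p ∸ 1) → Vanishes (λ x y → (x C a) * (y C b) * values ls x y)
    -- Since a + b < 2 (p - 1), one of the two degrees is below p - 1, and summing its binomial
    -- gives an inner binomial coefficient of `p`.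
    vanish [] a b a+b< with suc b <? p
    ... | yes b<p = ∣-Σ p (λ x _ → subst (p ∣_) (sym (trans (Σ-cong p (λ y → *-identityʳ ((x C a) * (y C b)))) (trans (Σ-* p (x C a) (_C b)) (cong ((x C a) *_) (hockeyStick p b)))))
                       (∣n⇒∣m*n (x C a) (prime∣pCk pr (suc b) (s≤s z≤n) b<p)))
    ... | no b≮p = subst (p ∣_) (sym (trans (Σ-cong p (λ x → trans (Σ-cong p (λ y → trans (*-identityʳ _) (*-comm (x C a) (y C b)))) (trans (Σ-cong p (λ y → *-comm (y C b) (x C a))) (trans (Σ-* p (x C a) (_C b)) (*-comm (x C a) _))))) (trans (Σ-* p (Σ[ p <] (_C b)) (_C a)) (cong (Σ[ p <] (_C b) *_) (hockeyStick p a)))))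
        (∣n⇒∣m*n (Σ[ p <] (_C b)) (prime∣pCk pr (suc a) (s≤s z≤n) a<p))
      where
      a<p : suc a < p
      a<p = bound p (≮⇒≥ b≮p) (subst (_< 2 * (p ∸ 1)) (+-identityʳ (a + b)) a+b<)
        where
        bound : ∀ p → p ≤ suc b → a + b < 2 * (p ∸ 1) → suc a < p
        bound (suc m) (s≤s m≤b) lt = s≤s (+-cancelʳ-< b a m (<-≤-trans lt (+-monoʳ-≤ m (subst (_≤ b) (sym (+-identityʳ m)) m≤b))))
    -- The form taken off the list pays for the degree that its linear terms add, so the bound on a
    -- + b + length persists.
    vanish ((α , β , γ) ∷ ls) a b lt =
      vanishes-cong (λ x y → trans (lemma₁ (x C a) (y C b) α β γ x y (values ls x y)) (trans (cong₂ (λ s t → α * ((x C a) * (y C b) * values ls x y) + β * (s * (y C b) * values ls x y) + γ * ((x C a) * t * values ls x y)) (n*nCk x a) (n*nCk y b)) (lemma₂ (x C a) (x C suc a) (y C b) (y C suc b) a b α β γ (values ls x y))))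
        (vanishes-+ (vanishes-+ (vanishes-* α v) (vanishes-* β (vanishes-+ (vanishes-* (suc a) v₁) (vanishes-* a v)))) (vanishes-* γ (vanishes-+ (vanishes-* (suc b) v₂) (vanishes-* b v))))
      where
      lt′ : suc (a + b + length ls) < 2 * (p ∸ 1)
      lt′ = subst (_< 2 * (p ∸ 1)) (+-suc (a + b) (length ls)) lt
      v = vanish ls a b (<-trans (n<1+n _) lt′)
      v₁ = vanish ls (suc a) b lt′
      v₂ = vanish ls a (suc b) (subst (λ z → z + length ls < 2 * (p ∸ 1)) (sym (+-suc a b)) lt′)
      lemma₁ : ∀ c d α β γ x y w → c * d * ((α + β * x + γ * y) * w) ≡ α * (c * d * w) + β * (x * c * d * w) + γ * (c * (y * d) * w)
      lemma₁ = solve-∀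
      lemma₂ : ∀ c c′ d d′ a b α β γ w → α * (c * d * w) + β * ((suc a * c′ + a * c) * d * w) + γ * (c * (suc b * d′ + b * d) * w)
        ≡ α * (c * d * w) + β * (suc a * (c′ * d * w) + a * (c * d * w)) + γ * (suc b * (c * d′ * w) + b * (c * d * w))
      lemma₂ = solve-∀

    private open module R = Residues p pr using (π; π-+; π-*; π-ι; 𝟘; _⊕_; _⊗_)

    private
      form : Fin p × Fin p × Fin p → Form
      form (α , β , γ) = toℕ α , toℕ β , toℕ γ

      value-zero : ∀ α β γ (x y : Fin p) → (α ⊕ β ⊗ x) ⊕ γ ⊗ y ≡ 𝟘 → p ∣ value (form (α , β , γ)) (toℕ x) (toℕ y)
      value-zero α β γ x y e = R.π≡𝟘⇒∣ _ (trans (trans (π-+ᴺ (toℕ α + toℕ β * toℕ x) (toℕ γ * toℕ y))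
          (cong₂ _⊕_ (trans (π-+ᴺ (toℕ α) (toℕ β * toℕ x)) (cong₂ _⊕_ (π-ι α) (πm β x))) (πm γ y))) e)
        where
        π-+ᴺ : ∀ m n → π (ℤ.+ (m + n)) ≡ π (ℤ.+ m) ⊕ π (ℤ.+ n)
        π-+ᴺ m n = trans (cong π (ℤ.pos-+ m n)) (π-+ (ℤ.+ m) (ℤ.+ n))
        πm : ∀ u v → π (ℤ.+ (toℕ u * toℕ v)) ≡ u ⊗ v
        πm u v = trans (cong π (ℤ.pos-* (toℕ u) (toℕ v))) (trans (π-* _ _) (cong₂ _⊗_ (π-ι u) (π-ι v)))

      forms : List (Fin p × Fin p × Fin p) → List Form
      forms [] = []
      forms (l ∷ ls) = form l ∷ forms ls

      length-forms : ∀ ls → length (forms ls) ≡ length ls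
      length-forms [] = refl
      length-forms (l ∷ ls) = cong suc (length-forms ls)

      values-zero : ∀ ls x y → Any (λ (l : Fin p × Fin p × Fin p) → (proj₁ l ⊕ proj₁ (proj₂ l) ⊗ x) ⊕ proj₂ (proj₂ l) ⊗ y ≡ 𝟘) ls → p ∣ values (forms ls) (toℕ x) (toℕ y)
      values-zero ((α , β , γ) ∷ ls) x y (here e) = ∣m⇒∣m*n _ (value-zero α β γ x y e)
      values-zero (l ∷ ls) x y (there h) = ∣n⇒∣m*n (value (form l) (toℕ x) (toℕ y)) (values-zero ls x y h)

      values-origin : ∀ ls → All (λ l → proj₁ l ≢ 𝟘) ls → ¬ p ∣ values (forms ls) 0 0
      values-origin [] [] p∣1 = contradiction (∣⇒≤ p∣1) (<⇒≱ R.1<p)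
      values-origin (l@(α , β , γ) ∷ ls) (α≢0 ∷ h) p∣ with euclidsLemma (value (form l) 0 0) _ pr p∣
      ... | inj₂ p∣ls = values-origin ls h p∣ls
      ... | inj₁ p∣α = R.nonzero⇒∤ α α≢0 (subst (p ∣_) (at-zero (toℕ α) (toℕ β) (toℕ γ)) p∣α)
        where
        at-zero : ∀ a b c → a + b * 0 + c * 0 ≡ a
        at-zero = solve-∀

    -- The product of the forms vanishes modulo `p` at every point but the origin, where it is a
    -- product of nonzero constants. Its sum over the plane is therefore nonzero, which `vanish`
    -- excludes for too few forms.
    jamison : (ls : List (Fin p × Fin p × Fin p)) →
      All (λ l → proj₁ l ≢ 𝟘) ls →
      (∀ x y → ¬ (x ≡ 𝟘 × y ≡ 𝟘) → Any (λ (l : Fin p × Fin p × Fin p) → (proj₁ l ⊕ proj₁ (proj₂ l) ⊗ x) ⊕ proj₂ (proj₂ l) ⊗ y ≡ 𝟘) ls) →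
      2 * (p ∸ 1) ≤ length ls
    jamison ls α≢0 cover with 2 * (p ∸ 1) ≤? length ls
    ... | yes h = h
    ... | no h = contradiction (head p refl sum-vanishes) (values-origin ls α≢0)
      where
      g : ℕ → ℕ → ℕ
      g x y = values (forms ls) x y
      sum-vanishes : p ∣ Σ[ p <] (λ x → Σ[ p <] (λ y → g x y))
      sum-vanishes = vanishes-cong (λ x y → sym (trans (*-identityˡ _) refl)) (vanish (forms ls) 0 0 (subst (_< 2 * (p ∸ 1)) (sym (length-forms ls)) (≰⇒> h)))
      zero-off-origin : ∀ x y → x < p → y < p → ¬ (x ≡ 0 × y ≡ 0) → p ∣ g x y
      zero-off-origin x y x< y< ne = subst₂ (λ s t → p ∣ g s t) (toℕ-fromℕ< x<) (toℕ-fromℕ< y<)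
        (values-zero ls (fromℕ< x<) (fromℕ< y<) (cover _ _ (λ (ex , ey) → ne
          ( trans (sym (toℕ-fromℕ< x<)) (trans (cong toℕ ex) R.toℕ-𝟘)
          , trans (sym (toℕ-fromℕ< y<)) (trans (cong toℕ ey) R.toℕ-𝟘)))))
      head : ∀ n → p ≡ n → p ∣ Σ[ n <] (λ x → Σ[ n <] (λ y → g x y)) → p ∣ g 0 0
      head zero e _ = contradiction (subst (1 <_) e R.1<p) λ ()
      head (suc n) e p∣ = ∣-Σ-head n (∣-Σ-head n p∣ (λ x 0<x x< → ∣-Σ (suc n) (λ y y< → off x y x< y< (λ (x≡0 , _) → <-irrefl (sym x≡0) 0<x))))
          (λ y 0<y y< → off 0 y (s≤s z≤n) y< (λ (_ , y≡0) → <-irrefl (sym y≡0) 0<y))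
        where
        off : ∀ x y → x < suc n → y < suc n → ¬ (x ≡ 0 × y ≡ 0) → p ∣ g x y
        off x y x< y< = zero-off-origin x y (subst (x <_) (sym e) x<) (subst (y <_) (sym e) y<)

  primeField : ∀ {p} → Prime p → Field p
  primeField {p} pr = record
    { Residues p pr
    ; π-0 = refl
    ; π-1 = refl
    ; jamison = jamison pr }

-- Counting by matchings and filters.

module Lists where

  open import Data.Nat
  open import Data.Nat.Properties
  open import Data.List using ([_]; _++_; filter)
  open import Data.List.Membership.Propositional.Properties using (∈-∃++; ∈-++⁻; ∈-++⁺ˡ; ∈-++⁺ʳ)
  open import Data.List.Relation.Unary.All using (lookup)

  module _ {A : Set} where

    length-insert : ∀ (ys : List A) {y zs} → length (ys ++ [ y ] ++ zs) ≡ suc (length (ys ++ zs))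
    length-insert [] = refl
    length-insert (_ ∷ ys) = cong suc (length-insert ys)

    ∈-remove : ∀ (ys : List A) {x y zs} → x ∈ ys ++ [ y ] ++ zs → x ≢ y → x ∈ ys ++ zs
    ∈-remove ys {zs = zs} x∈ x≢y with ∈-++⁻ ys x∈
    ... | inj₁ h = ∈-++⁺ˡ h
    ... | inj₂ (here e) = contradiction e x≢y
    ... | inj₂ (there h) = ∈-++⁺ʳ ys h

    ∈-reinsert : ∀ (ys : List A) {x y zs} → x ∈ ys ++ zs → x ∈ ys ++ [ y ] ++ zs
    ∈-reinsert ys x∈ with ∈-++⁻ ys x∈
    ... | inj₁ h = ∈-++⁺ˡ h
    ... | inj₂ h = ∈-++⁺ʳ ys (there h)

  module _ {A B : Set} (R : A → B → Set) where

    -- Each entry of `xs` takes a partner out of `ys`; no later entry can want the same partner,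
    -- which is related to one entry only.
    matching-≤ : ∀ {xs} → Unique xs → (ys : List B) →
      (∀ {x} → x ∈ xs → ∃ λ y → y ∈ ys × R x y) →
      (∀ {x x′ y} → x ∈ xs → x′ ∈ xs → y ∈ ys → R x y → R x′ y → x ≡ x′) →
      length xs ≤ length ys
    matching-≤ [] ys total inj = z≤n
    matching-≤ {x ∷ xs} (x∉ ∷ u) ys total inj with total (here refl)
    ... | y , y∈ , Rxy with ∈-∃++ y∈
    ... | ys₁ , ys₂ , refl = ≤-trans (s≤s (matching-≤ u (ys₁ ++ ys₂) total′ (λ p p′ q → inj (there p) (there p′) (∈-reinsert ys₁ q)))) (≤-reflexive (sym (length-insert ys₁)))
      where
      total′ : ∀ {x′} → x′ ∈ xs → ∃ λ y′ → y′ ∈ ys₁ ++ ys₂ × R x′ y′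
      total′ x′∈ with total (there x′∈)
      ... | y′ , y′∈ , Rx′y′ = y′ , ∈-remove ys₁ y′∈ (λ { refl → lookup x∉ x′∈ (inj (here refl) (there x′∈) y∈ Rxy Rx′y′) }) , Rx′y′

  unique-⊆-≤ : ∀ {A : Set} {xs : List A} → Unique xs → (ys : List A) → (∀ {x} → x ∈ xs → x ∈ ys) → length xs ≤ length ys
  unique-⊆-≤ u ys sub = matching-≤ _≡_ u ys (λ {x} x∈ → x , sub x∈ , refl) (λ _ _ _ e e′ → trans e (sym e′))

  module _ {A : Set} {P Q : A → Set} (P? : Decidable P) (Q? : Decidable Q) where

    -- Inclusion-exclusion: an entry kept by both filters is paid for a second time by `R`.
    length-filters : (∀ x → P x ⊎ Q x) → ∀ {R : A → Set} (R? : Decidable R) → (∀ x → P x → Q x → R x) →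
      ∀ xs → length (filter P? xs) + length (filter Q? xs) ≤ length xs + length (filter R? xs)
    length-filters or R? and [] = z≤n
    length-filters or R? and (x ∷ xs) with P? x | Q? x | R? x | length-filters or R? and xs
    ... | yes p | yes q | yes r | ih = s≤s (subst₂ _≤_ (sym (+-suc _ _)) (sym (+-suc _ _)) (s≤s ih))
    ... | yes p | yes q | no ¬r | ih = contradiction (and x p q) ¬r
    ... | yes p | no ¬q | yes r | ih = s≤s (≤-trans ih (+-monoʳ-≤ (length xs) (n≤1+n _)))
    ... | yes p | no ¬q | no ¬r | ih = s≤s ih
    ... | no ¬p | yes q | yes r | ih = ≤-trans (≤-reflexive (+-suc _ _)) (s≤s (≤-trans ih (+-monoʳ-≤ (length xs) (n≤1+n _))))
    ... | no ¬p | yes q | no ¬r | ih = ≤-trans (≤-reflexive (+-suc _ _)) (s≤s ih)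
    ... | no ¬p | no ¬q | _ | ih with or x
    ... | inj₁ p = contradiction p ¬p
    ... | inj₂ q = contradiction q ¬q

-- The affine plane, the tangents of a parabola, and covers by lines missing the origin.

module Plane {q : ℕ} (K : Field q) (n : Fin q) (nonSquare : ∀ x → Field._⊗_ K x x ≢ n)
  (two≢𝟘 : Field._⊕_ K (Field.𝟙 K) (Field.𝟙 K) ≢ Field.𝟘 K) (h : ℕ) (odd : q ≡ suc (2 * h)) where

  open FiniteFields


  open Lists
  open Field K
  open import Algebra.Bundles using (CommutativeRing)
  open CommutativeRing commutativeRing using () renaming (+-comm to ⊕-comm; *-comm to ⊗-comm; zeroˡ to ⊗-zeroˡ; zeroʳ to ⊗-zeroʳ; *-identityˡ to ⊗-identityˡ; *-identityʳ to ⊗-identityʳ; +-identityʳ to ⊕-identityʳ; +-identityˡ to ⊕-identityˡ; *-assoc to ⊗-assoc; -‿inverseʳ to ⊖-inverse)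
  open Solver using (solve; _:+_; _:*_; :-_; _:-_; _:=_)
  open import Data.Nat as ℕ using (_≤_; z≤n; s≤s)
  import Data.Nat.Tactic.RingSolver as ℕ
  import Data.Nat.Properties as ℕ
  open import Data.Fin using (toℕ; _≟_)
  open import Data.Fin.Properties using (any?; toℕ-injective)
  open import Data.List using ([_]; _++_; map; filter; allFin)
  open import Data.List.Properties using (length-map; length-++; length-tabulate)
  open import Data.List.Membership.Propositional.Properties
  import Data.List.Relation.Unary.All as All
  import Data.List.Relation.Unary.All.Properties as All
  import Data.List.Relation.Unary.Unique.Propositional.Properties as Unique
  import Data.Product.Properties as ×
  open import Relation.Nullary.Decidable using (¬?)

  F : Set
  F = Fin q

  inv : F → F
  inv x with x ≟ 𝟘
  ... | yes _ = 𝟘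
  ... | no x≢0 = proj₁ (inverse x x≢0)

  inv-right : ∀ {x} → x ≢ 𝟘 → x ⊗ inv x ≡ 𝟙
  inv-right {x} x≢0 with x ≟ 𝟘
  ... | yes e = contradiction e x≢0
  ... | no ne = proj₂ (inverse x ne)

  cancel : ∀ {x y} → x ⊗ y ≡ 𝟘 → x ≢ 𝟘 → y ≡ 𝟘
  cancel {x} {y} e x≢0 = begin
    y                 ≡⟨ ⊗-identityˡ y ⟨
    𝟙 ⊗ y             ≡⟨ cong (_⊗ y) (trans (⊗-comm (inv x) x) (inv-right x≢0)) ⟨
    inv x ⊗ x ⊗ y     ≡⟨ ⊗-assoc (inv x) x y ⟩
    inv x ⊗ (x ⊗ y)   ≡⟨ cong (inv x ⊗_) e ⟩
    inv x ⊗ 𝟘         ≡⟨ ⊗-zeroʳ (inv x) ⟩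
    𝟘                 ∎
    where open ≡-Reasoning

  ⊖≡𝟘⇒≡ : ∀ {x y} → x ⊖ y ≡ 𝟘 → x ≡ y
  ⊖≡𝟘⇒≡ {x} {y} e = trans (solve 2 (λ x y → x := (x :+ :- y) :+ y) refl x y) (trans (cong (_⊕ y) e) (⊕-identityˡ y))

  ≡⇒⊖≡𝟘 : ∀ {x y} → x ≡ y → x ⊖ y ≡ 𝟘
  ≡⇒⊖≡𝟘 {x} refl = ⊖-inverse x

  data Dir : Set where
    fin : F → Dir
    inf : Dir

  fin-injective : ∀ {s t} → fin s ≡ fin t → s ≡ t
  fin-injective refl = refl

  infix 4 _≟ᴰ_
  _≟ᴰ_ : (i j : Dir) → Dec (i ≡ j)
  fin s ≟ᴰ fin t with s ≟ t
  ... | yes refl = yes refl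
  ... | no ne = no (ne ∘ fin-injective)
  fin s ≟ᴰ inf = no λ ()
  inf ≟ᴰ fin t = no λ ()
  inf ≟ᴰ inf = yes refl

  dirs : List Dir
  dirs = inf ∷ map fin (allFin q)

  ∈-dirs : ∀ i → i ∈ dirs
  ∈-dirs (fin s) = there (∈-map⁺ fin (∈-allFin s))
  ∈-dirs inf = here refl

  unique-dirs : Unique dirs
  unique-dirs = All.map⁺ (All.universal (λ _ ()) (allFin q)) ∷ Unique.map⁺ fin-injective (Unique.allFin⁺ q)

  length-dirs : length dirs ≡ suc q
  length-dirs = cong suc (trans (length-map fin (allFin q)) (length-tabulate (λ (i : F) → i)))

  Pos : Set
  Pos = F × F

  origin : Pos
  origin = 𝟘 , 𝟘

  -- The line of direction i through p is determined by the intercept of p.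
  intercept : Dir → Pos → F
  intercept (fin s) (x , y) = y ⊖ s ⊗ x
  intercept inf (x , y) = x

  Line : Set
  Line = Dir × F

  infix 4 _on_
  _on_ : Pos → Line → Set
  p on (i , e) = intercept i p ≡ e

  -- The origin is the removed point; the lines of intercept `𝟘` pass through it and are the broken
  -- ones.
  Proper : Line → Set
  Proper (i , e) = e ≢ 𝟘

  on? : ∀ p ℓ → Dec (p on ℓ)
  on? p (i , e) = intercept i p ≟ e

  intercept-origin : ∀ i → intercept i origin ≡ 𝟘
  intercept-origin inf = refl
  intercept-origin (fin s) = trans (cong (𝟘 ⊖_) (⊗-zeroʳ s)) (⊖-inverse 𝟘)

  meet : ∀ {p p′} i j → i ≢ j → intercept i p ≡ intercept i p′ → intercept j p ≡ intercept j p′ → p ≡ p′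
  meet-fin : ∀ {p p′} s → proj₁ p ≡ proj₁ p′ → intercept (fin s) p ≡ intercept (fin s) p′ → p ≡ p′
  meet-fin {x , y} {.x , y′} s refl e = cong (x ,_) (trans (solve 3 (λ y s x → y := (y :- s :* x) :+ s :* x) refl y s x)
    (trans (cong (_⊕ s ⊗ x) e) (solve 3 (λ y s x → (y :- s :* x) :+ s :* x := y) refl y′ s x)))
  meet inf inf ne _ _ = contradiction refl ne
  meet inf (fin s) ne e e′ = meet-fin s e e′
  meet (fin s) inf ne e e′ = meet-fin s e′ e
  meet {x , y} {x′ , y′} (fin s) (fin t) ne e e′ = meet-fin s (⊖≡𝟘⇒≡ (cancel product (λ z → ne (cong fin (sym (⊖≡𝟘⇒≡ z)))))) e
    where
    product : (t ⊖ s) ⊗ (x ⊖ x′) ≡ 𝟘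
    product = begin
      (t ⊖ s) ⊗ (x ⊖ x′)
        ≡⟨ solve 6 (λ s t x x′ y y′ → (t :- s) :* (x :- x′) := ((y :- s :* x) :- (y′ :- s :* x′)) :- ((y :- t :* x) :- (y′ :- t :* x′))) refl s t x x′ y y′ ⟩
      ((y ⊖ s ⊗ x) ⊖ (y′ ⊖ s ⊗ x′)) ⊖ ((y ⊖ t ⊗ x) ⊖ (y′ ⊖ t ⊗ x′))
        ≡⟨ cong₂ _⊖_ (≡⇒⊖≡𝟘 e) (≡⇒⊖≡𝟘 e′) ⟩
      𝟘 ⊖ 𝟘 ≡⟨ ⊖-inverse 𝟘 ⟩
      𝟘 ∎
      where open ≡-Reasoning

  meet-origin : ∀ {p} i j → i ≢ j → intercept i p ≡ 𝟘 → intercept j p ≡ 𝟘 → p ≡ origin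
  meet-origin i j ne e e′ = meet i j ne (trans e (sym (intercept-origin i))) (trans e′ (sym (intercept-origin j)))

  join : ∀ p p′ → ∃ λ i → intercept i p ≡ intercept i p′
  join (x , y) (x′ , y′) with x ≟ x′
  ... | yes e = inf , e
  ... | no ne = fin s , ⊖≡𝟘⇒≡ (begin
      (y ⊖ s ⊗ x) ⊖ (y′ ⊖ s ⊗ x′)   ≡⟨ solve 6 (λ d i x x′ y y′ → (y :- (d :* i) :* x) :- (y′ :- (d :* i) :* x′) := (y :- y′) :- d :* ((x :- x′) :* i)) refl d i x x′ y y′ ⟩
      (y ⊖ y′) ⊖ d ⊗ ((x ⊖ x′) ⊗ i) ≡⟨ cong (λ z → (y ⊖ y′) ⊖ d ⊗ z) (inv-right (ne ∘ ⊖≡𝟘⇒≡)) ⟩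
      (y ⊖ y′) ⊖ d ⊗ 𝟙              ≡⟨ cong ((y ⊖ y′) ⊖_) (⊗-identityʳ d) ⟩
      (y ⊖ y′) ⊖ (y ⊖ y′)           ≡⟨ ⊖-inverse _ ⟩
      𝟘 ∎)
    where
    open ≡-Reasoning
    d = y ⊖ y′
    i = inv (x ⊖ x′)
    s = d ⊗ i

  -- The broken line that a position lies on; at the origin, which lies on all of them, the value is
  -- arbitrary.
  dir : Pos → Dir
  dir p = proj₁ (join p origin)

  dir-spec : ∀ p → intercept (dir p) p ≡ 𝟘
  dir-spec p = trans (proj₂ (join p origin)) (intercept-origin (dir p))

  dir-unique : ∀ {p} j → p ≢ origin → intercept j p ≡ 𝟘 → dir p ≡ j
  dir-unique {p} j p≢0 e with dir p ≟ᴰ j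
  ... | yes h = h
  ... | no h = contradiction (meet-origin (dir p) j h (dir-spec p) e) p≢0

  point : Line → F → Pos
  point (fin s , e) c = c , s ⊗ c ⊕ e
  point (inf , e) c = e , c

  point-on : ∀ ℓ c → point ℓ c on ℓ
  point-on (fin s , e) c = solve 3 (λ s c e → (s :* c :+ e) :- s :* c := e) refl s c e
  point-on (inf , e) c = refl

  point-injective : ∀ ℓ {c c′} → point ℓ c ≡ point ℓ c′ → c ≡ c′
  point-injective (fin s , e) h = cong proj₁ h
  point-injective (inf , e) h = cong proj₂ h

  point-origin : ∀ i → point (i , 𝟘) 𝟘 ≡ origin
  point-origin (fin s) = cong (𝟘 ,_) (trans (cong (_⊕ 𝟘) (⊗-zeroʳ s)) (⊕-identityʳ 𝟘))
  point-origin inf = refl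

  nonzeros : List F
  nonzeros = filter (λ c → ¬? (c ≟ 𝟘)) (allFin q)

  ∈-nonzeros : ∀ {c} → c ≢ 𝟘 → c ∈ nonzeros
  ∈-nonzeros {c} c≢0 = ∈-filter⁺ (λ c → ¬? (c ≟ 𝟘)) (∈-allFin c) c≢0

  nonzeros-≢ : ∀ {c} → c ∈ nonzeros → c ≢ 𝟘
  nonzeros-≢ c∈ = proj₂ (∈-filter⁻ (λ c → ¬? (c ≟ 𝟘)) {xs = allFin q} c∈)

  unique-nonzeros : Unique nonzeros
  unique-nonzeros = Unique.filter⁺ (λ c → ¬? (c ≟ 𝟘)) (Unique.allFin⁺ q)

  length-allFin : length (allFin q) ≡ q
  length-allFin = length-tabulate (λ (i : F) → i)

  length-nonzeros : q ≤ suc (length nonzeros)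
  length-nonzeros = subst (_≤ suc (length nonzeros)) length-allFin (unique-⊆-≤ (Unique.allFin⁺ q) (𝟘 ∷ nonzeros) split)
    where
    split : ∀ {c} → c ∈ allFin q → c ∈ 𝟘 ∷ nonzeros
    split {c} _ with c ≟ 𝟘
    ... | yes e = here e
    ... | no ne = there (∈-nonzeros ne)

  Covers : List Line → Pos → Set
  Covers ℓs p = ∃ λ ℓ → ℓ ∈ ℓs × p on ℓ

  module _ {ℓs : List Line} (proper : ∀ {ℓ} → ℓ ∈ ℓs → Proper ℓ) where

    -- A proper line meets the broken line `l` in at most one of its q - 1 positions.
    ray-cover : ∀ l → (∀ p → p ≢ origin → intercept l p ≡ 𝟘 → Covers ℓs p) → q ≤ suc (length ℓs)
    ray-cover l cover = ℕ.≤-trans length-nonzeros (s≤s (matching-≤ (λ c ℓ → point (l , 𝟘) c on ℓ) unique-nonzeros ℓs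
      (λ {c} c∈ → cover (point (l , 𝟘) c) (λ e → nonzeros-≢ c∈ (point-injective (l , 𝟘) (trans e (sym (point-origin l))))) (point-on (l , 𝟘) c))
      λ { {c} {c′} {i , e} c∈ c′∈ ℓ∈ h h′ → point-injective (l , 𝟘) (meet i l
           (λ { refl → proper ℓ∈ (trans (sym h) (point-on (l , 𝟘) c)) })
           (trans h (sym h′)) (trans (point-on (l , 𝟘) c) (sym (point-on (l , 𝟘) c′)))) }))

    -- When the line itself is missing from the list, every other line covers at most one of its q
    -- points.
    parallel-cover : ∀ i e → ¬ (i , e) ∈ ℓs → (∀ p → intercept i p ≡ e → Covers ℓs p) → q ≤ length ℓs
    parallel-cover i e ∉ cover = subst (_≤ length ℓs) length-allFin (matching-≤ (λ c ℓ → point (i , e) c on ℓ) (Unique.allFin⁺ q) ℓs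
      (λ {c} _ → cover (point (i , e) c) (point-on (i , e) c))
      λ { {c} {c′} {j , e′} _ _ ℓ∈ h h′ → point-injective (i , e) (meet j i
           (λ { refl → ∉ (subst (λ z → (j , z) ∈ ℓs) (trans (sym h) (point-on (i , e) c)) ℓ∈) })
           (trans h (sym h′)) (trans (point-on (i , e) c) (sym (point-on (i , e) c′)))) })

    plane-cover : (∀ p → p ≢ origin → Covers ℓs p) → 2 ℕ.* (q ℕ.∸ 1) ≤ length ℓs
    plane-cover cover = subst (2 ℕ.* (q ℕ.∸ 1) ≤_) (length-map form ℓs) (jamison (map form ℓs) (All.map⁺ (All.tabulate (λ { {ℓ} ℓ∈ → const≢0 ℓ (proper ℓ∈) })))
      (λ x y ne → zero-form x y (cover (x , y) (λ { refl → ne (refl , refl) }))))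
      where
      form : Line → F × F × F
      form (fin s , e) = e , s , neg 𝟙
      form (inf , e) = e , neg 𝟙 , 𝟘
      const≢0 : ∀ ℓ → Proper ℓ → proj₁ (form ℓ) ≢ 𝟘
      const≢0 (fin s , e) h = h
      const≢0 (inf , e) h = h
      zero-on : ∀ ℓ x y → (x , y) on ℓ → (proj₁ (form ℓ) ⊕ proj₁ (proj₂ (form ℓ)) ⊗ x) ⊕ proj₂ (proj₂ (form ℓ)) ⊗ y ≡ 𝟘
      zero-on (fin s , e) x y refl = trans (solve 4 (λ s x y o → ((y :- s :* x) :+ s :* x) :+ (:- o) :* y := y :- o :* y) refl s x y 𝟙) (≡⇒⊖≡𝟘 (sym (⊗-identityˡ y)))
      zero-on (inf , e) x y refl = trans (cong ((x ⊕ neg 𝟙 ⊗ x) ⊕_) (⊗-zeroˡ y)) (trans (⊕-identityʳ _)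
        (trans (solve 2 (λ x o → x :+ (:- o) :* x := x :- o :* x) refl x 𝟙) (≡⇒⊖≡𝟘 (sym (⊗-identityˡ x)))))
      zero-form : ∀ x y → Covers ℓs (x , y) → Any (λ l → (proj₁ l ⊕ proj₁ (proj₂ l) ⊗ x) ⊕ proj₂ (proj₂ l) ⊗ y ≡ 𝟘) (map form ℓs)
      zero-form x y (ℓ , ℓ∈ , h) = lose-map ℓ∈
        where
        lose-map : ∀ {ℓs} → ℓ ∈ ℓs → Any (λ l → (proj₁ l ⊕ proj₁ (proj₂ l) ⊗ x) ⊕ proj₂ (proj₂ l) ⊗ y ≡ 𝟘) (map form ℓs)
        lose-map (here refl) = here (zero-on ℓ x y h)
        lose-map (there m) = there (lose-map m)

  -- The tangents y = u x - u² + n of a parabola, one for every direction other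
  -- than inf; node u v is the point where the tangents u and v meet.
  tangent : F → Line
  tangent u = fin u , n ⊖ u ⊗ u

  node : F → F → Pos
  node u v = u ⊕ v , u ⊗ v ⊕ n

  node-comm : ∀ u v → node u v ≡ node v u
  node-comm u v = cong₂ _,_ (⊕-comm u v) (cong (_⊕ n) (⊗-comm u v))

  -- The reason for choosing a nonsquare: the tangent `u` contains the origin exactly when n = u².
  tangent-proper : ∀ u → Proper (tangent u)
  tangent-proper u e = nonSquare u (sym (⊖≡𝟘⇒≡ e))

  node-on : ∀ u v → node u v on tangent u
  node-on u v = solve 3 (λ u v n → (u :* v :+ n) :- u :* (u :+ v) := n :- u :* u) refl u v n

  node-on′ : ∀ u v → node u v on tangent v
  node-on′ u v = subst (_on tangent v) (node-comm v u) (node-on v u)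

  on-tangent : ∀ u p → p on tangent u → p ≡ node u (proj₁ p ⊖ u)
  on-tangent u (x , y) e = cong₂ _,_ (solve 2 (λ u x → x := u :+ (x :- u)) refl u x)
    (trans (solve 3 (λ y u x → y := (y :- u :* x) :+ u :* x) refl y u x)
      (trans (cong (_⊕ u ⊗ x) e) (solve 3 (λ n u x → (n :- u :* u) :+ u :* x := u :* (x :- u) :+ n) refl n u x)))

  zero-product : ∀ {x y} → x ⊗ y ≡ 𝟘 → x ≡ 𝟘 ⊎ y ≡ 𝟘
  zero-product {x} e with x ≟ 𝟘
  ... | yes x≡0 = inj₁ x≡0
  ... | no x≢0 = inj₂ (cancel e x≢0)

  -- Inserting the node into the equation of the tangent gives (a - u) (b - u) = 0. Hence no point
  -- lies on a third tangent.
  node-on-tangent : ∀ u a b → node a b on tangent u → a ≡ u ⊎ b ≡ u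
  node-on-tangent u a b e with zero-product (trans (solve 4 (λ a b u n → (a :- u) :* (b :- u) := ((a :* b :+ n) :- u :* (a :+ b)) :- (n :- u :* u)) refl a b u n) (≡⇒⊖≡𝟘 e))
  ... | inj₁ h = inj₁ (⊖≡𝟘⇒≡ h)
  ... | inj₂ h = inj₂ (⊖≡𝟘⇒≡ h)

  node≢origin : ∀ u v → node u v ≢ origin
  node≢origin u v e = tangent-proper u (trans (sym (node-on u v)) (trans (cong (intercept (fin u)) e) (intercept-origin (fin u))))

  Node : Pos → Set
  Node p = ∃₂ λ u v → p ≡ node u v

  node? : ∀ p → Dec (Node p)
  node? p = any? (λ u → any? (λ v → ×.≡-dec _≟_ _≟_ p (node u v)))

  module _ (σ : F → F) (involutive : ∀ u → σ (σ u) ≡ u)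
    (fixed : List F) (fixed≤3 : length fixed ≤ 3) (∈-fixed : ∀ u → σ u ≡ u → u ∈ fixed) where

    representatives : List F
    representatives = filter (λ u → toℕ u ℕ.≤? toℕ (σ u)) (allFin q)

    represented : ∀ u → u ∈ representatives ⊎ σ u ∈ representatives
    represented u with ℕ.≤-total (toℕ u) (toℕ (σ u))
    ... | inj₁ le = inj₁ (∈-filter⁺ (λ u → toℕ u ℕ.≤? toℕ (σ u)) (∈-allFin u) le)
    ... | inj₂ ge = inj₂ (∈-filter⁺ (λ u → toℕ u ℕ.≤? toℕ (σ u)) (∈-allFin (σ u)) (subst (λ v → toℕ (σ u) ≤ toℕ v) (sym (involutive u)) ge))

    -- The indices with u ≤ σ u and those with σ u ≤ u exhaust the field, are matched by σ, and
    -- share only the fixed points; so twice the number of representatives is at most q + 3 = 2 (h +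
    -- 2).
    length-representatives : length representatives ≤ suc (suc h)
    length-representatives = ℕ.*-cancelˡ-≤ 2 (ℕ.≤-trans (ℕ.+-monoʳ-≤ r (subst (_≤ b) (sym (ℕ.+-identityʳ r)) r≤b))
      (ℕ.≤-trans (length-filters (λ u → toℕ u ℕ.≤? toℕ (σ u)) (λ u → toℕ (σ u) ℕ.≤? toℕ u) (λ u → ℕ.≤-total (toℕ u) (toℕ (σ u)))
          (λ u → σ u ≟ u) (λ u le ge → toℕ-injective (ℕ.≤-antisym ge le)) (allFin q))
      (ℕ.≤-trans (ℕ.+-mono-≤ (ℕ.≤-reflexive (trans length-allFin odd)) fixes≤3) (ℕ.≤-reflexive (arith h)))))
      where
      r b : ℕ
      r = length representatives
      b = length (filter (λ u → toℕ (σ u) ℕ.≤? toℕ u) (allFin q))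
      r≤b : r ≤ b
      r≤b = matching-≤ (λ u v → v ≡ σ u) (Unique.filter⁺ _ (Unique.allFin⁺ q)) _
        (λ {u} u∈ → σ u , ∈-filter⁺ (λ u → toℕ (σ u) ℕ.≤? toℕ u) (∈-allFin (σ u))
            (subst (λ v → toℕ v ≤ toℕ (σ u)) (sym (involutive u)) (proj₂ (∈-filter⁻ (λ u → toℕ u ℕ.≤? toℕ (σ u)) {xs = allFin q} u∈))) , refl)
        (λ {u} {u′} _ _ _ e e′ → trans (sym (involutive u)) (trans (cong σ (trans (sym e) e′)) (involutive u′)))
      fixes≤3 : length (filter (λ u → σ u ≟ u) (allFin q)) ≤ 3
      fixes≤3 = ℕ.≤-trans (unique-⊆-≤ (Unique.filter⁺ _ (Unique.allFin⁺ q)) fixed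
        (λ {u} u∈ → ∈-fixed u (proj₂ (∈-filter⁻ (λ u → σ u ≟ u) {xs = allFin q} u∈)))) fixed≤3
      arith : ∀ h → suc (2 * h) ℕ.+ 3 ≡ 2 * suc (suc h)
      arith = ℕ.solve-∀

  -- The points on the broken line l which lie on a tangent or on x = 1. Nodes are
  -- paired by an involution, so there are only about q/2 of them.
  record Defects (l : Dir) : Set where
    field
      list : List Pos
      length≤ : length list ≤ suc (suc h)
      contained : ∀ {p} → p ∈ list → p ≢ origin × intercept l p ≡ 𝟘
      complete : ∀ p → p ≢ origin → intercept l p ≡ 𝟘 → Node p ⊎ proj₁ p ≡ 𝟙 → p ∈ list

  module _ {l : Dir} (σ : F → F) (involutive : ∀ u → σ (σ u) ≡ u)
    (fixed : List F) (fixed≤3 : length fixed ≤ 3) (∈-fixed : ∀ u → σ u ≡ u → u ∈ fixed)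
    (f : F → Pos) (f-σ : ∀ u → f (σ u) ≡ f u) (f-on : ∀ u → f u ≢ origin × intercept l (f u) ≡ 𝟘)
    (f-onto : ∀ p → p ≢ origin → intercept l p ≡ 𝟘 → Node p ⊎ proj₁ p ≡ 𝟙 → ∃ λ u → p ≡ f u) where

    paired-defects : Defects l
    paired-defects = record
      { list = map f reps
      ; length≤ = subst (_≤ suc (suc h)) (sym (length-map f reps)) (length-representatives σ involutive fixed fixed≤3 ∈-fixed)
      ; contained = contained
      ; complete = complete }
      where
      reps = representatives σ involutive fixed fixed≤3 ∈-fixed
      contained : ∀ {p} → p ∈ map f reps → p ≢ origin × intercept l p ≡ 𝟘
      contained p∈ with ∈-map⁻ f p∈
      ... | u , _ , refl = f-on u
      complete : ∀ p → p ≢ origin → intercept l p ≡ 𝟘 → Node p ⊎ proj₁ p ≡ 𝟙 → p ∈ map f reps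
      complete p p≢0 on-l special with f-onto p p≢0 on-l special
      ... | u , refl with represented σ involutive fixed fixed≤3 ∈-fixed u
      ... | inj₁ u∈ = ∈-map⁺ f u∈
      ... | inj₂ σu∈ = subst (_∈ map f reps) (f-σ u) (∈-map⁺ f σu∈)

  -- The tangents meeting at a node on x = 0 have indices u and - u, and x = 1 does not meet x = 0.
  -- Negation fixes `𝟘` only, as 2 is nonzero.
  defects-inf : Defects inf
  defects-inf = paired-defects neg neg-neg [ 𝟘 ] (s≤s z≤n) self-neg (λ u → node u (neg u))
    (λ u → trans (cong (node (neg u)) (neg-neg u)) (node-comm (neg u) u))
    (λ u → node≢origin u (neg u) , ⊖-inverse u) onto
    where
    neg-neg : ∀ u → neg (neg u) ≡ u
    neg-neg = solve 1 (λ u → :- (:- u) := u) refl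
    self-neg : ∀ u → neg u ≡ u → u ∈ [ 𝟘 ]
    self-neg u e = here (cancel (trans (solve 2 (λ o u → (o :+ o) :* u := o :* u :+ o :* u) refl 𝟙 u)
      (trans (cong₂ _⊕_ (⊗-identityˡ u) (trans (⊗-identityˡ u) (sym e))) (⊖-inverse u))) two≢𝟘)
    onto : ∀ p → p ≢ origin → intercept inf p ≡ 𝟘 → Node p ⊎ proj₁ p ≡ 𝟙 → ∃ λ u → p ≡ node u (neg u)
    onto p _ e (inj₂ e′) = contradiction (trans (sym e′) e) 𝟙≢𝟘
    onto p _ e (inj₁ (u , v , refl)) = u , cong (node u) (trans (solve 2 (λ u v → v := (u :+ v) :- u) refl u v) (trans (cong (_⊖ u) e) (⊕-identityˡ (neg u))))

  solution-unique : ∀ {v a b} → v ≢ 𝟘 → v ⊗ a ≡ v ⊗ b → a ≡ b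
  solution-unique {v} {a} {b} v≢0 e = ⊖≡𝟘⇒≡ (cancel (trans (solve 3 (λ v a b → v :* (a :- b) := v :* a :- v :* b) refl v a b) (≡⇒⊖≡𝟘 e)) v≢0)

  -- The node of u and v lies on y = s x if and only if (u - s) (v - s) = s² - n, and s² - n is
  -- nonzero. So u determines v by an involution of the indices other than s, fixing at most two of
  -- them, namely s plus a square root of s² - n. The spare index s stands for the point (1, s) on x
  -- = 1.
  defects-fin : ∀ s → Defects (fin s)
  defects-fin s = paired-defects σ involutive (proj₁ fixed) (proj₁ (proj₂ fixed)) (proj₂ (proj₂ fixed)) f f-σ f-on onto
    where
    c : F
    c = s ⊗ s ⊖ n
    c≢0 : c ≢ 𝟘
    c≢0 e = nonSquare s (⊖≡𝟘⇒≡ e)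
    ⊖≢ : ∀ {u} → u ≢ s → u ⊖ s ≢ 𝟘
    ⊖≢ ne e = ne (⊖≡𝟘⇒≡ e)
    partner : F → F
    partner u = s ⊕ c ⊗ inv (u ⊖ s)
    partner-spec : ∀ {u} → u ≢ s → (u ⊖ s) ⊗ (partner u ⊖ s) ≡ c
    partner-spec {u} ne = begin
      (u ⊖ s) ⊗ (s ⊕ c ⊗ inv (u ⊖ s) ⊖ s) ≡⟨ solve 4 (λ w s c i → w :* ((s :+ c :* i) :- s) := c :* (w :* i)) refl (u ⊖ s) s c (inv (u ⊖ s)) ⟩
      c ⊗ ((u ⊖ s) ⊗ inv (u ⊖ s))         ≡⟨ cong (c ⊗_) (inv-right (⊖≢ ne)) ⟩
      c ⊗ 𝟙                                ≡⟨ ⊗-identityʳ c ⟩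
      c ∎
      where open ≡-Reasoning
    partner≢ : ∀ {u} → u ≢ s → partner u ≢ s
    partner≢ {u} ne e = c≢0 (trans (sym (partner-spec ne)) (trans (cong ((u ⊖ s) ⊗_) (≡⇒⊖≡𝟘 e)) (⊗-zeroʳ _)))
    partner-unique : ∀ {u v} → u ≢ s → (u ⊖ s) ⊗ (v ⊖ s) ≡ c → v ≡ partner u
    partner-unique {u} {v} ne e = trans (solve 2 (λ v s → v := (v :- s) :+ s) refl v s) (trans (cong (_⊕ s) (solution-unique (⊖≢ ne) (trans e (sym (partner-spec ne)))))
      (solve 2 (λ v s → (v :- s) :+ s := v) refl (partner u) s))
    σ : F → F
    σ u with u ≟ s
    ... | yes _ = s
    ... | no _ = partner u
    σ-s : σ s ≡ s
    σ-s with s ≟ s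
    ... | yes _ = refl
    ... | no ne = contradiction refl ne
    σ-≢ : ∀ {u} → u ≢ s → σ u ≡ partner u
    σ-≢ {u} ne with u ≟ s
    ... | yes e = contradiction e ne
    ... | no _ = refl
    involutive : ∀ u → σ (σ u) ≡ u
    involutive u with u ≟ s
    ... | yes refl = σ-s
    ... | no ne = trans (σ-≢ (partner≢ ne)) (sym (partner-unique (partner≢ ne) (trans (⊗-comm _ _) (partner-spec ne))))
    f : F → Pos
    f u with u ≟ s
    ... | yes _ = 𝟙 , s
    ... | no _ = node u (partner u)
    f-≢ : ∀ {u} → u ≢ s → f u ≡ node u (partner u)
    f-≢ {u} ne with u ≟ s
    ... | yes e = contradiction e ne
    ... | no _ = refl
    f-s : f s ≡ (𝟙 , s)
    f-s with s ≟ s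
    ... | yes _ = refl
    ... | no ne = contradiction refl ne
    f-σ : ∀ u → f (σ u) ≡ f u
    f-σ u with u ≟ s
    ... | yes refl = f-s
    ... | no ne = trans (f-≢ (partner≢ ne)) (trans (cong (node (partner u)) (sym (partner-unique (partner≢ ne) (trans (⊗-comm _ _) (partner-spec ne))))) (node-comm (partner u) u))
    expand : ∀ u v → (u ⊖ s) ⊗ (v ⊖ s) ⊖ c ≡ intercept (fin s) (node u v)
    expand u v = solve 4 (λ u v s n → (u :- s) :* (v :- s) :- (s :* s :- n) := (u :* v :+ n) :- s :* (u :+ v)) refl u v s n
    f-on : ∀ u → f u ≢ origin × intercept (fin s) (f u) ≡ 𝟘
    f-on u with u ≟ s
    ... | yes refl = (λ e → 𝟙≢𝟘 (cong proj₁ e)) , trans (cong (s ⊖_) (⊗-identityʳ s)) (⊖-inverse s)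
    ... | no ne = node≢origin u (partner u) , trans (sym (expand u (partner u))) (≡⇒⊖≡𝟘 (partner-spec ne))
    onto : ∀ p → p ≢ origin → intercept (fin s) p ≡ 𝟘 → Node p ⊎ proj₁ p ≡ 𝟙 → ∃ λ u → p ≡ f u
    onto (x , y) _ e (inj₂ refl) = s , trans (cong (𝟙 ,_) (trans (⊖≡𝟘⇒≡ e) (⊗-identityʳ s))) (sym f-s)
    onto p _ e (inj₁ (u , v , refl)) = u , trans (cong (node u) (partner-unique ne prod)) (sym (f-≢ ne))
      where
      prod : (u ⊖ s) ⊗ (v ⊖ s) ≡ c
      prod = ⊖≡𝟘⇒≡ (trans (expand u v) e)
      ne : u ≢ s
      ne refl = c≢0 (trans (sym prod) (trans (cong (_⊗ (v ⊖ s)) (⊖-inverse s)) (⊗-zeroˡ _)))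
    square-pm : ∀ {w r} → w ⊗ w ≡ r ⊗ r → w ≡ r ⊎ w ≡ neg r
    square-pm {w} {r} e with zero-product (trans (solve 2 (λ w r → (w :- r) :* (w :+ r) := w :* w :- r :* r) refl w r) (≡⇒⊖≡𝟘 e))
    ... | inj₁ z = inj₁ (⊖≡𝟘⇒≡ z)
    ... | inj₂ z = inj₂ (⊖≡𝟘⇒≡ (trans (solve 2 (λ w r → w :- (:- r) := w :+ r) refl w r) z))
    back : ∀ {u r} → u ⊖ s ≡ r → u ≡ s ⊕ r
    back {u} refl = solve 2 (λ u s → u := s :+ (u :- s)) refl u s
    fixed : ∃ λ xs → length xs ≤ 3 × (∀ u → σ u ≡ u → u ∈ xs)
    fixed with any? (λ r → r ⊗ r ≟ c)
    ... | yes (r , r²) = s ∷ (s ⊕ r) ∷ (s ⊕ neg r) ∷ [] , ℕ.≤-refl , in-list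
      where
      in-list : ∀ u → σ u ≡ u → u ∈ s ∷ (s ⊕ r) ∷ (s ⊕ neg r) ∷ []
      in-list u e with u ≟ s
      ... | yes refl = here refl
      ... | no ne with square-pm (trans (subst (λ v → (u ⊖ s) ⊗ (v ⊖ s) ≡ c) e (partner-spec ne)) (sym r²))
      ... | inj₁ h = there (here (back h))
      ... | inj₂ h = there (there (here (back h)))
    ... | no none = [ s ] , s≤s z≤n , in-list
      where
      in-list : ∀ u → σ u ≡ u → u ∈ [ s ]
      in-list u e with u ≟ s
      ... | yes refl = here refl
      ... | no ne = contradiction (u ⊖ s , subst (λ v → (u ⊖ s) ⊗ (v ⊖ s) ≡ c) e (partner-spec ne)) none

  defects : ∀ l → Defects l
  defects (fin s) = defects-fin s
  defects inf = defects-inf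

  Special : Pos → Set
  Special p = Node p ⊎ proj₁ p ≡ 𝟙

  special? : ∀ p → Dec (Special p)
  special? p with node? p | proj₁ p ≟ 𝟙
  ... | yes m | _ = yes (inj₁ m)
  ... | no _ | yes e = yes (inj₂ e)
  ... | no a | no b = no λ { (inj₁ m) → a m ; (inj₂ e) → b e }

  otherDir : (i : Dir) → ∃ λ j → i ≢ j
  otherDir (fin s) = inf , λ ()
  otherDir inf = fin 𝟘 , λ ()

  AllProper : List Line → Set
  AllProper ℓs = ∀ {ℓ} → ℓ ∈ ℓs → Proper ℓ

  proper-++ : ∀ {ℓs ms} → AllProper ℓs → AllProper ms → AllProper (ℓs ++ ms)
  proper-++ {ℓs} a b ℓ∈ with ∈-++⁻ ℓs ℓ∈
  ... | inj₁ h = a h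
  ... | inj₂ h = b h

  covers-++ˡ : ∀ {ℓs ms p} → Covers ℓs p → Covers (ℓs ++ ms) p
  covers-++ˡ (ℓ , ℓ∈ , on) = ℓ , ∈-++⁺ˡ ℓ∈ , on

  covers-++ʳ : ∀ ℓs {ms p} → Covers ms p → Covers (ℓs ++ ms) p
  covers-++ʳ ℓs (ℓ , ℓ∈ , on) = ℓ , ∈-++⁺ʳ ℓs ℓ∈ , on

  OnBroken : Dir → Pos → Set
  OnBroken l p = p ≢ origin × intercept l p ≡ 𝟘

  unitPoint : ∀ l → OnBroken l (point (l , 𝟘) 𝟙)
  unitPoint l = (λ e → 𝟙≢𝟘 (point-injective (l , 𝟘) (trans e (sym (point-origin l))))) , point-on (l , 𝟘) 𝟙

  module _ {i j : Dir} (i≢j : i ≢ j) where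

    -- A line through the origin containing both positions would have to be both broken lines.
    lineThrough : ∀ {p p′} → OnBroken i p → OnBroken j p′ → ∃ λ ℓ → Proper ℓ × p on ℓ × p′ on ℓ
    lineThrough {p} {p′} (p≢0 , onᵢ) (p′≢0 , onⱼ) with join p p′
    ... | k , e = (k , intercept k p) , proper , refl , sym e
      where
      proper : intercept k p ≢ 𝟘
      proper z = i≢j (trans (sym (dir-unique i p≢0 onᵢ)) (trans (dir-unique k p≢0 z) (trans (sym (dir-unique k p′≢0 (trans (sym e) z))) (dir-unique j p′≢0 onⱼ))))

    -- The lists are zipped; when one is exhausted its unit point steps in, so that the number of
    -- lines is the larger of the two lengths and not their sum.
    connect : ∀ xs ys → (∀ {p} → p ∈ xs → OnBroken i p) → (∀ {p} → p ∈ ys → OnBroken j p) →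
      ∃ λ ms → AllProper ms × (∀ {k} → length xs ≤ k → length ys ≤ k → length ms ≤ k) ×
        (∀ {p} → p ∈ xs → Covers ms p) × (∀ {p} → p ∈ ys → Covers ms p)
    connect [] [] a b = [] , (λ ()) , (λ _ le → le) , (λ ()) , λ ()
    connect (x ∷ xs) [] a b with lineThrough (a (here refl)) (unitPoint j) | connect xs [] (a ∘ there) b
    ... | ℓ , pr , on , _ | ms , prs , len , cx , cy = ℓ ∷ ms , (λ { (here refl) → pr ; (there m) → prs m }) ,
      (λ { (s≤s l) _ → s≤s (len l z≤n) }) , (λ { (here refl) → ℓ , here refl , on ; (there m) → covers-++ʳ [ ℓ ] (cx m) }) , λ ()
    connect [] (y ∷ ys) a b with lineThrough (unitPoint i) (b (here refl)) | connect [] ys a (b ∘ there)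
    ... | ℓ , pr , _ , on | ms , prs , len , cx , cy = ℓ ∷ ms , (λ { (here refl) → pr ; (there m) → prs m }) ,
      (λ { _ (s≤s l) → s≤s (len z≤n l) }) , (λ ()) , λ { (here refl) → ℓ , here refl , on ; (there m) → covers-++ʳ [ ℓ ] (cy m) }
    connect (x ∷ xs) (y ∷ ys) a b with lineThrough (a (here refl)) (b (here refl)) | connect xs ys (a ∘ there) (b ∘ there)
    ... | ℓ , pr , on , on′ | ms , prs , len , cx , cy = ℓ ∷ ms , (λ { (here refl) → pr ; (there m) → prs m }) ,
      (λ { (s≤s l) (s≤s l′) → s≤s (len l l′) }) ,
      (λ { (here refl) → ℓ , here refl , on ; (there m) → covers-++ʳ [ ℓ ] (cx m) }) ,
      λ { (here refl) → ℓ , here refl , on′ ; (there m) → covers-++ʳ [ ℓ ] (cy m) }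

    -- A line joining a defect on i with a defect on j repairs both at once.
    repair : ∃ λ ms → AllProper ms × length ms ≤ suc (suc h) ×
      (∀ p → p ≢ origin → intercept i p ≡ 𝟘 ⊎ intercept j p ≡ 𝟘 → Special p → Covers ms p)
    repair with connect (Defects.list (defects i)) (Defects.list (defects j)) (Defects.contained (defects i)) (Defects.contained (defects j))
    ... | ms , prs , len , cᵢ , cⱼ = ms , prs , len (Defects.length≤ (defects i)) (Defects.length≤ (defects j)) , λ
      { p p≢0 (inj₁ e) sp → cᵢ (Defects.complete (defects i) p p≢0 e sp)
      ; p p≢0 (inj₂ e) sp → cⱼ (Defects.complete (defects j) p p≢0 e sp) }

  module _ {ℓs : List Line} (proper : AllProper ℓs) where

    -- The lines of `repair` complete the list to a cover of everything but the origin, for which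
    -- Jamison's bound is 2 (q - 1) = 4 h.
    two-broken : ∀ {i j} → i ≢ j →
      (∀ p → p ≢ origin → (intercept i p ≡ 𝟘 ⊎ intercept j p ≡ 𝟘 → ¬ Special p) → Covers ℓs p) →
      2 * (2 * h) ≤ length ℓs ℕ.+ suc (suc h)
    two-broken {i} {j} i≢j cover with repair i≢j
    ... | ms , prs , len , rep = ℕ.≤-trans (subst (λ z → 2 * (z ℕ.∸ 1) ≤ length (ℓs ++ ms)) odd (plane-cover (proper-++ proper prs) covered))
        (ℕ.≤-trans (ℕ.≤-reflexive (length-++ ℓs)) (ℕ.+-monoʳ-≤ (length ℓs) len))
      where
      covered : ∀ p → p ≢ origin → Covers (ℓs ++ ms) p
      covered p p≢0 with special? p | intercept i p ≟ 𝟘 | intercept j p ≟ 𝟘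
      ... | no ns | _ | _ = covers-++ˡ (cover p p≢0 (λ _ → ns))
      ... | yes sp | yes e | _ = covers-++ʳ ℓs (rep p p≢0 (inj₁ e) sp)
      ... | yes sp | no _ | yes e = covers-++ʳ ℓs (rep p p≢0 (inj₂ e) sp)
      ... | yes sp | no ne | no ne′ = covers-++ˡ (cover p p≢0 λ { (inj₁ e) → contradiction e ne ; (inj₂ e) → contradiction e ne′ })

    one-broken : ∀ l → (∀ p → p ≢ origin → intercept l p ≡ 𝟘 → ¬ Special p → Covers ℓs p) →
      2 * h ≤ length ℓs ℕ.+ suc (suc h)
    -- `repair` works on pairs of broken lines; any second one will do.
    one-broken l cover with repair (proj₂ (otherDir l))
    ... | ms , prs , len , rep = ℕ.≤-trans (ℕ.≤-pred (subst (_≤ suc (length (ℓs ++ ms))) odd (ray-cover (proper-++ proper prs) l covered)))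
        (ℕ.≤-trans (ℕ.≤-reflexive (length-++ ℓs)) (ℕ.+-monoʳ-≤ (length ℓs) len))
      where
      covered : ∀ p → p ≢ origin → intercept l p ≡ 𝟘 → Covers (ℓs ++ ms) p
      covered p p≢0 e with special? p
      ... | no ns = covers-++ˡ (cover p p≢0 e ns)
      ... | yes sp = covers-++ʳ ℓs (rep p p≢0 (inj₁ e) sp)

    -- All special positions are added at once, by the q tangents and the line x = 1.
    no-specials : (∀ p → p ≢ origin → ¬ Special p → Covers ℓs p) → 2 * (2 * h) ≤ length ℓs ℕ.+ suc q
    no-specials cover = ℕ.≤-trans (subst (λ z → 2 * (z ℕ.∸ 1) ≤ length (ℓs ++ ms)) odd (plane-cover (proper-++ proper prs) covered))
        (ℕ.≤-reflexive (trans (length-++ ℓs) (cong (λ z → length ℓs ℕ.+ suc z) (trans (length-map tangent (allFin q)) length-allFin))))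
      where
      ms : List Line
      ms = (inf , 𝟙) ∷ map tangent (allFin q)
      prs : AllProper ms
      prs (here refl) = 𝟙≢𝟘
      prs (there m) with ∈-map⁻ tangent m
      ... | u , _ , refl = tangent-proper u
      covered : ∀ p → p ≢ origin → Covers (ℓs ++ ms) p
      covered p p≢0 with special? p
      ... | no ns = covers-++ˡ (cover p p≢0 ns)
      ... | yes (inj₂ e) = covers-++ʳ ℓs ((inf , 𝟙) , here refl , e)
      ... | yes (inj₁ (u , v , refl)) = covers-++ʳ ℓs (tangent u , there (∈-map⁺ tangent (∈-allFin u)) , node-on u v)

-- Partition systems, the dual form of the hypergraphs.

module Systems where

  open import Data.Nat using (_≤_)

  -- There are k + 4 colours. In the enlargement the old `main` is absorbed by the direction of the
  -- hosting broken line and the new `main` is the vertical direction: q + 1 directions, k old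
  -- colours and three reserved ones make (q + k) + 4.
  data Colour (k : ℕ) : Set where
    main g₁ g₂ g₃ : Colour k
    other : Fin k → Colour k

  data Plain {k : ℕ} : Colour k → Set where
    main : Plain main
    other : ∀ κ → Plain (other κ)

  -- The dual picture: the points are the edges of a hypergraph, and a vertex is a
  -- colour together with a label, incident with the points carrying this label.
  -- Free points never need the colours g₁, g₂, g₃ to meet another point.
  record System (k t t₁ : ℕ) : Set₁ where
    field
      Point Label : Set
      _≟ᴸ_ : (a b : Label) → Dec (a ≡ b)
      points : List Point
      ∈-points : ∀ x → x ∈ points
      Valid Free : Point → Set
      valid? : Decidable Valid
      free? : Decidable Free
      free⇒valid : ∀ {x} → Free x → Valid x
      label : Point → Colour k → Label

    Vertex : Set
    Vertex = Colour k × Label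

    Hit : List Vertex → Point → Set
    Hit 𝒞 x = ∃ λ v → v ∈ 𝒞 × label x (proj₁ v) ≡ proj₂ v

    field
      meets : ∀ {x y} → Valid x → Valid y → ∃ λ c → label x c ≡ label y c
      free-meets : ∀ {x y} → Free x → Valid y → ∃ λ c → Plain c × label x c ≡ label y c
      cover : ∀ 𝒞 → (∀ x → Valid x → Hit 𝒞 x) → t ≤ length 𝒞
      free-cover : ∀ 𝒞 → (∀ x → Free x → Hit 𝒞 x) → t₁ ≤ length 𝒞

open Systems using (System)

-- The enlarged system: its points, labels and meetings.

module Enlargement {q : ℕ} (K : Field q) (n : Fin q) (nonSquare : ∀ x → Field._⊗_ K x x ≢ n)
  (two≢𝟘 : Field._⊕_ K (Field.𝟙 K) (Field.𝟙 K) ≢ Field.𝟘 K) (h : ℕ) (odd : q ≡ suc (2 * h))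
  {k t t₁ : ℕ} (S : System k t t₁) where

  open FiniteFields
  open Systems


  open Lists
  open Plane K n nonSquare two≢𝟘 h odd
  open Field K
  open import Algebra.Bundles using (CommutativeRing)
  open CommutativeRing commutativeRing using () renaming (+-identityʳ to ⊕-identityʳ; +-identityˡ to ⊕-identityˡ)
  open Solver using (solve; _:+_; _:-_; _:=_)
  module S = System S
  open import Data.Nat as ℕ using (_≤_; _<_; z≤n; s≤s; _+_)
  import Data.Nat.Properties as ℕ
  import Data.Nat.Tactic.RingSolver as ℕ
  open import Data.Fin using (_≟_; splitAt; _↑ˡ_; _↑ʳ_)
  open import Data.Fin.Properties using (splitAt-↑ˡ; splitAt-↑ʳ; splitAt⁻¹-↑ˡ)
  open import Data.List using ([_]; _++_; map; filter; allFin; concatMap; cartesianProduct)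
  open import Data.List.Properties using (length-map)
  open import Data.Nat.ListAction using (sum)
  open import Data.List.Membership.Propositional using (find; lose)
  open import Data.List.Membership.Propositional.Properties
  import Data.List.Relation.Unary.Any as Any
  import Data.List.Relation.Unary.All as All
  import Data.List.Relation.Unary.All.Properties as All
  import Data.List.Relation.Unary.Unique.Propositional.Properties as Unique
  open import Data.Product using (map₂)
  open import Data.Sum.Properties as Sum using (inj₁-injective)
  import Data.Product.Properties as ×
  open import Data.Bool using (Bool; true; false)
  import Data.Bool as Bool
  open import Data.Unit using (⊤; tt)
  open import Data.Empty using (⊥; ⊥-elim)
  open import Relation.Nullary.Decidable using (¬?; _×-dec_; _→-dec_; map′)

  -- A point is a point s of the smaller system at a position of the plane: off the
  -- tangents, or where the tangents u and v meet (using g₁ for u and g₂ for v). The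
  -- twin `extra` at the node of 𝟘 and 𝟙 is left out of the line x = 1, as is
  -- `at-node s u u` of the tangent u, so that these lines are not parts any more.
  data Point : Set where
    free-pos : S.Point → F → F → Point
    at-node : S.Point → F → F → Point
    extra : S.Point → Point

  pos : Point → Pos
  pos (free-pos s x y) = x , y
  pos (at-node s u v) = node u v
  pos (extra s) = node 𝟘 𝟙

  base : Point → S.Point
  base (free-pos s x y) = s
  base (at-node s u v) = s
  base (extra s) = s

  -- `sub` labels come from the smaller system on a broken line, `tan` is used by g₁
  -- and g₂, `vertical` by g₃ on the line x = 1, and `exception` marks the points left
  -- out of a line.
  data Label : Set where
    line : F → Label
    exception : Label
    sub : Dir → S.Label → Label
    tan : F → Label
    vertical : Label

  private
    Code : Set
    Code = (F ⊎ F) ⊎ ((Dir × S.Label) ⊎ Bool)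

    encode : Label → Code
    encode (line e) = inj₁ (inj₁ e)
    encode (tan u) = inj₁ (inj₂ u)
    encode (sub i l) = inj₂ (inj₁ (i , l))
    encode exception = inj₂ (inj₂ false)
    encode vertical = inj₂ (inj₂ true)

    decode : Code → Label
    decode (inj₁ (inj₁ e)) = line e
    decode (inj₁ (inj₂ u)) = tan u
    decode (inj₂ (inj₁ (i , l))) = sub i l
    decode (inj₂ (inj₂ false)) = exception
    decode (inj₂ (inj₂ true)) = vertical

    decode-encode : ∀ l → decode (encode l) ≡ l
    decode-encode (line e) = refl
    decode-encode (tan u) = refl
    decode-encode (sub i l) = refl
    decode-encode exception = refl
    decode-encode vertical = refl

  _≟ᴸ_ : (a b : Label) → Dec (a ≡ b)
  a ≟ᴸ b = map′ (λ e → trans (sym (decode-encode a)) (trans (cong decode e) (decode-encode b))) (cong encode)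
    (Sum.≡-dec (Sum.≡-dec _≟_ _≟_) (Sum.≡-dec (×.≡-dec _≟ᴰ_ S._≟ᴸ_) Bool._≟_) (encode a) (encode b))

  tan-injective : ∀ {a b} → tan a ≡ tan b → a ≡ b
  tan-injective refl = refl

  Exceptional : Dir → Point → Set
  Exceptional (fin w) (at-node s u v) = w ≡ u × w ≡ v
  Exceptional inf (extra s) = ⊤
  Exceptional _ _ = ⊥

  exceptional? : ∀ i x → Dec (Exceptional i x)
  exceptional? (fin w) (at-node s u v) = (w ≟ u) ×-dec (w ≟ v)
  exceptional? inf (extra s) = yes tt
  exceptional? (fin _) (free-pos _ _ _) = no λ ()
  exceptional? (fin _) (extra _) = no λ ()
  exceptional? inf (free-pos _ _ _) = no λ ()
  exceptional? inf (at-node _ _ _) = no λ ()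

  -- `at-node s 𝟘 𝟙` is left out so that no vertex belonging to the line x = 1 hits both it and
  -- `extra s`; the two still meet along the tangent `𝟘`.
  Vertical : Point → Set
  Vertical (free-pos s x y) = x ≡ 𝟙
  Vertical (at-node s u v) = u ⊕ v ≡ 𝟙 × u ≢ 𝟘 × v ≢ 𝟘
  Vertical (extra s) = ⊤

  vertical? : ∀ x → Dec (Vertical x)
  vertical? (free-pos s x y) = x ≟ 𝟙
  vertical? (at-node s u v) = (u ⊕ v ≟ 𝟙) ×-dec (¬? (u ≟ 𝟘) ×-dec ¬? (v ≟ 𝟘))
  vertical? (extra s) = yes tt

  dirLabel : Dir → Point → Label
  dirLabel i x with exceptional? i x | intercept i (pos x) ≟ 𝟘
  ... | yes _ | _ = exception
  ... | no _ | yes _ = sub i (S.label (base x) main)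
  ... | no _ | no _ = line (intercept i (pos x))

  tanLabel₁ tanLabel₂ verticalLabel : Point → Label
  tanLabel₁ x@(free-pos s _ _) = sub (dir (pos x)) (S.label s g₁)
  tanLabel₁ (at-node s u v) = tan u
  tanLabel₁ (extra s) = tan 𝟘
  tanLabel₂ x@(free-pos s _ _) = sub (dir (pos x)) (S.label s g₂)
  tanLabel₂ (at-node s u v) = tan v
  tanLabel₂ (extra s) = tan 𝟙
  verticalLabel x with vertical? x
  ... | yes _ = vertical
  ... | no _ = sub (dir (pos x)) (S.label (base x) g₃)

  otherLabel : Fin q ⊎ Fin k → Point → Label
  otherLabel (inj₁ w) x = dirLabel (fin w) x
  otherLabel (inj₂ κ) x = sub (dir (pos x)) (S.label (base x) (other κ))

  label : Point → Colour (q + k) → Label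
  label x main = dirLabel inf x
  label x g₁ = tanLabel₁ x
  label x g₂ = tanLabel₂ x
  label x g₃ = verticalLabel x
  label x (other κ) = otherLabel (splitAt q κ) x

  dirColour : Dir → Colour (q + k)
  dirColour (fin w) = other (w ↑ˡ k)
  dirColour inf = main

  liftColour : Fin k → Colour (q + k)
  liftColour κ = other (q ↑ʳ κ)

  label-dir : ∀ x i → label x (dirColour i) ≡ dirLabel i x
  label-dir x (fin w) rewrite splitAt-↑ˡ q w k = refl
  label-dir x inf = refl

  label-lift : ∀ x κ → label x (liftColour κ) ≡ sub (dir (pos x)) (S.label (base x) (other κ))
  label-lift x κ rewrite splitAt-↑ʳ q k κ = refl

  plain-dir : ∀ i → Plain (dirColour i)
  plain-dir (fin w) = other _
  plain-dir inf = main

  -- No point on a split line is free again, since it may need a reserved colour there. A new free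
  -- point hosts a free one, because on its broken line only `S.free-meets` yields a plain colour.
  Valid Free : Point → Set
  Valid (free-pos s x y) = S.Valid s × (x , y) ≢ origin × ¬ Node (x , y) × (x ≡ 𝟙 → S.Free s)
  Valid (at-node s u v) = S.Free s
  Valid (extra s) = S.Free s
  Free (free-pos s x y) = S.Free s × (x , y) ≢ origin × ¬ Node (x , y) × x ≢ 𝟙
  Free (at-node s u v) = ⊥
  Free (extra s) = ⊥

  _≟ᴾ_ : (p p′ : Pos) → Dec (p ≡ p′)
  _≟ᴾ_ = ×.≡-dec _≟_ _≟_

  valid? : Decidable Valid
  valid? (free-pos s x y) = S.valid? s ×-dec (¬? ((x , y) ≟ᴾ origin) ×-dec (¬? (node? (x , y)) ×-dec ((x ≟ 𝟙) →-dec S.free? s)))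
  valid? (at-node s u v) = S.free? s
  valid? (extra s) = S.free? s

  free? : Decidable Free
  free? (free-pos s x y) = S.free? s ×-dec (¬? ((x , y) ≟ᴾ origin) ×-dec (¬? (node? (x , y)) ×-dec ¬? (x ≟ 𝟙)))
  free? (at-node s u v) = no λ ()
  free? (extra s) = no λ ()

  free⇒valid : ∀ {x} → Free x → Valid x
  free⇒valid {free-pos s x y} (f , a , b , c) = S.free⇒valid f , a , b , λ e → contradiction e c

  base-valid : ∀ x → Valid x → S.Valid (base x)
  base-valid (free-pos s x y) (v , _) = v
  base-valid (at-node s u v) f = S.free⇒valid f
  base-valid (extra s) f = S.free⇒valid f

  pos≢origin : ∀ x → Valid x → pos x ≢ origin
  pos≢origin (free-pos s x y) (_ , ne , _) = ne
  pos≢origin (at-node s u v) _ = node≢origin u v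
  pos≢origin (extra s) _ = node≢origin 𝟘 𝟙

  points : List Point
  points = concatMap (λ s → extra s ∷ (map (λ p → free-pos s (proj₁ p) (proj₂ p)) plane ++ map (λ p → at-node s (proj₁ p) (proj₂ p)) plane)) S.points
    where
    plane : List Pos
    plane = cartesianProduct (allFin q) (allFin q)

  ∈-points : ∀ x → x ∈ points
  ∈-points x = ∈-concatMap⁺ _ (Any.map (λ { refl → inner x }) (S.∈-points (base x)))
    where
    plane : List Pos
    plane = cartesianProduct (allFin q) (allFin q)
    ∈-plane : ∀ p → p ∈ plane
    ∈-plane (x , y) = ∈-cartesianProduct⁺ (∈-allFin x) (∈-allFin y)
    inner : ∀ x → let s = base x in x ∈ extra s ∷ (map (λ p → free-pos s (proj₁ p) (proj₂ p)) plane ++ map (λ p → at-node s (proj₁ p) (proj₂ p)) plane)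
    inner (free-pos s x y) = there (∈-++⁺ˡ (∈-map⁺ (λ p → free-pos s (proj₁ p) (proj₂ p)) (∈-plane (x , y))))
    inner (at-node s u v) = there (∈-++⁺ʳ (map (λ p → free-pos s (proj₁ p) (proj₂ p)) plane) (∈-map⁺ (λ p → at-node s (proj₁ p) (proj₂ p)) (∈-plane (u , v))))
    inner (extra s) = here refl

  dirLabel-exception : ∀ i x → Exceptional i x → dirLabel i x ≡ exception
  dirLabel-exception i x e with exceptional? i x
  ... | yes _ = refl
  ... | no ne = contradiction e ne

  dirLabel-line : ∀ i x → ¬ Exceptional i x → intercept i (pos x) ≢ 𝟘 → dirLabel i x ≡ line (intercept i (pos x))
  dirLabel-line i x ne ne′ with exceptional? i x | intercept i (pos x) ≟ 𝟘
  ... | yes e | _ = contradiction e ne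
  ... | no _ | yes e = contradiction e ne′
  ... | no _ | no _ = refl

  𝟘⊕𝟙 : 𝟘 ⊕ 𝟙 ≡ 𝟙
  𝟘⊕𝟙 = ⊕-identityˡ 𝟙

  exceptional-on : ∀ {i x} → Exceptional i x → intercept i (pos x) ≢ 𝟘
  exceptional-on {fin w} {at-node s .w .w} (refl , refl) e = tangent-proper w (trans (sym (node-on w w)) e)
  exceptional-on {inf} {extra s} _ e = 𝟙≢𝟘 (trans (sym 𝟘⊕𝟙) e)

  dirLabel-sub : ∀ i x → intercept i (pos x) ≡ 𝟘 → dirLabel i x ≡ sub i (S.label (base x) main)
  dirLabel-sub i x z with exceptional? i x | intercept i (pos x) ≟ 𝟘
  ... | yes e | _ = contradiction z (exceptional-on {i} {x} e)
  ... | no _ | yes _ = refl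
  ... | no _ | no ne = contradiction z ne

  verticalLabel-yes : ∀ x → Vertical x → verticalLabel x ≡ vertical
  verticalLabel-yes x e with vertical? x
  ... | yes _ = refl
  ... | no ne = contradiction e ne

  verticalLabel-no : ∀ x → ¬ Vertical x → verticalLabel x ≡ sub (dir (pos x)) (S.label (base x) g₃)
  verticalLabel-no x ne with vertical? x
  ... | yes e = contradiction e ne
  ... | no _ = refl

  agree-dir : ∀ {x y} i → dirLabel i x ≡ dirLabel i y → label x (dirColour i) ≡ label y (dirColour i)
  agree-dir {x} {y} i e = trans (label-dir x i) (trans e (sym (label-dir y i)))

  agree-line : ∀ {x y} i → ¬ Exceptional i x → ¬ Exceptional i y → intercept i (pos x) ≡ intercept i (pos y) → intercept i (pos x) ≢ 𝟘 → label x (dirColour i) ≡ label y (dirColour i)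
  agree-line {x} {y} i nx ny e ne = agree-dir {x} {y} i (trans (dirLabel-line i x nx ne) (trans (cong line e) (sym (dirLabel-line i y ny (λ z → ne (trans e z))))))

  -- On a broken line the points are told apart by the smaller system only.
  module _ {i x y} (px : pos x ≢ origin) (py : pos y ≢ origin) (ox : intercept i (pos x) ≡ 𝟘) (oy : intercept i (pos y) ≡ 𝟘) where

    private
      same-dir : dir (pos x) ≡ dir (pos y)
      same-dir = trans (dir-unique i px ox) (sym (dir-unique i py oy))

    broken-plain : ∀ {c} → Plain c → S.label (base x) c ≡ S.label (base y) c → ∃ λ c → Plain c × label x c ≡ label y c
    broken-plain main e = dirColour i , plain-dir i , agree-dir {x} {y} i (trans (dirLabel-sub i x ox) (trans (cong (sub i) e) (sym (dirLabel-sub i y oy))))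
    broken-plain (other κ) e = liftColour κ , other _ , trans (label-lift x κ) (trans (cong₂ sub same-dir e) (sym (label-lift y κ)))

    sub-agree : ∀ {a b} → a ≡ b → sub (dir (pos x)) a ≡ sub (dir (pos y)) b
    sub-agree = cong₂ sub same-dir

  -- Valid points of this kind still carry all three reserved labels of the smaller system; every
  -- other valid point hosts a free one.
  Heavy : Point → Set
  Heavy (free-pos s x y) = x ≢ 𝟙
  Heavy _ = ⊥

  heavy-or-free : ∀ x → Valid x → Heavy x ⊎ S.Free (base x)
  heavy-or-free (free-pos s x y) (_ , _ , _ , f) with x ≟ 𝟙
  ... | yes e = inj₂ (f e)
  ... | no ne = inj₁ ne
  heavy-or-free (at-node s u v) f = inj₂ f
  heavy-or-free (extra s) f = inj₂ f

  -- On a tangent the other point has that tangent as one of its own two, which `g₁` or `g₂`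
  -- records. On x = 1 the colour `g₃` serves, except for the nodes of `𝟘` and `𝟙`, which share the
  -- position of `extra` and are met along the tangent `𝟘`.
  exceptional-meets : ∀ {i x y} → Exceptional i x → Valid y → intercept i (pos x) ≡ intercept i (pos y) → ∃ λ c → label x c ≡ label y c
  exceptional-meets {fin w} {at-node s .w .w} {free-pos s′ x′ y′} (refl , refl) (_ , _ , ¬node , _) e =
    contradiction (w , _ , on-tangent w (x′ , y′) (trans (sym e) (node-on w w))) ¬node
  exceptional-meets {fin w} {at-node s .w .w} {at-node s′ a b} (refl , refl) _ e with node-on-tangent w a b (trans (sym e) (node-on w w))
  ... | inj₁ a≡w = g₁ , cong tan (sym a≡w)
  ... | inj₂ b≡w = g₂ , cong tan (sym b≡w)
  exceptional-meets {fin w} {at-node s .w .w} {extra s′} (refl , refl) _ e with node-on-tangent w 𝟘 𝟙 (trans (sym e) (node-on w w))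
  ... | inj₁ a≡w = g₁ , cong tan (sym a≡w)
  ... | inj₂ b≡w = g₂ , cong tan (sym b≡w)
  exceptional-meets {inf} {extra s} {free-pos s′ x′ y′} _ _ e = g₃ , sym (verticalLabel-yes (free-pos s′ x′ y′) (trans (sym e) 𝟘⊕𝟙))
  exceptional-meets {inf} {extra s} {extra s′} _ _ e = g₃ , refl
  exceptional-meets {inf} {x@(extra s)} {y@(at-node s′ a b)} _ _ e with a ≟ 𝟘 | b ≟ 𝟘
  ... | yes refl | _ = dirColour (fin 𝟘) , agree-line {x} {y} (fin 𝟘) (λ ()) (λ { (_ , z) → 𝟙≢𝟘 (trans (sym b≡𝟙) (sym z)) })
        (cong (intercept (fin 𝟘) ∘ node 𝟘) (sym b≡𝟙)) (λ z → tangent-proper 𝟘 (trans (sym (node-on 𝟘 𝟙)) z))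
    where
    b≡𝟙 : b ≡ 𝟙
    b≡𝟙 = trans (sym (⊕-identityˡ b)) (trans (sym e) 𝟘⊕𝟙)
  ... | no a≢0 | yes refl = dirColour (fin 𝟘) , agree-line {x} {y} (fin 𝟘) (λ ()) (λ { (z , _) → a≢0 (sym z) })
        (cong (intercept (fin 𝟘)) (trans (node-comm 𝟘 𝟙) (cong (λ a → node a 𝟘) (sym a≡𝟙)))) (λ z → tangent-proper 𝟘 (trans (sym (node-on 𝟘 𝟙)) z))
    where
    a≡𝟙 : a ≡ 𝟙
    a≡𝟙 = trans (sym (⊕-identityʳ a)) (trans (sym e) 𝟘⊕𝟙)
  ... | no a≢0 | no b≢0 = g₃ , sym (verticalLabel-yes y (trans (sym e) 𝟘⊕𝟙 , a≢0 , b≢0))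

  meets : ∀ {x y} → Valid x → Valid y → ∃ λ c → label x c ≡ label y c
  meets {x} {y} vx vy with join (pos x) (pos y)
  ... | i , e with intercept i (pos x) ≟ 𝟘
  ... | no ne = off-broken (exceptional? i x) (exceptional? i y)
    where
    off-broken : Dec (Exceptional i x) → Dec (Exceptional i y) → ∃ λ c → label x c ≡ label y c
    off-broken (yes ex) _ = exceptional-meets {i} {x} {y} ex vy e
    off-broken (no _) (yes ey) = map₂ sym (exceptional-meets {i} {y} {x} ey vx (sym e))
    off-broken (no nx) (no ny) = dirColour i , agree-line {x} {y} i nx ny e ne
  ... | yes z = on-broken (heavy-or-free x vx) (heavy-or-free y vy)
    where
    px = pos≢origin x vx
    py = pos≢origin y vy
    z′ : intercept i (pos y) ≡ 𝟘
    z′ = trans (sym e) z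
    both-heavy : ∀ {x y} → Heavy x → Heavy y → pos x ≢ origin → pos y ≢ origin → intercept i (pos x) ≡ 𝟘 → intercept i (pos y) ≡ 𝟘 →
      ∀ c → S.label (base x) c ≡ S.label (base y) c → ∃ λ c → label x c ≡ label y c
    both-heavy {x} {y} _ _ px py z z′ main eq = map₂ proj₂ (broken-plain {i} {x} {y} px py z z′ main eq)
    both-heavy {x} {y} _ _ px py z z′ (other κ) eq = map₂ proj₂ (broken-plain {i} {x} {y} px py z z′ (other κ) eq)
    both-heavy {x@(free-pos _ _ _)} {y@(free-pos _ _ _)} _ _ px py z z′ g₁ eq = g₁ , sub-agree {i} {x} {y} px py z z′ eq
    both-heavy {x@(free-pos _ _ _)} {y@(free-pos _ _ _)} _ _ px py z z′ g₂ eq = g₂ , sub-agree {i} {x} {y} px py z z′ eq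
    both-heavy {x@(free-pos _ _ _)} {y@(free-pos _ _ _)} hx hy px py z z′ g₃ eq = g₃ , trans (verticalLabel-no x hx) (trans (sub-agree {i} {x} {y} px py z z′ eq) (sym (verticalLabel-no y hy)))
    on-broken : Heavy x ⊎ S.Free (base x) → Heavy y ⊎ S.Free (base y) → ∃ λ c → label x c ≡ label y c
    -- One free point is enough: it meets the other in a plain colour, and these survive everywhere
    -- on a broken line.
    on-broken (inj₂ f) _ with S.free-meets f (base-valid y vy)
    ... | c , pl , eq = map₂ proj₂ (broken-plain {i} {x} {y} px py z z′ pl eq)
    on-broken (inj₁ _) (inj₂ f) with S.free-meets f (base-valid x vx)
    ... | c , pl , eq = map₂ proj₂ (broken-plain {i} {x} {y} px py z z′ pl (sym eq))
    on-broken (inj₁ hx) (inj₁ hy) with S.meets (base-valid x vx) (base-valid y vy)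
    ... | c , eq = both-heavy {x} {y} hx hy px py z z′ c eq

  free-meets : ∀ {x y} → Free x → Valid y → ∃ λ c → Plain c × label x c ≡ label y c
  free-meets {x@(free-pos s a b)} {y} (f , px , ¬node , a≢𝟙) vy with join (pos x) (pos y)
  ... | i , e with intercept i (pos x) ≟ 𝟘
  ... | no ne = dirColour i , plain-dir i , agree-line {x} {y} i (not-exceptional i) (λ ey → clash i y ey e) e ne
    where
    not-exceptional : ∀ i → ¬ Exceptional i x
    not-exceptional (fin _) ()
    not-exceptional inf ()
    -- An exceptional point on the common line would put `x` on a split line, where no point is
    -- free.
    clash : ∀ i y → Exceptional i y → intercept i (a , b) ≡ intercept i (pos y) → ⊥
    clash (fin w) (at-node s′ .w .w) (refl , refl) e = ¬node (w , _ , on-tangent w (a , b) (trans e (node-on w w)))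
    clash inf (extra s′) _ e = a≢𝟙 (trans e 𝟘⊕𝟙)
  ... | yes z with S.free-meets f (base-valid y vy)
  ... | c , pl , eq = broken-plain {i} {x} {y} px (pos≢origin y vy) z (trans (sym e) z) pl eq

  -- Covers of the enlarged system.

  Vertex : Set
  Vertex = Colour (q + k) × Label

  Class : Set
  Class = Line ⊎ (Dir × S.Vertex)

  vertical-line : Line
  vertical-line = inf , 𝟙

  -- Labels that do not occur are sent to an arbitrary proper line.
  classifyDir : Dir → Label → Class
  classifyDir i (line e) with e ≟ 𝟘
  ... | yes _ = inj₁ vertical-line
  ... | no _ = inj₁ (i , e)
  classifyDir (fin w) exception = inj₁ (tangent w)
  classifyDir inf exception = inj₁ vertical-line
  classifyDir i (sub j l) = inj₂ (j , main , l)
  classifyDir i (tan _) = inj₁ vertical-line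
  classifyDir i vertical = inj₁ vertical-line

  classifySub : Colour k → Label → Class
  classifySub c (sub j l) = inj₂ (j , c , l)
  classifySub c (tan u) = inj₁ (tangent u)
  classifySub c _ = inj₁ vertical-line

  classifyOther : Fin q ⊎ Fin k → Label → Class
  classifyOther (inj₁ w) = classifyDir (fin w)
  classifyOther (inj₂ κ) = classifySub (other κ)

  classify : Vertex → Class
  classify (main , l) = classifyDir inf l
  classify (g₁ , l) = classifySub g₁ l
  classify (g₂ , l) = classifySub g₂ l
  classify (g₃ , l) = classifySub g₃ l
  classify (other κ , l) = classifyOther (splitAt q κ) l

  ProperClass : Class → Set
  ProperClass (inj₁ ℓ) = Proper ℓ
  ProperClass (inj₂ _) = ⊤

  classifyDir-proper : ∀ i l → ProperClass (classifyDir i l)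
  classifyDir-proper i (line e) with e ≟ 𝟘
  ... | yes _ = 𝟙≢𝟘
  ... | no ne = ne
  classifyDir-proper (fin w) exception = tangent-proper w
  classifyDir-proper inf exception = 𝟙≢𝟘
  classifyDir-proper i (sub j l) = tt
  classifyDir-proper i (tan _) = 𝟙≢𝟘
  classifyDir-proper i vertical = 𝟙≢𝟘

  classifySub-proper : ∀ c l → ProperClass (classifySub c l)
  classifySub-proper c (line _) = 𝟙≢𝟘
  classifySub-proper c exception = 𝟙≢𝟘
  classifySub-proper c (sub _ _) = tt
  classifySub-proper c (tan u) = tangent-proper u
  classifySub-proper c vertical = 𝟙≢𝟘

  classify-proper : ∀ v → ProperClass (classify v)
  classify-proper (main , l) = classifyDir-proper inf l
  classify-proper (g₁ , l) = classifySub-proper g₁ l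
  classify-proper (g₂ , l) = classifySub-proper g₂ l
  classify-proper (g₃ , l) = classifySub-proper g₃ l
  classify-proper (other κ , l) with splitAt q κ
  ... | inj₁ w = classifyDir-proper (fin w) l
  ... | inj₂ κ′ = classifySub-proper (other κ′) l

  -- A vertex is enlarged to the line, or to the vertex of the smaller system, that
  -- it is classified as.
  Incident : Point → Class → Set
  Incident x (inj₁ ℓ) = pos x on ℓ
  Incident x (inj₂ (j , c , l)) = intercept j (pos x) ≡ 𝟘 × S.label (base x) c ≡ l

  node-vertical : node 𝟘 𝟙 on vertical-line
  node-vertical = 𝟘⊕𝟙

  incident-dir : ∀ i x → Incident x (classifyDir i (dirLabel i x))
  incident-dir i x with exceptional? i x | intercept i (pos x) ≟ 𝟘
  incident-dir (fin w) (at-node s .w .w) | yes (refl , refl) | _ = node-on w w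
  incident-dir inf (extra s) | yes tt | _ = node-vertical
  ... | no _ | yes z = z , refl
  ... | no _ | no ne with intercept i (pos x) ≟ 𝟘
  ... | yes z = contradiction z ne
  ... | no _ = refl

  incident : ∀ x c → Incident x (classify (c , label x c))
  incident x main = incident-dir inf x
  incident x@(free-pos s a b) g₁ = dir-spec (pos x) , refl
  incident x@(free-pos s a b) g₂ = dir-spec (pos x) , refl
  incident (at-node s u v) g₁ = node-on u v
  incident (at-node s u v) g₂ = node-on′ u v
  incident (extra s) g₁ = node-on 𝟘 𝟙
  incident (extra s) g₂ = node-on′ 𝟘 𝟙
  incident x g₃ with vertical? x
  incident (free-pos s a b) g₃ | yes e = e
  incident (at-node s u v) g₃ | yes (e , _) = e
  incident (extra s) g₃ | yes _ = node-vertical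
  ... | no _ = dir-spec (pos x) , refl
  incident x (other κ) with splitAt q κ
  ... | inj₁ w = incident-dir (fin w) x
  ... | inj₂ κ′ = dir-spec (pos x) , refl

  consLine : Class → List Line → List Line
  consLine (inj₁ ℓ) ℓs = ℓ ∷ ℓs
  consLine (inj₂ _) ℓs = ℓs

  consSub : Dir → Class → List S.Vertex → List S.Vertex
  consSub j (inj₁ _) vs = vs
  consSub j (inj₂ (i , v)) vs with i ≟ᴰ j
  ... | yes _ = v ∷ vs
  ... | no _ = vs

  lines : List Vertex → List Line
  lines [] = []
  lines (v ∷ 𝒞) = consLine (classify v) (lines 𝒞)

  subs : Dir → List Vertex → List S.Vertex
  subs j [] = []
  subs j (v ∷ 𝒞) = consSub j (classify v) (subs j 𝒞)

  ∈-lines⁺ : ∀ {v ℓ 𝒞} → v ∈ 𝒞 → classify v ≡ inj₁ ℓ → ℓ ∈ lines 𝒞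
  ∈-lines⁺ (here refl) e rewrite e = here refl
  ∈-lines⁺ {𝒞 = w ∷ 𝒞} (there m) e with classify w
  ... | inj₁ _ = there (∈-lines⁺ m e)
  ... | inj₂ _ = ∈-lines⁺ m e

  ∈-lines⁻ : ∀ {ℓ} 𝒞 → ℓ ∈ lines 𝒞 → ∃ λ v → v ∈ 𝒞 × classify v ≡ inj₁ ℓ
  ∈-lines⁻ (w ∷ 𝒞) m with classify w in eq
  ∈-lines⁻ (w ∷ 𝒞) (here refl) | inj₁ _ = w , here refl , eq
  ∈-lines⁻ (w ∷ 𝒞) (there m) | inj₁ _ with ∈-lines⁻ 𝒞 m
  ... | v , v∈ , e = v , there v∈ , e
  ∈-lines⁻ (w ∷ 𝒞) m | inj₂ _ with ∈-lines⁻ 𝒞 m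
  ... | v , v∈ , e = v , there v∈ , e

  lines-proper : ∀ 𝒞 → AllProper (lines 𝒞)
  lines-proper 𝒞 m with ∈-lines⁻ 𝒞 m
  ... | v , _ , e = subst ProperClass e (classify-proper v)

  ∈-subs⁺ : ∀ {v j w 𝒞} → v ∈ 𝒞 → classify v ≡ inj₂ (j , w) → w ∈ subs j 𝒞
  ∈-subs⁺ {j = j} (here refl) e rewrite e with j ≟ᴰ j
  ... | yes _ = here refl
  ... | no ne = contradiction refl ne
  ∈-subs⁺ {j = j} {𝒞 = u ∷ 𝒞} (there m) e with classify u
  ... | inj₁ _ = ∈-subs⁺ m e
  ... | inj₂ (i , _) with i ≟ᴰ j
  ... | yes _ = there (∈-subs⁺ m e)
  ... | no _ = ∈-subs⁺ m e

  sizes : List Vertex → List Dir → ℕ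
  sizes 𝒞 js = sum (map (λ j → length (subs j 𝒞)) js)

  subs-line : ∀ {v ℓ 𝒞} j → classify v ≡ inj₁ ℓ → subs j (v ∷ 𝒞) ≡ subs j 𝒞
  subs-line {𝒞 = 𝒞} j e = cong (λ c → consSub j c (subs j 𝒞)) e

  subs-skip : ∀ {v i w 𝒞} j → classify v ≡ inj₂ (i , w) → i ≢ j → subs j (v ∷ 𝒞) ≡ subs j 𝒞
  subs-skip {i = i} {w} {𝒞} j e ne = trans (cong (λ c → consSub j c (subs j 𝒞)) e) skip
    where
    skip : consSub j (inj₂ (i , w)) (subs j 𝒞) ≡ subs j 𝒞
    skip with i ≟ᴰ j
    ... | yes i≡j = contradiction i≡j ne
    ... | no _ = refl

  subs-≤ : ∀ c j vs → length (consSub j c vs) ≤ suc (length vs)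
  subs-≤ (inj₁ _) j vs = ℕ.n≤1+n _
  subs-≤ (inj₂ (i , w)) j vs with i ≟ᴰ j
  ... | yes _ = ℕ.≤-refl
  ... | no _ = ℕ.n≤1+n _

  sizes-line : ∀ {v ℓ 𝒞} js → classify v ≡ inj₁ ℓ → sizes (v ∷ 𝒞) js ≡ sizes 𝒞 js
  sizes-line [] e = refl
  sizes-line {v} {𝒞 = 𝒞} (j ∷ js) e = cong₂ _+_ (cong length (subs-line {v} {𝒞 = 𝒞} j e)) (sizes-line {v} {𝒞 = 𝒞} js e)

  sizes-skip : ∀ {v i w 𝒞} js → classify v ≡ inj₂ (i , w) → All (i ≢_) js → sizes (v ∷ 𝒞) js ≡ sizes 𝒞 js
  sizes-skip [] e [] = refl
  sizes-skip {v} {𝒞 = 𝒞} (j ∷ js) e (ne ∷ a) = cong₂ _+_ (cong length (subs-skip {v} {𝒞 = 𝒞} j e ne)) (sizes-skip {v} {𝒞 = 𝒞} js e a)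

  sizes-cons : ∀ {v i w 𝒞} js → Unique js → classify v ≡ inj₂ (i , w) → sizes (v ∷ 𝒞) js ≤ suc (sizes 𝒞 js)
  sizes-cons [] [] e = z≤n
  sizes-cons {v} {i} {w} {𝒞} (j ∷ js) (j∉ ∷ u) e with i ≟ᴰ j
  ... | yes refl = ℕ.+-mono-≤ (subs-≤ (classify v) j (subs j 𝒞)) (ℕ.≤-reflexive (sizes-skip {v} {𝒞 = 𝒞} js e j∉))
  ... | no ne = ℕ.≤-trans (ℕ.+-mono-≤ (ℕ.≤-reflexive (cong length (subs-skip {v} {𝒞 = 𝒞} j e ne))) (sizes-cons {v} {𝒞 = 𝒞} js u e)) (ℕ.≤-reflexive (ℕ.+-suc _ _))

  -- A vertex falls into one class only, so lines and the vertices on distinct broken lines can be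
  -- charged separately.
  count : ∀ 𝒞 {js} → Unique js → length (lines 𝒞) + sizes 𝒞 js ≤ length 𝒞
  count [] {js} u = ℕ.≤-reflexive (zero-sizes js)
    where
    zero-sizes : ∀ js → sizes [] js ≡ 0
    zero-sizes [] = refl
    zero-sizes (_ ∷ js) = zero-sizes js
  count (v ∷ 𝒞) {js} u = by-class (classify v) refl
    where
    by-class : ∀ c → classify v ≡ c → length (lines (v ∷ 𝒞)) + sizes (v ∷ 𝒞) js ≤ suc (length 𝒞)
    by-class (inj₁ ℓ) e = ℕ.≤-trans (ℕ.≤-reflexive (cong₂ _+_ (cong (λ c → length (consLine c (lines 𝒞))) e) (sizes-line {v} {𝒞 = 𝒞} js e))) (s≤s (count 𝒞 u))
    by-class (inj₂ _) e = ℕ.≤-trans (ℕ.+-mono-≤ (ℕ.≤-reflexive (cong (λ c → length (consLine c (lines 𝒞))) e)) (sizes-cons {v} {𝒞 = 𝒞} js u e))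
      (ℕ.≤-trans (ℕ.≤-reflexive (ℕ.+-suc _ _)) (s≤s (count 𝒞 u)))

  covers? : ∀ ℓs p → Dec (Covers ℓs p)
  covers? ℓs p with Any.any? (on? p) ℓs
  ... | yes a = yes (let ℓ , ℓ∈ , on = find a in ℓ , ℓ∈ , on)
  ... | no na = no λ (ℓ , ℓ∈ , on) → na (lose ℓ∈ on)

  Hit : List Vertex → Point → Set
  Hit 𝒞 x = ∃ λ v → v ∈ 𝒞 × label x (proj₁ v) ≡ proj₂ v

  hit-class : ∀ {𝒞 x} → Hit 𝒞 x → ∃ λ v → v ∈ 𝒞 × label x (proj₁ v) ≡ proj₂ v × Incident x (classify v)
  hit-class {x = x} ((c , l) , v∈ , refl) = (c , l) , v∈ , refl , incident x c

  -- If too few vertices live on the broken line l, the points of l hosting a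
  -- large part of the smaller system have to be covered by lines.
  forced : ∀ {𝒞 T l p} (Q : S.Point → Set) → (∀ 𝒟 → (∀ s → Q s → S.Hit 𝒟 s) → T ≤ length 𝒟) → p ≢ origin → intercept l p ≡ 𝟘 →
    (∀ s → Q s → ∃ λ x → pos x ≡ p × base x ≡ s × Hit 𝒞 x) → length (subs l 𝒞) < T → Covers (lines 𝒞) p
  forced {𝒞} {T} {l} {p} Q bound p≢0 on-l host few with covers? (lines 𝒞) p
  ... | yes c = c
  ... | no nc = contradiction (bound (subs l 𝒞) hit) (ℕ.<⇒≱ few)
    where
    hit : ∀ s → Q s → S.Hit (subs l 𝒞) s
    hit s qs with host s qs
    ... | x , refl , refl , hx with hit-class {𝒞} {x} hx
    ... | v , v∈ , _ , inc with classify v in eq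
    ... | inj₁ ℓ = contradiction (ℓ , ∈-lines⁺ v∈ eq , inc) nc
    ... | inj₂ (j , w) with trans (sym (dir-unique j p≢0 (proj₁ inc))) (dir-unique l p≢0 on-l)
    ... | refl = w , ∈-subs⁺ v∈ eq , proj₂ inc

  subs-size : List Vertex → Dir → ℕ
  subs-size 𝒞 j = length (subs j 𝒞)

  -- Only these broken lines have enough vertices to hit a whole set of free points; by `forced`,
  -- elsewhere a position hosting all free points has to lie on one of the lines.
  rich : List Vertex → List Dir
  rich 𝒞 = filter (λ j → t₁ ℕ.≤? subs-size 𝒞 j) dirs

  unique-rich : ∀ 𝒞 → Unique (rich 𝒞)
  unique-rich 𝒞 = Unique.filter⁺ (λ j → t₁ ℕ.≤? subs-size 𝒞 j) unique-dirs

  rich-≤ : ∀ 𝒞 {j} → j ∈ rich 𝒞 → t₁ ≤ subs-size 𝒞 j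
  rich-≤ 𝒞 j∈ = proj₂ (∈-filter⁻ (λ j → t₁ ℕ.≤? subs-size 𝒞 j) {xs = dirs} j∈)

  ∉-rich : ∀ 𝒞 {j} → ¬ j ∈ rich 𝒞 → subs-size 𝒞 j < t₁
  ∉-rich 𝒞 {j} ∉ = ℕ.≰⇒> λ le → ∉ (∈-filter⁺ (λ j → t₁ ℕ.≤? subs-size 𝒞 j) (∈-dirs j) le)

  poor? : ∀ 𝒞 → (∃ λ d → subs-size 𝒞 d < t₁) ⊎ (∀ d → t₁ ≤ subs-size 𝒞 d)
  poor? 𝒞 with All.all? (λ j → t₁ ℕ.≤? subs-size 𝒞 j) dirs
  ... | yes a = inj₂ (λ d → All.lookup a (∈-dirs d))
  ... | no na with find (All.¬All⇒Any¬ (λ j → t₁ ℕ.≤? subs-size 𝒞 j) dirs na)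
  ... | d , _ , lt = inj₁ (d , ℕ.≰⇒> lt)

  all-rich : ∀ 𝒞 → (∀ d → t₁ ≤ subs-size 𝒞 d) → suc q * t₁ ≤ length 𝒞
  all-rich 𝒞 all = ℕ.≤-trans (subst (λ z → z * t₁ ≤ sizes 𝒞 dirs) length-dirs (sum-bound dirs)) (ℕ.≤-trans (ℕ.m≤n+m _ (length (lines 𝒞))) (count 𝒞 unique-dirs))
    where
    sum-bound : ∀ js → length js * t₁ ≤ sizes 𝒞 js
    sum-bound [] = z≤n
    sum-bound (j ∷ js) = ℕ.+-mono-≤ (all j) (sum-bound js)

  module FreeCover (t₁≥1 : 1 ≤ t₁) (t₁≤h : t₁ ≤ h) (𝒞 : List Vertex) (hits : ∀ x → Free x → Hit 𝒞 x) where

    forced-free : ∀ {l p} → p ≢ origin → intercept l p ≡ 𝟘 → ¬ Special p → subs-size 𝒞 l < t₁ → Covers (lines 𝒞) p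
    forced-free {l} {x , y} p≢0 on-l ns = forced {𝒞} {l = l} S.Free S.free-cover p≢0 on-l
      (λ s f → free-pos s x y , refl , refl , hits _ (f , p≢0 , (λ m → ns (inj₁ m)) , λ e → ns (inj₂ e)))

    -- If no broken line is rich, the lines cover all positions that are not special, so there are
    -- at least 2 h - 2 of them. Otherwise the `t₁` vertices of a rich one come on top of the h - 2
    -- lines forced by the poor `d`.
    bound : h + t₁ ≤ suc (suc (length 𝒞))
    bound with poor? 𝒞
    ... | inj₂ all = ℕ.≤-trans (ℕ.≤-trans (arith h t₁≥1) (subst (λ z → suc z * t₁ ≤ length 𝒞) odd (all-rich 𝒞 all))) (ℕ.m≤n+m _ 2)
      where
      arith : ∀ h {t} → 1 ≤ t → h + t ≤ suc (suc (2 * h)) * t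
      arith h {suc t} _ = subst (h + suc t ≤_) (eq h t) (ℕ.m≤m+n (h + suc t) _)
        where
        eq : ∀ h t → (h + suc t) + (2 * h * t + h + suc t) ≡ suc (suc (2 * h)) * suc t
        eq = ℕ.solve-∀
    ... | inj₁ (d , poor) with rich 𝒞 in eq
    ... | [] = ℕ.≤-trans (ℕ.+-monoʳ-≤ h t₁≤h) (ℕ.+-cancelʳ-≤ (2 * h) _ _ (ℕ.≤-trans (ℕ.≤-reflexive (four h)) (ℕ.≤-trans
          (no-specials (lines-proper 𝒞) (λ p p≢0 ns → forced-free {dir p} p≢0 (dir-spec p) ns (∉-rich 𝒞 (λ m → ∉[] (subst (_ ∈_) eq m)))))
          (ℕ.≤-trans (ℕ.≤-reflexive (trans (cong (λ z → length (lines 𝒞) + suc z) odd) (shift (length (lines 𝒞)) h))) (ℕ.+-monoˡ-≤ (2 * h) (ℕ.+-monoʳ-≤ 2 (ℕ.≤-trans (ℕ.m≤m+n (length (lines 𝒞)) 0) (count 𝒞 {[]} [])))))))) 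
      where
      four : ∀ h → h + h + 2 * h ≡ 2 * (2 * h)
      four = ℕ.solve-∀
      shift : ∀ m h → m + suc (suc (2 * h)) ≡ suc (suc m) + 2 * h
      shift = ℕ.solve-∀
    ... | i ∷ _ = ℕ.+-cancelʳ-≤ h _ _ (ℕ.≤-trans (ℕ.≤-reflexive (two h t₁)) (ℕ.≤-trans (ℕ.+-monoˡ-≤ t₁ (one-broken (lines-proper 𝒞) d (λ p p≢0 on-d ns → forced-free p≢0 on-d ns poor)))
        (ℕ.≤-trans (ℕ.≤-reflexive (shift (length (lines 𝒞)) h t₁)) (ℕ.+-monoˡ-≤ h (ℕ.+-monoʳ-≤ 2
          (ℕ.≤-trans (ℕ.+-monoʳ-≤ (length (lines 𝒞)) (ℕ.≤-trans (rich-≤ 𝒞 (subst (i ∈_) (sym eq) (here refl))) (ℕ.m≤m+n _ 0))) (count 𝒞 {[ i ]} ([] ∷ []))))))))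
      where
      two : ∀ h t → h + t + h ≡ 2 * h + t
      two = ℕ.solve-∀
      shift : ∀ m h t → m + suc (suc h) + t ≡ suc (suc (m + t)) + h
      shift = ℕ.solve-∀

  -- Thus the free points of the smaller system live at every position, including those on split
  -- lines, and `forced` applies with `t₁` throughout.
  host : ∀ p s → p ≢ origin → S.Free s → ∃ λ x → Valid x × pos x ≡ p × base x ≡ s
  host (a , b) s p≢0 f with node? (a , b)
  ... | yes (u , v , e) = at-node s u v , f , sym e , refl
  ... | no nn = free-pos s a b , (S.free⇒valid f , p≢0 , nn , λ _ → f) , refl , refl

  special-line : Dir → Line
  special-line (fin u) = tangent u
  special-line inf = vertical-line

  special-direction : ∀ i → proj₁ (special-line i) ≡ i
  special-direction (fin u) = refl
  special-direction inf = refl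

  special-proper : ∀ i → Proper (special-line i)
  special-proper (fin u) = tangent-proper u
  special-proper inf = 𝟙≢𝟘

  same-slope : ∀ {w u} {a b : F} → _≡_ {A = Class} (inj₁ (fin w , a)) (inj₁ (fin u , b)) → w ≡ u
  same-slope refl = refl

  tangent-colours : ∀ {x u} c → classify (c , label x c) ≡ inj₁ (tangent u) → c ≡ dirColour (fin u) ⊎ c ≡ g₁ ⊎ c ≡ g₂
  tangent-colours {x} {u} main e with exceptional? inf x | intercept inf (pos x) ≟ 𝟘
  tangent-colours {x} {u} main () | yes _ | _
  tangent-colours {x} {u} main () | no _ | yes _
  ... | no _ | no ne with intercept inf (pos x) ≟ 𝟘
  tangent-colours {x} {u} main () | no _ | no ne | yes _
  tangent-colours {x} {u} main () | no _ | no ne | no _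
  tangent-colours g₁ e = inj₂ (inj₁ refl)
  tangent-colours g₂ e = inj₂ (inj₂ refl)
  tangent-colours {x} g₃ e with vertical? x
  tangent-colours {x} g₃ () | yes _
  tangent-colours {x} g₃ () | no _
  tangent-colours {x} {u} (other κ) e with splitAt q κ in eq
  tangent-colours {x} {u} (other κ) () | inj₂ _
  ... | inj₁ w with exceptional? (fin w) x | intercept (fin w) (pos x) ≟ 𝟘
  ... | yes _ | _ = inj₁ (cong other (trans (sym (splitAt⁻¹-↑ˡ eq)) (cong (_↑ˡ k) (same-slope e))))
  tangent-colours {x} {u} (other κ) () | inj₁ w | no _ | yes _
  ... | no _ | no ne with intercept (fin w) (pos x) ≟ 𝟘
  ... | yes z = contradiction z ne
  ... | no _ = inj₁ (cong other (trans (sym (splitAt⁻¹-↑ˡ eq)) (cong (_↑ˡ k) (same-slope e))))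

  vertical-colours : ∀ {x} c → classify (c , label x c) ≡ inj₁ vertical-line → c ≡ main ⊎ c ≡ g₃
  vertical-colours main e = inj₁ refl
  vertical-colours g₃ e = inj₂ refl
  vertical-colours {free-pos _ _ _} g₁ ()
  vertical-colours {at-node _ _ _} g₁ ()
  vertical-colours {extra _} g₁ ()
  vertical-colours {free-pos _ _ _} g₂ ()
  vertical-colours {at-node _ _ _} g₂ ()
  vertical-colours {extra _} g₂ ()
  vertical-colours {x} (other κ) e with splitAt q κ
  vertical-colours {x} (other κ) () | inj₂ _
  ... | inj₁ w with exceptional? (fin w) x | intercept (fin w) (pos x) ≟ 𝟘
  vertical-colours {x} (other κ) () | inj₁ w | yes _ | _
  vertical-colours {x} (other κ) () | inj₁ w | no _ | yes _
  ... | no _ | no ne with intercept (fin w) (pos x) ≟ 𝟘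
  vertical-colours {x} (other κ) () | inj₁ w | no _ | no ne | no _
  ... | yes z = contradiction z ne

  dirLabel-≢exception : ∀ i x → ¬ Exceptional i x → dirLabel i x ≢ exception
  dirLabel-≢exception i x nx e with exceptional? i x | intercept i (pos x) ≟ 𝟘
  dirLabel-≢exception i x nx e | yes ex | _ = nx ex
  dirLabel-≢exception i x nx () | no _ | yes _
  dirLabel-≢exception i x nx () | no _ | no _

  -- One vertex standing for the tangent `u` cannot hit all three points: in direction `u` only (u,
  -- u) is exceptional, `g₁` separates it from (v, u), and `g₂` separates it from (u, v).
  three-hosts : ∀ {s u v} c → u ≢ v → classify (c , label (at-node s u u) c) ≡ inj₁ (tangent u) →
    label (at-node s u u) c ≡ label (at-node s u v) c → label (at-node s u u) c ≡ label (at-node s v u) c → ⊥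
  three-hosts {s} {u} {v} c u≢v cl e e′ with tangent-colours {at-node s u u} c cl
  ... | inj₁ refl = dirLabel-≢exception (fin u) (at-node s u v) (λ (_ , u≡v) → u≢v u≡v)
        (trans (sym (label-dir (at-node s u v) (fin u))) (trans (sym e) (trans (label-dir (at-node s u u) (fin u)) (dirLabel-exception (fin u) (at-node s u u) (refl , refl)))))
  ... | inj₂ (inj₁ refl) = u≢v (tan-injective e′)
  ... | inj₂ (inj₂ refl) = u≢v (tan-injective e)

  -- For x = 1 two points suffice: `extra s` is exceptional in `main`, and `at-node s 𝟘 𝟙` is not
  -- `Vertical`.
  two-hosts : ∀ {s} c → classify (c , label (extra s) c) ≡ inj₁ vertical-line → label (extra s) c ≡ label (at-node s 𝟘 𝟙) c → ⊥
  two-hosts {s} c cl e with vertical-colours {extra s} c cl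
  ... | inj₁ refl = dirLabel-≢exception inf (at-node s 𝟘 𝟙) (λ ()) (trans (sym e) (dirLabel-exception inf (extra s) tt))
  ... | inj₂ refl with trans e (verticalLabel-no (at-node s 𝟘 𝟙) (λ (_ , z , _) → z refl))
  ... | ()

  lines-remove : ∀ 𝒜 {ℬ v ℓ} → classify v ≡ inj₁ ℓ → length (lines (𝒜 ++ [ v ] ++ ℬ)) ≡ suc (length (lines (𝒜 ++ ℬ)))
  lines-remove [] {ℬ} e = cong (λ c → length (consLine c (lines ℬ))) e
  lines-remove (w ∷ 𝒜) {ℬ} {v} e with classify w
  ... | inj₁ _ = cong suc (lines-remove 𝒜 {ℬ} {v} e)
  ... | inj₂ _ = lines-remove 𝒜 {ℬ} {v} e

  parallels : Dir → List Line
  parallels i = map (i ,_) nonzeros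

  unique-parallels : ∀ i → Unique (parallels i)
  unique-parallels i = Unique.map⁺ (cong proj₂) unique-nonzeros

  -- The tight case. With at most q - 1 lines and all other vertices on the broken line `i`, the
  -- lines have to be the q - 1 parallels of `i`, each represented by one vertex. But the split line
  -- among them has points that no single vertex hits together.
  module Saturated (𝒞 : List Vertex) (hits : ∀ x → Valid x → Hit 𝒞 x) (t₁≥1 : 1 ≤ t₁) (i : Dir)
    (few : length (lines 𝒞) ≤ 2 * h) (empty : ∀ j → i ≢ j → subs-size 𝒞 j ≡ 0) where

    not-more : ¬ q ≤ length (lines 𝒞)
    not-more le = ℕ.<-irrefl refl (ℕ.≤-trans (subst (_≤ length (lines 𝒞)) odd le) few)

    off-i : ∀ {p} → intercept i p ≢ 𝟘 → i ≢ dir p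
    off-i {p} ne refl = ne (dir-spec p)

    off-origin : ∀ {p} → intercept i p ≢ 𝟘 → p ≢ origin
    off-origin ne refl = ne (intercept-origin i)

    covered : ∀ p → intercept i p ≢ 𝟘 → Covers (lines 𝒞) p
    covered p ne = forced {𝒞} {t₁} {dir p} S.Free S.free-cover (off-origin ne) (dir-spec p)
      (λ s f → let x , vx , e , e′ = host p s (off-origin ne) f in x , e , e′ , hits x vx)
      (subst (_< t₁) (sym (empty (dir p) (off-i ne))) t₁≥1)

    parallel-∈ : ∀ e → e ≢ 𝟘 → (i , e) ∈ lines 𝒞
    parallel-∈ e e≢0 with Any.any? (×.≡-dec _≟ᴰ_ _≟_ (i , e)) (lines 𝒞)
    ... | yes m = m
    ... | no nm = contradiction (parallel-cover (lines-proper 𝒞) i e nm (λ p o → covered p (λ z → e≢0 (trans (sym o) z)))) not-more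

    only-parallels : ∀ {ℓ} → ℓ ∈ lines 𝒞 → proj₁ ℓ ≡ i
    only-parallels {j , e} ℓ∈ with j ≟ᴰ i
    ... | yes eq = eq
    ... | no ne = contradiction (ℕ.≤-trans length-nonzeros (subst (λ z → suc z ≤ length (lines 𝒞)) (length-map (i ,_) nonzeros) (unique-⊆-≤ (fresh ∷ unique-parallels i) (lines 𝒞) sub⊆))) not-more
      where
      fresh : All ((j , e) ≢_) (parallels i)
      fresh = All.map⁺ (All.universal (λ _ eq → ne (cong proj₁ eq)) nonzeros)
      sub⊆ : ∀ {ℓ} → ℓ ∈ (j , e) ∷ parallels i → ℓ ∈ lines 𝒞
      sub⊆ (here refl) = ℓ∈
      sub⊆ (there m) with ∈-map⁻ (i ,_) m
      ... | e′ , e′∈ , refl = parallel-∈ e′ (nonzeros-≢ e′∈)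

    special-vertex : ∀ x → Valid x → pos x on special-line i → ∃ λ c → (c , label x c) ∈ 𝒞 × classify (c , label x c) ≡ inj₁ (special-line i)
    special-vertex x vx o with hit-class {𝒞} {x} (hits x vx)
    ... | (c , _) , v∈ , refl , inc with classify (c , label x c) in eq
    ... | inj₂ (j , w) = contradiction (∈-subs⁺ v∈ eq) (none (empty j (λ { refl → special-proper i (trans (sym o) (subst (λ d → intercept d (pos x) ≡ 𝟘) (sym (special-direction i)) (proj₁ inc))) })))
      where
      none : ∀ {A : Set} {a : A} {xs} → length xs ≡ 0 → ¬ a ∈ xs
      none {xs = []} _ ()
    ... | inj₁ (j , e) = c , v∈ , trans eq (cong inj₁ (same i (only-parallels (∈-lines⁺ v∈ eq)) o inc))
      where
      same : ∀ {p j e} i → j ≡ i → p on special-line i → p on (j , e) → (j , e) ≡ special-line i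
      same (fin u) refl o o′ = cong (fin u ,_) (trans (sym o′) o)
      same inf refl o o′ = cong (inf ,_) (trans (sym o′) o)

    -- Without `v` all q - 1 parallels would still be there, so `v` would be line number q. The
    -- conclusion is doubly negated to avoid deciding equality of vertices; it is used for a
    -- contradiction only.
    special-once : ∀ {v v′} → v ∈ 𝒞 → v′ ∈ 𝒞 → classify v ≡ inj₁ (special-line i) → classify v′ ≡ inj₁ (special-line i) → ¬ v′ ≢ v
    special-once {v} {v′} v∈ v′∈ cl cl′ ne with ∈-∃++ v∈
    ... | 𝒜 , ℬ , refl = not-more (ℕ.≤-trans (subst (q ≤_) (cong suc (sym (length-map (i ,_) nonzeros))) length-nonzeros)
        (ℕ.≤-trans (s≤s (unique-⊆-≤ (unique-parallels i) (lines (𝒜 ++ ℬ)) stays)) (ℕ.≤-reflexive (sym (lines-remove 𝒜 {ℬ} {v} cl)))))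
      where
      stays : ∀ {ℓ} → ℓ ∈ parallels i → ℓ ∈ lines (𝒜 ++ ℬ)
      stays {ℓ} m with ∈-map⁻ (i ,_) m
      ... | e , e∈ , refl with ∈-lines⁻ 𝒞 (parallel-∈ e (nonzeros-≢ e∈))
      ... | w , w∈ , clw with e ≟ proj₂ (special-line i)
      ... | yes eq = subst (_∈ lines (𝒜 ++ ℬ)) (trans (cong (_, proj₂ (special-line i)) (special-direction i)) (cong (i ,_) (sym eq))) (∈-lines⁺ (∈-remove 𝒜 v′∈ ne) cl′)
      ... | no e≢ = ∈-lines⁺ (∈-remove 𝒜 w∈ (λ { refl → e≢ (cong proj₂ (inj₁-injective (trans (sym clw) cl))) })) clw

    impossible : ⊥
    -- A free point exists because otherwise the empty list would cover them all, against t₁ ≥ 1.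
    impossible = ℕ.<⇒≱ t₁≥1 (S.free-cover [] (λ s f → ⊥-elim (no-free i refl s f)))
      where
      no-free : ∀ j → i ≡ j → ∀ s → S.Free s → ⊥
      no-free (fin u) refl s f =
        let c , m , cl = special-vertex (at-node s u u) f (node-on u u)
            c₂ , m₂ , cl₂ = special-vertex (at-node s u (u ⊕ 𝟙)) f (node-on u (u ⊕ 𝟙))
            c₃ , m₃ , cl₃ = special-vertex (at-node s (u ⊕ 𝟙) u) f (node-on′ (u ⊕ 𝟙) u)
        in special-once m m₂ cl cl₂ λ e₂ → special-once m m₃ cl cl₃ λ e₃ →
           three-hosts {s} {u} {u ⊕ 𝟙} c (λ z → 𝟙≢𝟘 (trans (solve 2 (λ u o → o := (u :+ o) :- u) refl u 𝟙) (≡⇒⊖≡𝟘 (sym z)))) cl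
             (transport {at-node s u (u ⊕ 𝟙)} {at-node s u u} e₂) (transport {at-node s (u ⊕ 𝟙) u} {at-node s u u} e₃)
        where
        transport : ∀ {x y c c′} → (c′ , label x c′) ≡ (c , label y c) → label y c ≡ label x c
        transport {x} e = trans (sym (cong proj₂ e)) (cong (label x) (cong proj₁ e))
      no-free inf refl s f =
        let c , m , cl = special-vertex (extra s) f node-vertical
            c₂ , m₂ , cl₂ = special-vertex (at-node s 𝟘 𝟙) f node-vertical
        in special-once m m₂ cl cl₂ λ e → two-hosts {s} c cl (transport {at-node s 𝟘 𝟙} {extra s} e)
        where
        transport : ∀ {x y c c′} → (c′ , label x c′) ≡ (c , label y c) → label y c ≡ label x c
        transport {x} e = trans (sym (cong proj₂ e)) (cong (label x) (cong proj₁ e))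

  positive : ∀ {m n} → suc m ≤ 3 * n → 1 ≤ n
  positive {n = suc _} _ = s≤s z≤n

  -- Each inequality settles one count of rich broken lines. `t<2h` serves for none, where Jamison
  -- gives 4 h lines; `t+3≤h+t₁` for one or two with fewer than `t` vertices each, where 3 h - 2
  -- lines and `t₁` vertices are certain; `t<3t₁` for three or more, and `many` for all of them.
  module FullCover (t<2h : suc t ≤ 2 * h) (t+3≤h+t₁ : 3 + t ≤ h + t₁) (t<3t₁ : suc t ≤ 3 * t₁) (many : q + t ≤ suc q * t₁)
    (𝒞 : List Vertex) (hits : ∀ x → Valid x → Hit 𝒞 x) where

    m : ℕ
    m = length (lines 𝒞)

    a : Dir → ℕ
    a = subs-size 𝒞

    t₁≥1 : 1 ≤ t₁
    t₁≥1 = positive t<3t₁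

    q+t : q + t ≡ suc (2 * h + t)
    q+t = cong (_+ t) odd

    covered : ∀ {l p} → p ≢ origin → intercept l p ≡ 𝟘 → a l < t₁ → Covers (lines 𝒞) p
    covered {l} {p} p≢0 o lt = forced {𝒞} {t₁} {l} S.Free S.free-cover p≢0 o
      (λ s f → let x , vx , e , e′ = host p s p≢0 f in x , e , e′ , hits x vx) lt

    covered-full : ∀ {l p} → p ≢ origin → intercept l p ≡ 𝟘 → ¬ Special p → a l < t → Covers (lines 𝒞) p
    covered-full {l} {x , y} p≢0 o ns lt = forced {𝒞} {t} {l} S.Valid S.cover p≢0 o
      (λ s v → free-pos s x y , refl , refl , hits (free-pos s x y) (v , p≢0 , (λ b → ns (inj₁ b)) , λ e → contradiction (inj₂ e) ns)) lt

    one : ∀ i → m + a i ≤ length 𝒞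
    one i = ℕ.≤-trans (ℕ.+-monoʳ-≤ m (ℕ.m≤m+n (a i) 0)) (count 𝒞 {[ i ]} ([] ∷ []))

    two : ∀ {i j} → i ≢ j → m + a i + a j ≤ length 𝒞
    two {i} {j} ne = ℕ.≤-trans (ℕ.≤-reflexive (eq m (a i) (a j))) (count 𝒞 {i ∷ j ∷ []} ((ne ∷ []) ∷ [] ∷ []))
      where
      eq : ∀ m x y → m + x + y ≡ m + (x + (y + 0))
      eq = ℕ.solve-∀

    by-two-broken : ∀ {x} → 2 * (2 * h) ≤ m + suc (suc h) → t₁ ≤ x → q + t ≤ m + x
    by-two-broken {x} le t₁≤x = ℕ.+-cancelʳ-≤ (suc (suc h)) _ _ (begin
      q + t + suc (suc h)       ≡⟨ cong (_+ suc (suc h)) q+t ⟩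
      suc (2 * h + t) + suc (suc h) ≡⟨ eq₁ h t ⟩
      3 * h + (3 + t)           ≤⟨ ℕ.+-monoʳ-≤ (3 * h) t+3≤h+t₁ ⟩
      3 * h + (h + t₁)          ≡⟨ eq₂ h t₁ ⟩
      2 * (2 * h) + t₁          ≤⟨ ℕ.+-mono-≤ le t₁≤x ⟩
      m + suc (suc h) + x       ≡⟨ eq₃ m (suc (suc h)) x ⟩
      m + x + suc (suc h)       ∎)
      where
      open ℕ.≤-Reasoning
      eq₁ : ∀ h t → suc (2 * h + t) + suc (suc h) ≡ 3 * h + (3 + t)
      eq₁ = ℕ.solve-∀
      eq₂ : ∀ h t → 3 * h + (h + t) ≡ 2 * (2 * h) + t
      eq₂ = ℕ.solve-∀
      eq₃ : ∀ x y z → x + y + z ≡ x + z + y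
      eq₃ = ℕ.solve-∀

    by-one-line : ∀ {x} → 2 * h ≤ m → suc t ≤ x → q + t ≤ m + x
    by-one-line {x} le le′ = subst (_≤ m + x) (trans (ℕ.+-suc (2 * h) t) (sym q+t)) (ℕ.+-mono-≤ le le′)

    saturated : ∀ i → t ≤ a i → 2 * h ≤ m → length 𝒞 < q + t → ⊥
    saturated i t≤ le lt = Saturated.impossible 𝒞 hits t₁≥1 i m≤ zero-size
      where
      total : length 𝒞 ≤ 2 * h + t
      total = ℕ.≤-pred (subst (suc (length 𝒞) ≤_) q+t lt)
      m≤ : m ≤ 2 * h
      m≤ = ℕ.+-cancelʳ-≤ t _ _ (ℕ.≤-trans (ℕ.+-monoʳ-≤ m t≤) (ℕ.≤-trans (one i) total))
      zero-size : ∀ j → i ≢ j → a j ≡ 0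
      zero-size j ne = ℕ.n≤0⇒n≡0 (ℕ.+-cancelˡ-≤ (2 * h + t) _ _ (ℕ.≤-trans (ℕ.+-monoˡ-≤ (a j) (ℕ.+-mono-≤ le t≤)) (ℕ.≤-trans (two ne) (ℕ.≤-trans total (ℕ.≤-reflexive (sym (ℕ.+-identityʳ _)))))))

    bound : q + t ≤ length 𝒞
    bound with poor? 𝒞
    ... | inj₂ all = ℕ.≤-trans many (all-rich 𝒞 all)
    ... | inj₁ (d , poor) = by-rich (rich 𝒞) refl
      where
      2h≤m : 2 * h ≤ m
      2h≤m = ℕ.≤-pred (subst (_≤ suc m) odd (ray-cover (lines-proper 𝒞) d (λ p p≢0 o → covered {d} p≢0 o poor)))
      by-rich : ∀ js → rich 𝒞 ≡ js → q + t ≤ length 𝒞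
      by-rich [] e = ℕ.≤-trans (begin
          q + t             ≡⟨ q+t ⟩
          suc (2 * h + t)   ≡⟨ ℕ.+-suc (2 * h) t ⟨
          2 * h + suc t     ≤⟨ ℕ.+-monoʳ-≤ (2 * h) t<2h ⟩
          2 * h + 2 * h     ≡⟨ cong (2 * h +_) (ℕ.+-identityʳ (2 * h)) ⟨
          2 * (2 * h)       ≤⟨ subst (λ z → 2 * (z ℕ.∸ 1) ≤ m) odd (plane-cover (lines-proper 𝒞) (λ p p≢0 → covered {dir p} p≢0 (dir-spec p) (∉-rich 𝒞 (λ b → ∉[] (subst (dir p ∈_) e b))))) ⟩
          m                 ∎) (ℕ.≤-trans (ℕ.m≤m+n m (a inf)) (one inf))
        where open ℕ.≤-Reasoning
      by-rich (i ∷ []) e with t ℕ.≤? a i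
      -- The only case where 2 h lines and `t` vertices fall one short of q + t.
      ... | yes t≤ = ℕ.≮⇒≥ (saturated i t≤ 2h≤m)
      ... | no t≰ = ℕ.≤-trans (by-two-broken (two-broken (lines-proper 𝒞) {i} (proj₂ (otherDir i)) covers) (rich-≤ 𝒞 (subst (i ∈_) (sym e) (here refl)))) (one i)
        where
        covers : ∀ p → p ≢ origin → (intercept i p ≡ 𝟘 ⊎ intercept (proj₁ (otherDir i)) p ≡ 𝟘 → ¬ Special p) → Covers (lines 𝒞) p
        covers p p≢0 ns with dir p ≟ᴰ i
        ... | yes refl = covered-full {dir p} p≢0 (dir-spec p) (ns (inj₁ (dir-spec p))) (ℕ.≰⇒> t≰)
        ... | no ne = covered {dir p} p≢0 (dir-spec p) (∉-rich 𝒞 (λ b → ne (only (subst (dir p ∈_) e b))))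
          where
          only : ∀ {j} → j ∈ [ i ] → j ≡ i
          only (here eq) = eq
      by-rich (i ∷ j ∷ []) e with t ℕ.≤? a i | t ℕ.≤? a j | subst Unique e (unique-rich 𝒞)
      -- A single vertex on the other rich line is already the one that is missing.
      ... | yes t≤ | _ | (i≢j ∷ _) ∷ _ = ℕ.≤-trans (by-one-line 2h≤m (subst (_≤ a i + a j) (ℕ.+-comm t 1) (ℕ.+-mono-≤ t≤ (ℕ.≤-trans t₁≥1 (rich-≤ 𝒞 (subst (j ∈_) (sym e) (there (here refl))))))))
           (ℕ.≤-trans (ℕ.≤-reflexive (sym (ℕ.+-assoc m (a i) (a j)))) (two i≢j))
      ... | no _ | yes t≤ | (i≢j ∷ _) ∷ _ = ℕ.≤-trans (by-one-line 2h≤m (ℕ.+-mono-≤ (ℕ.≤-trans t₁≥1 (rich-≤ 𝒞 (subst (i ∈_) (sym e) (here refl)))) t≤))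
           (ℕ.≤-trans (ℕ.≤-reflexive (sym (ℕ.+-assoc m (a i) (a j)))) (two i≢j))
      ... | no t≰ | no t≰′ | (i≢j ∷ _) ∷ _ = ℕ.≤-trans (by-two-broken (two-broken (lines-proper 𝒞) i≢j covers) (rich-≤ 𝒞 (subst (i ∈_) (sym e) (here refl)))) (one i)
        where
        covers : ∀ p → p ≢ origin → (intercept i p ≡ 𝟘 ⊎ intercept j p ≡ 𝟘 → ¬ Special p) → Covers (lines 𝒞) p
        covers p p≢0 ns with dir p ≟ᴰ i | dir p ≟ᴰ j
        ... | yes refl | _ = covered-full {dir p} p≢0 (dir-spec p) (ns (inj₁ (dir-spec p))) (ℕ.≰⇒> t≰)
        ... | no _ | yes refl = covered-full {dir p} p≢0 (dir-spec p) (ns (inj₂ (dir-spec p))) (ℕ.≰⇒> t≰′)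
        ... | no ne | no ne′ = covered {dir p} p≢0 (dir-spec p) (∉-rich 𝒞 (λ b → only (subst (dir p ∈_) e b)))
          where
          only : ¬ dir p ∈ i ∷ j ∷ []
          only (here eq) = ne eq
          only (there (here eq)) = ne′ eq
      by-rich (i ∷ j ∷ l ∷ js) e with subst Unique e (unique-rich 𝒞)
      ... | (i≢j ∷ i≢l ∷ _) ∷ (j≢l ∷ _) ∷ _ = ℕ.≤-trans (by-one-line 2h≤m (ℕ.≤-trans t<3t₁ (ℕ.+-mono-≤ (rich! (here refl)) (ℕ.+-mono-≤ (rich! (there (here refl))) (ℕ.+-mono-≤ (rich! (there (there (here refl)))) z≤n)))))
          (count 𝒞 {i ∷ j ∷ l ∷ []} ((i≢j ∷ i≢l ∷ []) ∷ (j≢l ∷ []) ∷ [] ∷ []))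
        where
        rich! : ∀ {d} → d ∈ i ∷ j ∷ l ∷ js → t₁ ≤ a d
        rich! d∈ = rich-≤ 𝒞 (subst (_ ∈_) (sym e) d∈)

  step : ∀ {T₁} → suc t ≤ 2 * h → 3 + t ≤ h + t₁ → suc t ≤ 3 * t₁ → q + t ≤ suc q * t₁ → t₁ ≤ h → suc (suc T₁) ≤ h + t₁ → System (q + k) (q + t) T₁
  step t<2h t+3≤h+t₁ t<3t₁ many t₁≤h T₁≤ = record
    { Point = Point
    ; Label = Label
    ; _≟ᴸ_ = _≟ᴸ_
    ; points = points
    ; ∈-points = ∈-points
    ; Valid = Valid
    ; Free = Free
    ; valid? = valid?
    ; free? = free?
    ; free⇒valid = λ {x} → free⇒valid {x}
    ; label = label
    ; meets = λ {x} {y} → meets {x} {y}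
    ; free-meets = λ {x} {y} → free-meets {x} {y}
    ; cover = FullCover.bound t<2h t+3≤h+t₁ t<3t₁ many
    ; free-cover = λ 𝒞 hits → ℕ.≤-pred (ℕ.≤-pred (ℕ.≤-trans T₁≤ (FreeCover.bound t₁≥1 t₁≤h 𝒞 hits)))
    }
    where
    t₁≥1 : 1 ≤ t₁
    t₁≥1 = positive t<3t₁

-- Enlargement by a prime, and the system to start from.

module PrimeStep where

  open FiniteFields
  open Jamison using (primeField)
  open Systems
  open import Algebra.Bundles using (CommutativeRing)
  open import Data.Nat as ℕ using (_+_; _≤_; z≤n; s≤s)
  import Data.Nat.Properties as ℕ
  open import Data.Nat.Divisibility using (∣⇒≤)
  open import Data.Nat.Primality using (Prime)
  open import Data.Integer using (+_)
  open import Data.Fin using (_≟_; punchOut)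
  open import Data.Fin.Properties using (any?; all?; injective⇒≤; punchOut-injective)
  open import Data.List using ([_])
  open import Data.Unit using (⊤; tt)
  open import Relation.Nullary.Decidable using (¬?)

  module _ {r : ℕ} (K : Field (suc r)) (two≢𝟘 : Field._⊕_ K (Field.𝟙 K) (Field.𝟙 K) ≢ Field.𝟘 K) where
    open Field K
    open CommutativeRing commutativeRing using () renaming (-‿inverseʳ to ⊖-inverse)
    open Solver using (solve; _:*_; :-_; _:=_)

    -- Otherwise a choice of square roots would be an injection missing either the
    -- chosen root of 1 or its negative.
    nonSquare : ∃ λ n → ∀ x → x ⊗ x ≢ n
    nonSquare with any? (λ n → all? (λ x → ¬? (x ⊗ x ≟ n)))
    ... | yes found = found
    ... | no none = contradiction (injective⇒≤ {f = f} f-injective) (ℕ.<⇒≱ (ℕ.n<1+n r))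
      where
      root : ∀ n → ∃ λ x → x ⊗ x ≡ n
      root n with any? (λ x → x ⊗ x ≟ n)
      ... | yes found = found
      ... | no nr = contradiction (n , λ x e → nr (x , e)) none
      g : Fin (suc r) → Fin (suc r)
      g n = proj₁ (root n)
      g-injective : ∀ {a b} → g a ≡ g b → a ≡ b
      g-injective {a} {b} e = trans (sym (proj₂ (root a))) (trans (cong (λ x → x ⊗ x) e) (proj₂ (root b)))
      missed : Fin (suc r)
      missed = neg (g 𝟙)
      missed≢ : ∀ n → missed ≢ g n
      missed≢ n e = two≢𝟘 (trans (cong (𝟙 ⊕_) 𝟙≡-𝟙) (⊖-inverse 𝟙))
        where
        n≡𝟙 : n ≡ 𝟙
        n≡𝟙 = trans (sym (proj₂ (root n))) (trans (cong (λ x → x ⊗ x) (sym e)) (trans (solve 1 (λ x → (:- x) :* (:- x) := x :* x) refl (g 𝟙)) (proj₂ (root 𝟙))))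
        𝟙≡-g : g 𝟙 ≡ neg (g 𝟙)
        𝟙≡-g = trans (cong g (sym n≡𝟙)) (sym e)
        𝟙≡-𝟙 : 𝟙 ≡ neg 𝟙
        𝟙≡-𝟙 = trans (sym (proj₂ (root 𝟙))) (trans (cong (g 𝟙 ⊗_) 𝟙≡-g) (trans (solve 1 (λ x → x :* (:- x) := :- (x :* x)) refl (g 𝟙)) (cong neg (proj₂ (root 𝟙)))))
      f : Fin (suc r) → Fin r
      f n = punchOut (missed≢ n)
      f-injective : ∀ {a b} → f a ≡ f b → a ≡ b
      f-injective {a} {b} e = g-injective (punchOut-injective (missed≢ a) (missed≢ b) e)

  prime-step : ∀ {q h k t t₁ T₁} → Prime q → q ≡ suc (2 * h) → System k t t₁ →
    suc t ≤ 2 * h → 3 + t ≤ h + t₁ → suc t ≤ 3 * t₁ → q + t ≤ suc q * t₁ → t₁ ≤ h → suc (suc T₁) ≤ h + t₁ →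
    System (q + k) (q + t) T₁
  prime-step {q} {h} {t = t} {t₁} pr refl S t<2h = Enlargement.step (primeField pr) (proj₁ square) (proj₂ square) two≢𝟘 h refl S t<2h
    where
    open Residues q pr using (𝟘; 𝟙; _⊕_; π; π-+; π≡𝟘⇒∣)
    2≤2h : ∀ {t} h → suc t ≤ 2 * h → 2 ≤ 2 * h
    2≤2h (suc h) _ = ℕ.*-monoʳ-≤ 2 {1} (s≤s z≤n)
    two≢𝟘 : 𝟙 ⊕ 𝟙 ≢ 𝟘
    two≢𝟘 e = ℕ.<⇒≱ (s≤s (2≤2h h t<2h)) (∣⇒≤ (π≡𝟘⇒∣ 2 (trans (π-+ (+ 1) (+ 1)) e)))
    square = nonSquare (primeField pr) two≢𝟘

  -- One point under four partitions: the difference between partitions and cover number is 3 from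
  -- the start.
  singleton : System 0 1 1
  singleton = record
    { Point = ⊤ ; Label = ⊤ ; _≟ᴸ_ = λ _ _ → yes refl ; points = [ tt ] ; ∈-points = λ _ → here refl
    ; Valid = λ _ → ⊤ ; Free = λ _ → ⊤ ; valid? = λ _ → yes tt ; free? = λ _ → yes tt ; free⇒valid = λ _ → tt
    ; label = λ _ _ → tt ; meets = λ _ _ → main , refl ; free-meets = λ _ _ → main , main , refl
    ; cover = λ 𝒞 hits → nonempty 𝒞 (proj₁ (proj₂ (hits tt tt))) ; free-cover = λ 𝒞 hits → nonempty 𝒞 (proj₁ (proj₂ (hits tt tt))) }
    where
    nonempty : ∀ {A : Set} {v : A} 𝒞 → v ∈ 𝒞 → 1 ≤ length 𝒞
    nonempty (_ ∷ _) _ = s≤s z≤n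

-- Turning a system into a hypergraph.

module Realisation {k t t₁ : ℕ} (S : System k t t₁) where

  open Systems
  open import Data.Nat using (_+_; _≤_)


  open System S
  import Data.Nat.Properties as ℕ
  open import Data.Bool using (true; false)
  open import Data.Fin using (zero; suc; _≟_; remQuot; combine; _↑ˡ_; _↑ʳ_)
  open import Data.Fin.Properties using (any?; remQuot-combine; combine-remQuot; splitAt-↑ˡ; splitAt-↑ʳ)
  open import Data.Fin.Subset using (Subset; inside; outside; ∣_∣) renaming (_∈_ to _∈ₛ_)
  open import Data.List as List using (map; filter; allFin)
  open import Data.List.Properties using (length-map)
  open import Data.List.Membership.Propositional.Properties using (∈-map⁺; ∈-map⁻; ∈-filter⁺; ∈-filter⁻; ∈-allFin; ∈-lookup)
  open import Data.List.Relation.Unary.Any using (index)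
  open import Data.List.Relation.Unary.Any.Properties using (lookup-index)
  open import Data.Vec as Vec using ([]; _∷_; tabulate; lookup; here; there)
  open import Data.Vec.Properties using (lookup⇒[]=; []=⇒lookup; lookup∘tabulate)
  open import Relation.Nullary using (does)
  open import Relation.Nullary.Decidable using (dec-true)

  private
    colour : Fin (4 + k) → Colour k
    colour zero = main
    colour (suc zero) = g₁
    colour (suc (suc zero)) = g₂
    colour (suc (suc (suc zero))) = g₃
    colour (suc (suc (suc (suc κ)))) = other κ

    index-of : Colour k → Fin (4 + k)
    index-of main = zero
    index-of g₁ = suc zero
    index-of g₂ = suc (suc zero)
    index-of g₃ = suc (suc (suc zero))
    index-of (other κ) = suc (suc (suc (suc κ)))

    colour-index : ∀ c → colour (index-of c) ≡ c
    colour-index main = refl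
    colour-index g₁ = refl
    colour-index g₂ = refl
    colour-index g₃ = refl
    colour-index (other κ) = refl

    elements : ∀ {n} → Subset n → List (Fin n)
    elements [] = []
    elements (inside ∷ p) = zero ∷ map suc (elements p)
    elements (outside ∷ p) = map suc (elements p)

    length-elements : ∀ {n} (p : Subset n) → length (elements p) ≡ ∣ p ∣
    length-elements [] = refl
    length-elements (inside ∷ p) = cong suc (trans (length-map suc (elements p)) (length-elements p))
    length-elements (outside ∷ p) = trans (length-map suc (elements p)) (length-elements p)

    ∈-elements : ∀ {n} {p : Subset n} {i} → i ∈ₛ p → i ∈ elements p
    ∈-elements {p = inside ∷ p} here = here refl
    ∈-elements {p = inside ∷ p} (there m) = there (∈-map⁺ suc (∈-elements m))
    ∈-elements {p = outside ∷ p} (there m) = ∈-map⁺ suc (∈-elements m)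

    tabulate-cong : ∀ {n} {f g : Fin n → _} → (∀ i → f i ≡ g i) → tabulate {A = Data.Bool.Bool} f ≡ tabulate g
    tabulate-cong {0} e = refl
    tabulate-cong {suc n} e = cong₂ _∷_ (e zero) (tabulate-cong (e ∘ suc))

    card-empty : ∀ n → ∣ tabulate {n = n} (λ _ → false) ∣ ≡ 0
    card-empty 0 = refl
    card-empty (suc n) = card-empty n

    card-singleton : ∀ {n} (a : Fin n) → ∣ tabulate (λ j → does (a ≟ j)) ∣ ≡ 1
    card-singleton {suc n} zero = cong suc (card-empty n)
    card-singleton {suc n} (suc a) = card-singleton a

    card-+ : ∀ m {n} (f : Fin (m + n) → Data.Bool.Bool) → ∣ tabulate f ∣ ≡ ∣ tabulate (λ i → f (i ↑ˡ n)) ∣ + ∣ tabulate (λ i → f (m ↑ʳ i)) ∣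
    card-+ 0 f = refl
    card-+ (suc m) f with f zero
    ... | true = cong suc (card-+ m (f ∘ suc))
    ... | false = card-+ m (f ∘ suc)

    abstract
      quo : ∀ m n → Fin (m * n) → Fin m
      quo m n f = proj₁ (remQuot n f)

      rmd : ∀ m n → Fin (m * n) → Fin n
      rmd m n f = proj₂ (remQuot {m} n f)

      pair : ∀ m n → Fin m → Fin n → Fin (m * n)
      pair m n = combine

      quo-pair : ∀ m n i j → quo m n (pair m n i j) ≡ i
      quo-pair m n i j = cong proj₁ (remQuot-combine i j)

      rmd-pair : ∀ m n i j → rmd m n (pair m n i j) ≡ j
      rmd-pair m n i j = cong proj₂ (remQuot-combine {m} i j)

      pair-quo-rmd : ∀ m n f → pair m n (quo m n f) (rmd m n f) ≡ f
      pair-quo-rmd m n f = combine-remQuot {m} n f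

      -- An edge is the graph of a function from colours to codes, with one vertex in each row.
      card-graph : ∀ m n (g : Fin m → Fin n) → ∣ tabulate {n = m * n} (λ f → does (g (quo m n f) ≟ rmd m n f)) ∣ ≡ m
      card-graph 0 n g = refl
      card-graph (suc m) n g = trans (card-+ n _) (cong₂ _+_
        (trans (cong ∣_∣ (tabulate-cong {n} left)) (card-singleton (g zero)))
        (trans (cong ∣_∣ (tabulate-cong {m * n} right)) (card-graph m n (g ∘ suc))))
        where
        G : Fin (suc m) × Fin n → Data.Bool.Bool
        G (i , j) = does (g i ≟ j)
        left : ∀ i → G (remQuot {suc m} n (i ↑ˡ m * n)) ≡ does (g zero ≟ i)
        left i rewrite splitAt-↑ˡ n i (m * n) = refl
        right : ∀ i → G (remQuot {suc m} n (n ↑ʳ i)) ≡ does (g (suc (proj₁ (remQuot {m} n i))) ≟ proj₂ (remQuot {m} n i))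
        right i rewrite splitAt-↑ʳ n (m * n) i = refl

    pts : List Point
    pts = filter valid? points

    N : ℕ
    N = length pts

    pt : Fin N → Point
    pt = List.lookup pts

    pt-valid : ∀ i → Valid (pt i)
    pt-valid i = proj₂ (∈-filter⁻ valid? {xs = points} (∈-lookup {xs = pts} i))

    representative : ∀ c l → Dec (∃ λ j → label (pt j) c ≡ l)
    representative c l = any? (λ j → label (pt j) c ≟ᴸ l)

    pick : ∀ {c l} → Dec (∃ λ j → label (pt j) c ≡ l) → Fin N → Fin N
    pick (yes (j , _)) i = j
    -- Never reached from `code`, where `i` itself carries the label.
    pick (no _) i = i

    -- Labels are numbered without enumerating their type: a label becomes the index of a chosen
    -- valid point carrying it, so every colour class has `N` vertices.
    code : Fin N → Colour k → Fin N
    code i c = pick (representative c (label (pt i) c)) i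

    label-code : ∀ i c → label (pt (code i c)) c ≡ label (pt i) c
    label-code i c with representative c (label (pt i) c)
    ... | yes (j , e) = e
    ... | no _ = refl

    code-cong : ∀ {i j} c → label (pt i) c ≡ label (pt j) c → code i c ≡ code j c
    code-cong {i} {j} c e = trans (same (representative c (label (pt i) c)) (i , refl)) (cong (λ l → pick (representative c l) j) e)
      where
      same : ∀ {l} (d : Dec (∃ λ j → label (pt j) c ≡ l)) → (∃ λ j → label (pt j) c ≡ l) → pick d i ≡ pick d j
      same (yes _) _ = refl
      same (no ne) ex = contradiction ex ne

    edge : Fin N → Subset ((4 + k) * N)
    edge i = tabulate (λ f → does (code i (colour ((quo (4 + k) N f))) ≟ (rmd (4 + k) N f)))

    ∈-edge⁻ : ∀ i f → f ∈ₛ edge i → code i (colour ((quo (4 + k) N f))) ≡ (rmd (4 + k) N f)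
    ∈-edge⁻ i f m with code i (colour ((quo (4 + k) N f))) ≟ (rmd (4 + k) N f) in eq
    ... | yes e = e
    ... | no ne with trans (sym ([]=⇒lookup m)) (trans (lookup∘tabulate _ f) (cong does eq))
    ... | ()

    ∈-edge⁺ : ∀ i c → pair (4 + k) N (index-of c) (code i c) ∈ₛ edge i
    ∈-edge⁺ i c = lookup⇒[]= _ _ (trans (lookup∘tabulate _ (pair (4 + k) N (index-of c) (code i c))) (dec-true (_ ≟ _) eq))
      where
      eq : code i (colour (quo (4 + k) N (pair (4 + k) N (index-of c) (code i c)))) ≡ rmd (4 + k) N (pair (4 + k) N (index-of c) (code i c))
      eq = trans (cong (λ a → code i (colour a)) (quo-pair (4 + k) N (index-of c) (code i c)))
        (trans (cong (code i) (colour-index c)) (sym (rmd-pair (4 + k) N (index-of c) (code i c))))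

  hypergraph : Hypergraph
  hypergraph = record { numVertices = (4 + k) * N ; edges = map edge (allFin N) }

  private
    edge-of : ∀ {e} → e ∈ edges hypergraph → ∃ λ i → e ≡ edge i
    edge-of e∈ with ∈-map⁻ edge e∈
    ... | i , _ , eq = i , eq

  hypergraph-partite : Partite (4 + k) hypergraph
  hypergraph-partite = (λ f → (quo (4 + k) N f)) , partite
    where
    partite : ∀ {e} → e ∈ edges hypergraph → ∀ u v → u ∈ₛ e → v ∈ₛ e → (quo (4 + k) N u) ≡ (quo (4 + k) N v) → u ≡ v
    partite e∈ u v u∈ v∈ same with edge-of e∈
    ... | i , refl = trans (sym (pair-quo-rmd (4 + k) N u)) (trans (cong₂ (pair (4 + k) N) same (trans (sym (∈-edge⁻ i u u∈)) (trans (cong (code i ∘ colour) same) (∈-edge⁻ i v v∈)))) (pair-quo-rmd (4 + k) N v))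

  hypergraph-uniform : Uniform (4 + k) hypergraph
  hypergraph-uniform e∈ with edge-of e∈
  ... | i , refl = card-graph (4 + k) N (code i ∘ colour)

  hypergraph-intersecting : Intersecting hypergraph
  hypergraph-intersecting e∈ f∈ with edge-of e∈ | edge-of f∈
  ... | i , refl | j , refl with meets (pt-valid i) (pt-valid j)
  ... | c , eq = pair (4 + k) N (index-of c) (code i c) , ∈-edge⁺ i c , subst (λ z → pair (4 + k) N (index-of c) z ∈ₛ edge j) (sym (code-cong c eq)) (∈-edge⁺ j c)

  hypergraph-τ : τ≥ hypergraph t
  hypergraph-τ C covers = subst (t ≤_) (trans (length-map vertex (elements C)) (length-elements C)) (cover (map vertex (elements C)) hit)
    where
    vertex : Fin ((4 + k) * N) → Vertex
    vertex f = c , label (pt ((rmd (4 + k) N f))) c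
      where c = colour ((quo (4 + k) N f))
    hit : ∀ x → Valid x → Hit (map vertex (elements C)) x
    hit x vx with covers (∈-map⁺ edge (∈-allFin (index x∈)))
      where x∈ = ∈-filter⁺ valid? (∈-points x) vx
    ... | f , f∈e , f∈C = vertex f , ∈-map⁺ vertex (∈-elements f∈C) ,
      trans (cong (λ x → label x c) (lookup-index x∈)) (trans (sym (label-code (index x∈) c)) (cong (λ j → label (pt j) c) (∈-edge⁻ (index x∈) f f∈e)))
      where
      x∈ = ∈-filter⁺ valid? (∈-points x) vx
      c = colour ((quo (4 + k) N f))

-- Bertrand's postulate with a margin.

module Bertrand where

  open Jamison using (n*nCk; [k+1]*[n+1]C[k+1])
  open import Data.Nat
  open import Data.Nat.Properties
  open import Data.Nat.Divisibility
  open import Data.Nat.DivMod using (m/n*n≡m; m/n*n≤m; /-monoˡ-≤; m≡m%n+[m/n]*n; m%n<n)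
  open import Data.Nat.Combinatorics using (_C_; nCk+nC[k+1]≡[n+1]C[k+1]; k>n⇒nCk≡0; nCk≡nC[n∸k]; nCk≡n!/k![n-k]!; k![n∸k]!∣n!)
  open import Data.Nat.Primality using (Prime; prime?; euclidsLemma; prime⇒nonZero; prime⇒nonTrivial; ¬prime[0]; ¬prime[1]; prime⇒irreducible)
  open import Data.Nat.Primality.Factorisation using (factorise)
  open import Data.Nat.ListAction using (product)
  open import Data.Nat.ListAction.Properties using (product-++)
  open import Data.Nat.Induction using (<-rec)
  open import Data.Nat.Tactic.RingSolver using (solve-∀)
  open import Data.List using (_++_; map)
  open import Data.List.Properties using (map-++)
  open import Data.List.Membership.Propositional.Properties using (∈-++⁺ˡ; ∈-++⁺ʳ; ∈-map⁺)
  import Data.List.Relation.Unary.All as All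
  import Data.List.Relation.Unary.All.Properties as All
  open import Relation.Nullary.Decidable using (_×-dec_)

  prime>1 : ∀ {p} → Prime p → 1 < p
  prime>1 {p} pr = nonTrivial⇒n>1 p where instance _ = prime⇒nonTrivial pr

  prime>0 : ∀ {p} → Prime p → 0 < p
  prime>0 pr = <-trans (s≤s z≤n) (prime>1 pr)

  primeDivisor : ∀ n → 1 < n → ∃ λ p → Prime p × p ∣ n
  primeDivisor n@(suc _) 1<n with factorise n
  ... | record { factors = [] ; isFactorisation = refl } = contradiction 1<n (<-irrefl refl)
  ... | record { factors = p ∷ ps ; isFactorisation = e ; factorsPrime = pr ∷ _ } = p , pr , subst (p ∣_) (sym e) (m∣m*n (product ps))

  split-power : ∀ {p} → Prime p → ∀ n → 0 < n → ∃₂ λ a w → n ≡ p ^ a * w × ¬ p ∣ w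
  split-power {p} pr = <-rec _ go
    where
    go : ∀ n → (∀ {m} → m < n → 0 < m → ∃₂ λ a w → m ≡ p ^ a * w × ¬ p ∣ w) → 0 < n → ∃₂ λ a w → n ≡ p ^ a * w × ¬ p ∣ w
    go n rec 0<n with p ∣? n
    ... | no p∤n = 0 , n , sym (*-identityˡ n) , p∤n
    ... | yes (divides zero refl) = contradiction 0<n λ ()
    ... | yes (divides m@(suc _) refl) with rec {m} (m<m*n m p (prime>1 pr)) (s≤s z≤n)
    ... | a , w , e , p∤w = suc a , w , trans (cong (_* p) e) (trans (*-comm (p ^ a * w) p) (sym (*-assoc p (p ^ a) w))) , p∤w

  -- Bounds for the prime powers dividing `c`. Surplus entries, even composite or repeated ones, do
  -- no harm, so whole intervals can serve as candidates.
  Listed : ℕ → List (ℕ × ℕ) → Set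
  Listed c pbs = ∀ p → Prime p → p ∣ c → ∃ λ b → (p , b) ∈ pbs × (∀ a → p ^ a ∣ c → p ^ a ≤ b)

  ≤-product : ∀ pbs → All (λ pb → 1 ≤ proj₂ pb) pbs → ∀ c → 0 < c → Listed c pbs → c ≤ product (map proj₂ pbs)
  ≤-product [] [] c 0<c listed with 1 <? c
  ... | no c≤1 = ≮⇒≥ c≤1
  ... | yes 1<c with primeDivisor c 1<c
  ... | p , pr , p∣c with listed p pr p∣c
  ... | _ , () , _
  ≤-product ((p , b) ∷ pbs) (1≤b ∷ 1≤bs) c 0<c listed with prime? p
  ... | no np = ≤-trans (≤-product pbs 1≤bs c 0<c skip) (m≤n*m _ b {{>-nonZero 1≤b}})
    where
    skip : Listed c pbs
    skip p′ pr p∣c with listed p′ pr p∣c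
    ... | b′ , here refl , _ = contradiction pr np
    ... | b′ , there m , bound = b′ , m , bound
  ... | yes pr with split-power pr c 0<c
  ... | a , w , refl , p∤w with p ^ a ≤? b
  ... | yes pa≤b = *-mono-≤ pa≤b (≤-product pbs 1≤bs w 0<w rest)
    where
    0<w : 0 < w
    0<w = n≢0⇒n>0 (λ { refl → p∤w (p ∣0) })
    rest : Listed w pbs
    rest p′ pr′ p′∣w with listed p′ pr′ (∣n⇒∣m*n (p ^ a) p′∣w)
    ... | b′ , here refl , _ = contradiction p′∣w p∤w
    ... | b′ , there m , bound = b′ , m , λ a′ d → bound a′ (∣n⇒∣m*n (p ^ a) d)
  -- This entry does not bound the power of `p` in the number, so `Listed` must point to a later
  -- one.
  ... | no pa≰b = ≤-trans (≤-product pbs 1≤bs _ 0<c skip) (m≤n*m _ b {{>-nonZero 1≤b}})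
    where
    skip : Listed (p ^ a * w) pbs
    skip p′ pr′ p′∣c with listed p′ pr′ p′∣c
    ... | b′ , here refl , bound = contradiction (bound a (m∣m*n w)) pa≰b
    ... | b′ , there m , bound = b′ , m , bound

  -- Leibniz' harmonic triangle: 1/D = 1/D₁ − 1/D₂ for the entries D = (N+1) C(N,k+1),
  -- D₁ = N C(N−1,k) and D₂ = (N+1) C(N,k).
  leibniz : ∀ {L} N k → k ≤ N → (∀ i → 0 < i → i ≤ suc N → i ∣ L) → suc N * (N C k) ∣ L
  leibniz {L} N zero _ h = subst (_∣ L) (sym (*-identityʳ (suc N))) (h (suc N) (s≤s z≤n) ≤-refl)
  leibniz {L} (suc N) (suc k) (s≤s k≤N) h
    with leibniz N k k≤N (λ i 0<i i≤ → h i 0<i (m≤n⇒m≤1+n i≤)) | leibniz (suc N) k (m≤n⇒m≤1+n k≤N) h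
  ... | divides x L≡xD₁ | divides y L≡yD₂ = ∣m+n∣n⇒∣m (subst (D ∣_) D*x≡ (m∣m*n x)) (m∣m*n y)
    where
    A = suc N C suc k
    B = suc N C k
    D = suc (suc N) * A
    D₁ = suc N * (N C k)
    D₂ = suc (suc N) * B
    ∣m+n∣n⇒∣m : ∀ {m n} → D ∣ m + n → D ∣ n → D ∣ m
    ∣m+n∣n⇒∣m {m} {n} = ∣m+n∣m⇒∣n ∘ subst (D ∣_) (+-comm m n)
    D₁≡ : D₁ ≡ suc k * A
    D₁≡ = sym ([k+1]*[n+1]C[k+1] N k)
    D₂≡ : D₂ ≡ suc k * (A + B)
    D₂≡ = trans (cong (B +_) (n*nCk (suc N) k)) (lemma k A B)
      where
      lemma : ∀ k a b → b + (suc k * a + k * b) ≡ suc k * (a + b)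
      lemma = solve-∀
    triangle : D * D₂ ≡ D₁ * D₂ + D * D₁
    triangle = begin
      D * D₂                    ≡⟨ cong (D *_) D₂≡ ⟩
      D * (suc k * (A + B))     ≡⟨ lemma (suc (suc N)) A B (suc k) ⟩
      suc k * A * D₂ + D * (suc k * A) ≡⟨ cong (λ z → z * D₂ + D * z) D₁≡ ⟨
      D₁ * D₂ + D * D₁          ∎
      where
      open ≡-Reasoning
      lemma : ∀ n a b k → n * a * (k * (a + b)) ≡ k * a * (n * b) + n * a * (k * a)
      lemma = solve-∀
    positive : ∀ {n k} → k ≤ n → 0 < n C k
    positive {n} {zero} _ = s≤s z≤n
    positive {suc n} {suc k} (s≤s k≤n) = <-≤-trans (positive k≤n) (≤-trans (m≤m+n _ _) (≤-reflexive (nCk+nC[k+1]≡[n+1]C[k+1] n k)))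
    instance
      D₁≢0 : NonZero D₁
      D₁≢0 = m*n≢0 (suc N) (N C k) {{_}} {{>-nonZero (positive k≤N)}}
      D₂≢0 : NonZero D₂
      D₂≢0 = m*n≢0 (suc (suc N)) B {{_}} {{>-nonZero (positive (m≤n⇒m≤1+n k≤N))}}
      D₁D₂≢0 : NonZero (D₁ * D₂)
      D₁D₂≢0 = m*n≢0 D₁ D₂
    D*x≡ : D * x ≡ L + D * y
    D*x≡ = *-cancelʳ-≡ _ _ (D₁ * D₂) (begin
      D * x * (D₁ * D₂)               ≡⟨ l₁ D x D₁ D₂ ⟩
      D * D₂ * (x * D₁)               ≡⟨ cong₂ _*_ triangle (sym L≡xD₁) ⟩
      (D₁ * D₂ + D * D₁) * L          ≡⟨ *-distribʳ-+ L (D₁ * D₂) (D * D₁) ⟩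
      D₁ * D₂ * L + D * D₁ * L        ≡⟨ cong (λ z → D₁ * D₂ * L + D * D₁ * z) L≡yD₂ ⟩
      D₁ * D₂ * L + D * D₁ * (y * D₂) ≡⟨ l₂ D D₁ D₂ L y ⟩
      (L + D * y) * (D₁ * D₂)         ∎)
      where
      open ≡-Reasoning
      l₁ : ∀ d x d₁ d₂ → d * x * (d₁ * d₂) ≡ d * d₂ * (x * d₁)
      l₁ = solve-∀
      l₂ : ∀ d d₁ d₂ l y → d₁ * d₂ * l + d * d₁ * (y * d₂) ≡ (l + d * y) * (d₁ * d₂)
      l₂ = solve-∀

  module _ {p} (pr : Prime p) where

    private instance
      p≢0 : NonZero p
      p≢0 = prime⇒nonZero pr

    ∤-* : ∀ {m n} → ¬ p ∣ m → ¬ p ∣ n → ¬ p ∣ m * n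
    ∤-* {m} {n} a b d with euclidsLemma m n pr d
    ... | inj₁ h = a h
    ... | inj₂ h = b h

    ^-monoʳ-∣ : ∀ {a b} → a ≤ b → p ^ a ∣ p ^ b
    ^-monoʳ-∣ {a} {b} a≤b = divides (p ^ (b ∸ a)) (trans (cong (p ^_) (sym (m∸n+n≡m a≤b))) (^-distribˡ-+-* p (b ∸ a) a))

    -- Stands in for the least common multiple of 1, ..., M: only its exponent of `p` has to be
    -- right.
    commonMultiple : ∀ M → 0 < M → ∃₂ λ e W → p ^ e ≤ M × ¬ p ∣ W × (∀ i → 0 < i → i ≤ M → i ∣ p ^ e * W)
    commonMultiple (suc zero) _ = 0 , 1 , ≤-refl , (λ d → <⇒≱ (prime>1 pr) (∣⇒≤ d)) , λ i 0<i i≤1 → subst (_∣ 1) (≤-antisym 0<i i≤1) (divides 1 refl)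
    commonMultiple (suc M@(suc _)) _ with commonMultiple M (s≤s z≤n) | split-power pr (suc M) (s≤s z≤n)
    ... | e , W , pe≤ , p∤W , all | b , w , eq , p∤w = e ⊔ b , W * w , power≤ , ∤-* p∤W p∤w , divide
      where
      power≤ : p ^ (e ⊔ b) ≤ suc M
      power≤ with ⊔-sel e b
      ... | inj₁ h rewrite h = m≤n⇒m≤1+n pe≤
      ... | inj₂ h rewrite h = ≤-trans (m≤m*n (p ^ b) w {{≢-nonZero (λ { refl → p∤w (p ∣0) })}}) (≤-reflexive (sym eq))
      divide : ∀ i → 0 < i → i ≤ suc M → i ∣ p ^ (e ⊔ b) * (W * w)
      divide i 0<i i≤ with i ≟ suc M
      ... | yes refl = subst (_∣ p ^ (e ⊔ b) * (W * w)) (sym eq) (*-pres-∣ (^-monoʳ-∣ (m≤n⊔m e b)) (n∣m*n W))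
      ... | no ne = ∣-trans (all i 0<i (≤-pred (≤∧≢⇒< i≤ ne))) (*-pres-∣ (^-monoʳ-∣ (m≤m⊔n e b)) (m∣m*n w))

    power-∣ : ∀ {a e W} → ¬ p ∣ W → p ^ a ∣ p ^ e * W → a ≤ e
    power-∣ {zero} _ _ = z≤n
    power-∣ {suc a} {zero} {W} p∤W d = contradiction (∣-trans (m∣m*n (p ^ a)) (subst (p ^ suc a ∣_) (*-identityˡ W) d)) p∤W
    power-∣ {suc a} {suc e} {W} p∤W d = s≤s (power-∣ {a} {e} {W} p∤W (*-cancelˡ-∣ p (subst (p * p ^ a ∣_) (*-assoc p (p ^ e) W) d)))

    -- n C(2n, n) = 2n C(2n - 1, n - 1) is an entry of Leibniz' triangle and divides every common
    -- multiple of 1, ..., 2n. This takes the place of Legendre's formula.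
    central-power : ∀ n a → 0 < n → p ^ a ∣ (2 * n) C n → p ^ a ≤ 2 * n
    central-power n@(suc m) a _ d with commonMultiple (2 * n) (s≤s z≤n)
    ... | e , W , pe≤ , p∤W , all = ≤-trans (^-monoʳ-≤ p (power-∣ {a} {e} {W} p∤W (∣-trans d (∣-trans (divides n refl) (subst (_∣ p ^ e * W) (sym absorb) (leibniz N m (m≤m+n m _) all)))))) pe≤
      where
      N : ℕ
      N = m + 1 * n
      absorb : n * ((2 * n) C n) ≡ suc N * (N C m)
      absorb = [k+1]*[n+1]C[k+1] N m

    -- Below p² every multiple of `p` contributes exactly one factor `p`.
    factorial : ∀ a → a < p → ∀ j → j < p → ∃ λ w → (a * p + j) ! ≡ p ^ a * w × ¬ p ∣ w
    factorial zero _ zero _ = 1 , refl , λ d → <⇒≱ (prime>1 pr) (∣⇒≤ d)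
    factorial (suc a) a<p zero _ with factorial a (<-trans (n<1+n a) a<p) (p ∸ 1) (≤-reflexive (suc-pred p))
    ... | w , eq , p∤w = suc a * w , trans (cong _! step) (trans (cong₂ _*_ (sym step) eq) (lemma (suc a) p (p ^ a) w)) , ∤-* (λ d → <⇒≱ a<p (∣⇒≤ d)) p∤w
      where
      step : suc a * p + 0 ≡ suc (a * p + (p ∸ 1))
      step = trans (+-identityʳ _) (trans (+-comm p (a * p)) (trans (cong (a * p +_) (sym (suc-pred p))) (+-suc (a * p) (p ∸ 1))))
      lemma : ∀ a p q w → (a * p + 0) * (q * w) ≡ p * q * (a * w)
      lemma = solve-∀
    factorial a a<p (suc j) j<p with factorial a a<p j (<-trans (n<1+n j) j<p)
    ... | w , eq , p∤w = (a * p + suc j) * w , trans (cong _! (+-suc (a * p) j)) (trans (cong₂ _*_ (sym (+-suc (a * p) j)) eq) (lemma (a * p + suc j) (p ^ a) w)) ,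
        ∤-* (λ d → <⇒≱ j<p (∣⇒≤ (∣m+n∣m⇒∣n d (n∣m*n a)))) p∤w
      where
      lemma : ∀ x q w → x * (q * w) ≡ q * (x * w)
      lemma = solve-∀

    ∤-small! : ∀ {j} → j < p → ¬ p ∣ j !
    ∤-small! {j} j<p d with factorial 0 (prime>0 pr) j j<p
    ... | w , eq , p∤w = p∤w (subst (p ∣_) (trans eq (*-identityˡ w)) d)

  C*!*! : ∀ {n k} → k ≤ n → (n C k) * (k ! * (n ∸ k) !) ≡ n !
  C*!*! {n} {k} k≤n = trans (cong (_* (k ! * (n ∸ k) !)) (nCk≡n!/k![n-k]! k≤n)) (m/n*n≡m (k![n∸k]!∣n! k≤n))
    where instance _ = k !* (n ∸ k) !≢0

  2n∸n : ∀ n → 2 * n ∸ n ≡ n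
  2n∸n n = trans (m+n∸m≡n n (n + 0)) (+-identityʳ n)

  -- In this range `p` occurs once in n! and twice in (2n)!, so it cancels from the quotient.
  ∤-central : ∀ {p n} → Prime p → 2 < p → p ≤ n → 2 * n < 3 * p → ¬ p ∣ (2 * n) C n
  ∤-central {p} {n} pr 2<p p≤n 2n<3p d
    with factorial pr 1 (prime>1 pr) (n ∸ p) j<p | factorial pr 2 2<p (2 * n ∸ 2 * p) j′<p
    where
    j<p : n ∸ p < p
    j<p = +-cancelˡ-< p _ _ (subst (_< p + p) (sym (m+[n∸m]≡n p≤n)) (*-cancelˡ-< 2 n (p + p) (<-≤-trans 2n<3p (≤-trans (m≤m+n (3 * p) p) (≤-reflexive (lemma p))))))
      where
      lemma : ∀ p → 3 * p + p ≡ 2 * (p + p)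
      lemma = solve-∀
    j′<p : 2 * n ∸ 2 * p < p
    j′<p = +-cancelˡ-< (2 * p) _ _ (subst₂ _<_ (sym (m+[n∸m]≡n (*-monoʳ-≤ 2 p≤n))) (lemma p) 2n<3p)
      where
      lemma : ∀ p → 3 * p ≡ 2 * p + p
      lemma = solve-∀
  ... | w , eq , p∤w | w′ , eq′ , p∤w′ = p∤w′ (subst (p ∣_) (sym w′≡) (∣m⇒∣m*n (w * w) d))
    where
    instance _ = prime⇒nonZero pr
    n!≡ : n ! ≡ p * w
    n!≡ = trans (cong _! (sym (trans (cong (_+ (n ∸ p)) (*-identityˡ p)) (m+[n∸m]≡n p≤n)))) (trans eq (cong (_* w) (*-identityʳ p)))
    2n!≡ : (2 * n) ! ≡ p * p * w′
    2n!≡ = trans (cong _! (sym (m+[n∸m]≡n (*-monoʳ-≤ 2 p≤n)))) (trans eq′ (cong (λ z → p * z * w′) (*-identityʳ p)))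
    w′≡ : w′ ≡ ((2 * n) C n) * (w * w)
    w′≡ = *-cancelˡ-≡ _ _ (p * p) {{m*n≢0 p p}} (begin
      p * p * w′                              ≡⟨ 2n!≡ ⟨
      (2 * n) !                               ≡⟨ C*!*! (m≤m+n n (n + 0)) ⟨
      ((2 * n) C n) * (n ! * (2 * n ∸ n) !)   ≡⟨ cong (λ z → ((2 * n) C n) * (n ! * z !)) (2n∸n n) ⟩
      ((2 * n) C n) * (n ! * n !)             ≡⟨ cong (λ z → ((2 * n) C n) * (z * z)) n!≡ ⟩
      ((2 * n) C n) * (p * w * (p * w))       ≡⟨ lemma ((2 * n) C n) p w ⟩
      p * p * (((2 * n) C n) * (w * w))       ∎)
      where
      open ≡-Reasoning
      lemma : ∀ c p w → c * (p * w * (p * w)) ≡ p * p * (c * (w * w))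
      lemma = solve-∀

  product-∣-≤ : ∀ {xs c} → All Prime xs → Unique xs → 0 < c → (∀ {p} → p ∈ xs → p ∣ c) → product xs ≤ c
  product-∣-≤ [] [] 0<c _ = 0<c
  product-∣-≤ {p ∷ xs} (pr ∷ prs) (p∉ ∷ u) 0<c div with div (here refl)
  ... | divides c refl = ≤-trans (*-monoʳ-≤ p (product-∣-≤ prs u (n≢0⇒n>0 (λ { refl → contradiction 0<c λ () })) rest)) (≤-reflexive (*-comm p c))
    where
    rest : ∀ {q} → q ∈ xs → q ∣ c
    rest {q} q∈ with euclidsLemma c p (All.lookup prs q∈) (div (there q∈))
    ... | inj₁ h = h
    ... | inj₂ q∣p with prime⇒irreducible pr q∣p
    ... | inj₁ refl = contradiction (All.lookup prs q∈) ¬prime[1]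
    ... | inj₂ refl = contradiction refl (All.lookup p∉ q∈)

  [n+1]Ck≤2^n : ∀ n k → suc n C k ≤ 2 ^ n
  [n+1]Ck≤2^n zero zero = ≤-refl
  [n+1]Ck≤2^n zero (suc zero) = ≤-refl
  [n+1]Ck≤2^n zero (suc (suc k)) = ≤-trans (≤-reflexive (k>n⇒nCk≡0 {1} {suc (suc k)} (s≤s (s≤s z≤n)))) z≤n
  [n+1]Ck≤2^n (suc n) zero = m^n>0 2 (suc n)
  [n+1]Ck≤2^n (suc n) (suc k) = ≤-trans (≤-reflexive (sym (nCk+nC[k+1]≡[n+1]C[k+1] (suc n) k)))
    (≤-trans (+-mono-≤ ([n+1]Ck≤2^n n k) ([n+1]Ck≤2^n n (suc k))) (≤-reflexive (cong (2 ^ n +_) (sym (+-identityʳ (2 ^ n))))))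

  C-odd-symmetric : ∀ m → suc (2 * m) C m ≡ suc (2 * m) C suc m
  C-odd-symmetric m = trans (nCk≡nC[n∸k] (m≤n⇒m≤1+n (m≤m+n m (m + 0)))) (cong (suc (2 * m) C_) (trans (+-∸-assoc 1 {2 * m} {m} (m≤m+n m (m + 0))) (cong suc (2n∸n m))))

  C-odd-≤ : ∀ m → suc (2 * m) C m ≤ 4 ^ m
  C-odd-≤ m = *-cancelˡ-≤ 2 (begin
    2 * (suc (2 * m) C m)                             ≡⟨ cong (suc (2 * m) C m +_) (+-identityʳ _) ⟩
    suc (2 * m) C m + suc (2 * m) C m                 ≡⟨ cong (suc (2 * m) C m +_) (C-odd-symmetric m) ⟩
    suc (2 * m) C m + suc (2 * m) C suc m             ≡⟨ nCk+nC[k+1]≡[n+1]C[k+1] (suc (2 * m)) m ⟩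
    suc (suc (2 * m)) C suc m                         ≤⟨ [n+1]Ck≤2^n (suc (2 * m)) (suc m) ⟩
    2 * 2 ^ (2 * m)                                   ≡⟨ cong (2 *_) (^-*-assoc 2 2 m) ⟨
    2 * 4 ^ m                                         ∎)
    where open ≤-Reasoning

  addPrime : ℕ → List ℕ → List ℕ
  addPrime n xs with prime? n
  ... | yes _ = n ∷ xs
  ... | no _ = xs

  -- The primes p with a < p ≤ a + b.
  primesFrom : ℕ → ℕ → List ℕ
  primesFrom a zero = []
  primesFrom a (suc b) = addPrime (a + suc b) (primesFrom a b)

  product-addPrime : ∀ n xs ys z → product ys ≡ product xs * z → product (addPrime n ys) ≡ product (addPrime n xs) * z
  product-addPrime n xs ys z e with prime? n
  ... | yes _ = trans (cong (n *_) e) (sym (*-assoc n (product xs) z))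
  ... | no _ = e

  ∈-primesFrom⁻ : ∀ a b {p} → p ∈ primesFrom a b → Prime p × a < p × p ≤ a + b
  ∈-primesFrom⁻ a (suc b) p∈ with prime? (a + suc b)
  ∈-primesFrom⁻ a (suc b) (here refl) | yes pr = pr , m<m+n a (s≤s z≤n) , ≤-refl
  ∈-primesFrom⁻ a (suc b) (there m) | yes _ with ∈-primesFrom⁻ a b m
  ... | pr , lt , le = pr , lt , ≤-trans le (+-monoʳ-≤ a (n≤1+n b))
  ∈-primesFrom⁻ a (suc b) m | no _ with ∈-primesFrom⁻ a b m
  ... | pr , lt , le = pr , lt , ≤-trans le (+-monoʳ-≤ a (n≤1+n b))

  ∈-primesFrom⁺ : ∀ b {p} → Prime p → p ≤ b → p ∈ primesFrom 0 b
  ∈-primesFrom⁺ zero pr z≤n = contradiction pr ¬prime[0]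
  ∈-primesFrom⁺ (suc b) {p} pr p≤ with prime? (suc b) | p ≟ suc b
  ... | yes _ | yes e = here e
  ... | yes _ | no ne = there (∈-primesFrom⁺ b pr (≤-pred (≤∧≢⇒< p≤ ne)))
  ... | no np | yes refl = contradiction pr np
  ... | no _ | no ne = ∈-primesFrom⁺ b pr (≤-pred (≤∧≢⇒< p≤ ne))

  unique-primesFrom : ∀ a b → Unique (primesFrom a b)
  unique-primesFrom a zero = []
  unique-primesFrom a (suc b) with prime? (a + suc b)
  ... | yes _ = All.tabulate (λ {p} p∈ e → <-irrefl (sym e) (≤-trans (s≤s (proj₂ (proj₂ (∈-primesFrom⁻ a b p∈)))) (≤-reflexive (sym (+-suc a b))))) ∷ unique-primesFrom a b
  ... | no _ = unique-primesFrom a b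

  primesFrom-split : ∀ a b → product (primesFrom 0 (a + b)) ≡ product (primesFrom a b) * product (primesFrom 0 a)
  primesFrom-split a zero = trans (cong (λ z → product (primesFrom 0 z)) (+-identityʳ a)) (sym (*-identityˡ _))
  primesFrom-split a (suc b) = trans (cong (λ z → product (primesFrom 0 z)) (+-suc a b))
    (trans (product-addPrime (suc (a + b)) (primesFrom a b) (primesFrom 0 (a + b)) (product (primesFrom 0 a)) (primesFrom-split a b))
      (cong (λ z → product (addPrime z (primesFrom a b)) * product (primesFrom 0 a)) (sym (+-suc a b))))

  even-or-odd : ∀ n → (∃ λ m → n ≡ 2 * m) ⊎ (∃ λ m → n ≡ suc (2 * m))
  even-or-odd zero = inj₁ (0 , refl)
  even-or-odd (suc n) with even-or-odd n
  ... | inj₁ (m , refl) = inj₂ (m , refl)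
  ... | inj₂ (m , refl) = inj₁ (suc m , cong suc (sym (+-suc m (m + 0))))

  -- These primes divide (2m + 1)! but neither m! nor (m + 1)!, hence they divide C(2m + 1, m).
  middle-primes : ∀ m → product (primesFrom (suc m) m) ≤ 4 ^ m
  middle-primes m = ≤-trans (product-∣-≤ (All.tabulate (λ p∈ → proj₁ (∈-primesFrom⁻ (suc m) m p∈))) (unique-primesFrom (suc m) m) 0<C divide) (C-odd-≤ m)
    where
    le : m ≤ suc (2 * m)
    le = m≤n⇒m≤1+n (m≤m+n m (m + 0))
    rest : suc (2 * m) ∸ m ≡ suc m
    rest = trans (+-∸-assoc 1 {2 * m} {m} (m≤m+n m (m + 0))) (cong suc (2n∸n m))
    0<C : 0 < suc (2 * m) C m
    0<C = n≢0⇒n>0 (λ e → <⇒≢ (n!>0 (suc (2 * m))) (sym (trans (sym (C*!*! le)) (cong (_* (m ! * (suc (2 * m) ∸ m) !)) e))))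
      where
      n!>0 : ∀ n → 0 < n !
      n!>0 n = n≢0⇒n>0 (≢-nonZero⁻¹ (n !) {{n !≢0}})
    divide : ∀ {p} → p ∈ primesFrom (suc m) m → p ∣ suc (2 * m) C m
    divide {p} p∈ with ∈-primesFrom⁻ (suc m) m p∈
    ... | pr , m<p , p≤ with euclidsLemma (suc (2 * m) C m) (m ! * (suc (2 * m) ∸ m) !) pr (subst (p ∣_) (sym (C*!*! le)) p∣!)
      where
      p∣! : p ∣ suc (2 * m) !
      p∣! = ∣-trans (self p (prime>0 pr)) (m≤n⇒m!∣n! (≤-trans p≤ (≤-reflexive (cong (λ z → suc (m + z)) (sym (+-identityʳ m))))))
        where
        self : ∀ p → 0 < p → p ∣ p !
        self (suc p) _ = m∣m*n (p !)
    ... | inj₁ h = h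
    ... | inj₂ h = contradiction h (∤-* pr (∤-small! pr (<-trans (n<1+n m) m<p)) (λ d → ∤-small! pr m<p (subst (λ z → p ∣ z !) rest d)))

  -- Erdős' induction: an even n > 2 contributes no prime, and for n = 2m + 1 the primes above m + 1
  -- are paid for by `middle-primes`.
  primorial-≤ : ∀ n → product (primesFrom 0 n) ≤ 4 ^ n
  primorial-≤ = <-rec _ go
    where
    go : ∀ n → (∀ {m} → m < n → product (primesFrom 0 m) ≤ 4 ^ m) → product (primesFrom 0 n) ≤ 4 ^ n
    go n rec with even-or-odd n
    ... | inj₁ (zero , refl) = ≤-refl
    ... | inj₁ (suc zero , refl) = s≤s (s≤s z≤n)
    ... | inj₁ (suc (suc m) , refl) = ≤-trans drop (≤-trans (rec ≤-refl) (^-monoʳ-≤ 4 (n≤1+n (suc (m + suc (suc (m + 0)))))))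
      where
      composite : ¬ Prime (2 * suc (suc m))
      composite pr with prime⇒irreducible pr (m∣m*n {2} (suc (suc m)))
      ... | inj₁ ()
      ... | inj₂ e = <⇒≢ (*-monoʳ-< 2 {1} {suc (suc m)} (s≤s (s≤s z≤n))) e
      drop : product (primesFrom 0 (2 * suc (suc m))) ≤ product (primesFrom 0 (suc (m + suc (suc (m + 0)))))
      drop with prime? (2 * suc (suc m))
      ... | yes pr = contradiction pr composite
      ... | no _ = ≤-refl
    ... | inj₂ (zero , refl) = s≤s z≤n
    ... | inj₂ (suc m , refl) = begin
      product (primesFrom 0 (suc (2 * suc m)))  ≡⟨ cong (λ z → product (primesFrom 0 z)) (shape (suc m)) ⟩
      product (primesFrom 0 (suc (suc m) + suc m)) ≡⟨ primesFrom-split (suc (suc m)) (suc m) ⟩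
      product (primesFrom (suc (suc m)) (suc m)) * product (primesFrom 0 (suc (suc m)))
        ≤⟨ *-mono-≤ (middle-primes (suc m)) (rec (s≤s (s≤s (≤-trans (m≤n+m (suc m) m) (≤-reflexive (cong (λ z → m + suc z) (sym (+-identityʳ m)))))))) ⟩
      4 ^ suc m * 4 ^ suc (suc m)               ≡⟨ ^-distribˡ-+-* 4 (suc m) (suc (suc m)) ⟨
      4 ^ (suc m + suc (suc m))                 ≡⟨ cong (4 ^_) (trans (+-comm (suc m) (suc (suc m))) (sym (shape (suc m)))) ⟩
      4 ^ suc (2 * suc m)                       ∎
      where
      open ≤-Reasoning
      shape : ∀ m → suc (2 * m) ≡ suc m + m
      shape = solve-∀

  central-step : ∀ n → suc n * ((2 * suc n) C suc n) ≡ 2 * (suc (2 * n) * ((2 * n) C n))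
  central-step n = begin
    suc n * ((2 * suc n) C suc n)           ≡⟨ cong (λ z → suc n * (z C suc n)) (cong suc (+-suc n (n + 0))) ⟩
    suc n * (suc (suc (2 * n)) C suc n)     ≡⟨ [k+1]*[n+1]C[k+1] (suc (2 * n)) n ⟩
    suc (suc (2 * n)) * (suc (2 * n) C n)   ≡⟨ cong (suc (suc (2 * n)) *_) (C-odd-symmetric n) ⟩
    suc (suc (2 * n)) * (suc (2 * n) C suc n) ≡⟨ lemma n (suc (2 * n) C suc n) ⟩
    2 * (suc n * (suc (2 * n) C suc n))     ≡⟨ cong (2 *_) ([k+1]*[n+1]C[k+1] (2 * n) n) ⟩
    2 * (suc (2 * n) * ((2 * n) C n))       ∎
    where
    open ≡-Reasoning
    lemma : ∀ n x → suc (suc (2 * n)) * x ≡ 2 * (suc n * x)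
    lemma = solve-∀

  4^n≤ : ∀ n → 4 ^ suc n ≤ 2 * suc n * ((2 * suc n) C suc n)
  4^n≤ zero = ≤-refl
  4^n≤ (suc n) = begin
    4 * 4 ^ suc n                                         ≤⟨ *-monoʳ-≤ 4 (4^n≤ n) ⟩
    4 * (2 * suc n * ((2 * suc n) C suc n))               ≤⟨ *-monoʳ-≤ 4 (*-monoˡ-≤ ((2 * suc n) C suc n) (n≤1+n (2 * suc n))) ⟩
    4 * (suc (2 * suc n) * ((2 * suc n) C suc n))         ≡⟨ lemma (suc (2 * suc n) * ((2 * suc n) C suc n)) ⟩
    2 * (2 * (suc (2 * suc n) * ((2 * suc n) C suc n)))   ≡⟨ cong (2 *_) (central-step (suc n)) ⟨
    2 * (suc (suc n) * ((2 * suc (suc n)) C suc (suc n))) ≡⟨ *-assoc 2 (suc (suc n)) ((2 * suc (suc n)) C suc (suc n)) ⟨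
    2 * suc (suc n) * ((2 * suc (suc n)) C suc (suc n))   ∎
    where
    open ≤-Reasoning
    lemma : ∀ x → 4 * x ≡ 2 * (2 * x)
    lemma = solve-∀

  interval : (ℕ → ℕ) → ℕ → ℕ → List (ℕ × ℕ)
  interval a zero b = []
  interval a (suc k) b = (a (suc k) , b) ∷ interval a k b

  ∈-interval : ∀ a k b i → 0 < i → i ≤ k → (a i , b) ∈ interval a k b
  ∈-interval a zero b zero () z≤n
  ∈-interval a (suc k) b i 0<i i≤ with i ≟ suc k
  ... | yes refl = here refl
  ... | no ne = there (∈-interval a k b i 0<i (≤-pred (≤∧≢⇒< i≤ ne)))

  product-interval : ∀ a k b → product (map proj₂ (interval a k b)) ≡ b ^ k
  product-interval a zero b = refl
  product-interval a (suc k) b = cong (b *_) (product-interval a k b)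

  positive-interval : ∀ a k b → 1 ≤ b → All (λ pb → 1 ≤ proj₂ pb) (interval a k b)
  positive-interval a zero b _ = []
  positive-interval a (suc k) b 1≤b = 1≤b ∷ positive-interval a k b 1≤b

  diagonal : List ℕ → List (ℕ × ℕ)
  diagonal = map (λ p → p , p)

  product-diagonal : ∀ ps → product (map proj₂ (diagonal ps)) ≡ product ps
  product-diagonal [] = refl
  product-diagonal (p ∷ ps) = cong (p *_) (product-diagonal ps)

  module _ {n s : ℕ} (0<n : 0 < n) (s² : s * s ≤ 2 * n) (s²′ : 2 * n < suc s * suc s) (2≤s : 2 ≤ s) where

    private
      M = 2 * n / 3

      3M≤2n : 3 * M ≤ 2 * n
      3M≤2n = ≤-trans (≤-reflexive (*-comm 3 M)) (m/n*n≤m (2 * n) 3)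

      1≤2n : 1 ≤ 2 * n
      1≤2n = ≤-trans 0<n (m≤m+n n (n + 0))

      -- Primes up to s, bounded by 2n; primes up to 2n/3, which beyond s occur to the first power;
      -- and those in (n, n + s], bounded by 2n again. Admitting the last interval creates the
      -- margin s.
      candidates : List (ℕ × ℕ)
      candidates = interval (λ i → i) s (2 * n) ++ (diagonal (primesFrom 0 M) ++ interval (n +_) s (2 * n))

      product-candidates : product (map proj₂ candidates) ≡ (2 * n) ^ s * (product (primesFrom 0 M) * (2 * n) ^ s)
      product-candidates = trans (cong product (map-++ proj₂ (interval (λ i → i) s (2 * n)) _)) (trans (product-++ (map proj₂ (interval (λ i → i) s (2 * n))) _)
        (cong₂ _*_ (product-interval (λ i → i) s (2 * n)) (trans (cong product (map-++ proj₂ (diagonal (primesFrom 0 M)) _)) (trans (product-++ (map proj₂ (diagonal (primesFrom 0 M))) _)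
          (cong₂ _*_ (product-diagonal (primesFrom 0 M)) (product-interval (n +_) s (2 * n)))))))

      positive-candidates : All (λ pb → 1 ≤ proj₂ pb) candidates
      positive-candidates = All.++⁺ (positive-interval (λ i → i) s (2 * n) 1≤2n) (All.++⁺ (All.map⁺ (All.tabulate (λ p∈ → prime>0 (proj₁ (∈-primesFrom⁻ 0 M p∈))))) (positive-interval (n +_) s (2 * n) 1≤2n))

    no-large-primes : ¬ (∃ λ p → p < suc (2 * n) × (Prime p × n + s < p)) → Listed ((2 * n) C n) candidates
    no-large-primes none p pr p∣C with p ≤? s
    ... | yes p≤s = 2 * n , ∈-++⁺ˡ (∈-interval (λ i → i) s (2 * n) p (prime>0 pr) p≤s) , λ a → central-power pr n a 0<n
    ... | no p≰s with p ≤? M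
    ... | yes p≤M = p , ∈-++⁺ʳ (interval (λ i → i) s (2 * n)) (∈-++⁺ˡ (∈-map⁺ (λ p → p , p) (∈-primesFrom⁺ M pr p≤M))) , small
      where
      instance _ = prime⇒nonZero pr
      small : ∀ a → p ^ a ∣ (2 * n) C n → p ^ a ≤ p
      small zero _ = prime>0 pr
      small (suc zero) _ = ≤-reflexive (*-identityʳ p)
      -- A prime above s has a square above 2n, too large for `central-power`.
      small a@(suc (suc b)) d = contradiction (≤-trans (*-mono-≤ (≰⇒> p≰s) (≰⇒> p≰s))
        (≤-trans (≤-reflexive (cong (p *_) (sym (*-identityʳ p)))) (≤-trans (^-monoʳ-≤ p {2} {a} (s≤s (s≤s z≤n))) (central-power pr n a 0<n d)))) (<⇒≱ s²′)
    ... | no p≰M with p ≤? n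
    ... | yes p≤n = contradiction p∣C (∤-central pr (<-≤-trans (s≤s 2≤s) (≰⇒> p≰s)) p≤n
        (<-≤-trans (m<[m/n+1]*n (2 * n)) (≤-trans (*-monoˡ-≤ 3 (≰⇒> p≰M)) (≤-reflexive (*-comm p 3)))))
      where
      m<[m/n+1]*n : ∀ m → m < suc (m / 3) * 3
      m<[m/n+1]*n m = ≤-trans (s≤s (≤-reflexive (m≡m%n+[m/n]*n m 3))) (+-monoˡ-≤ (m / 3 * 3) (m%n<n m 3))
    ... | no p≰n with p ≤? n + s
    ... | no p≰ = contradiction (p , s≤s p≤2n , pr , ≰⇒> p≰) none
      where
      p≤2n : p ≤ 2 * n
      p≤2n = subst (_≤ 2 * n) (*-identityʳ p) (central-power pr n 1 0<n (subst (_∣ (2 * n) C n) (sym (*-identityʳ p)) p∣C))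
    ... | yes p≤n+s = 2 * n , ∈-++⁺ʳ (interval (λ i → i) s (2 * n)) (∈-++⁺ʳ (diagonal (primesFrom 0 M))
        (subst (λ z → (z , 2 * n) ∈ interval (n +_) s (2 * n)) (m+[n∸m]≡n (<⇒≤ (≰⇒> p≰n))) (∈-interval (n +_) s (2 * n) (p ∸ n) (m<n⇒0<n∸m (≰⇒> p≰n)) (+-cancelˡ-≤ n _ _ (subst (_≤ n + s) (sym (m+[n∸m]≡n (<⇒≤ (≰⇒> p≰n)))) p≤n+s))))) ,
        λ a → central-power pr n a 0<n

    -- Since 2n < (s + 1)² ≤ 4^h, all bounds become powers of 4. Without a large prime, n ≤ h (2s +
    -- 1) + 2n/3, that is 2n ≤ 6 h (2s + 1), against `few` and s² ≤ 2n.
    large-prime : ∀ h → suc s ≤ 2 ^ h → 6 * h * suc (2 * s) < s * s → ∃ λ p → p < suc (2 * n) × (Prime p × n + s < p)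
    large-prime h s<2^h few with anyUpTo? (λ p → prime? p ×-dec (n + s <? p)) (suc (2 * n))
    ... | yes found = found
    ... | no none = contradiction (^-cancelʳ-≤ n (h * suc (2 * s) + M) upper) (<⇒≱ exponent)
      where
      open ≤-Reasoning
      0<C : 0 < (2 * n) C n
      0<C = n≢0⇒n>0 (λ e → <⇒≢ (n≢0⇒n>0 (≢-nonZero⁻¹ ((2 * n) !) {{(2 * n) !≢0}})) (sym (trans (sym (C*!*! (m≤m+n n (n + 0)))) (cong (_* (n ! * (2 * n ∸ n) !)) e))))
      central≤ : (2 * n) C n ≤ (2 * n) ^ s * (4 ^ M * (2 * n) ^ s)
      central≤ = ≤-trans (≤-product candidates positive-candidates ((2 * n) C n) 0<C (no-large-primes none))
        (≤-trans (≤-reflexive product-candidates) (*-monoʳ-≤ ((2 * n) ^ s) (*-monoˡ-≤ ((2 * n) ^ s) (primorial-≤ M))))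
      2n≤4^h : 2 * n ≤ 4 ^ h
      2n≤4^h = ≤-trans (<⇒≤ s²′) (≤-trans (*-mono-≤ s<2^h s<2^h) (≤-reflexive (trans (sym (^-distribˡ-+-* 2 h h)) (trans (cong (λ z → 2 ^ (h + z)) (sym (+-identityʳ h))) (sym (^-*-assoc 2 2 h))))))
      power≤ : 4 ^ n ≤ 2 * n * ((2 * n) C n)
      power≤ = go n 0<n
        where
        go : ∀ n → 0 < n → 4 ^ n ≤ 2 * n * ((2 * n) C n)
        go (suc n) _ = 4^n≤ n
      upper : 4 ^ n ≤ 4 ^ (h * suc (2 * s) + M)
      upper = begin
        4 ^ n                                               ≤⟨ power≤ ⟩
        2 * n * ((2 * n) C n)                               ≤⟨ *-monoʳ-≤ (2 * n) central≤ ⟩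
        2 * n * ((2 * n) ^ s * (4 ^ M * (2 * n) ^ s))       ≡⟨ shape (2 * n) ((2 * n) ^ s) (4 ^ M) ⟩
        2 * n * ((2 * n) ^ s * (2 * n) ^ s) * 4 ^ M         ≡⟨ cong (λ z → 2 * n * z * 4 ^ M) (trans (cong ((2 * n) ^_) (cong (s +_) (+-identityʳ s))) (^-distribˡ-+-* (2 * n) s s)) ⟨
        (2 * n) ^ suc (2 * s) * 4 ^ M                       ≤⟨ *-monoˡ-≤ (4 ^ M) (^-monoˡ-≤ (suc (2 * s)) 2n≤4^h) ⟩
        (4 ^ h) ^ suc (2 * s) * 4 ^ M                       ≡⟨ cong (_* 4 ^ M) (^-*-assoc 4 h (suc (2 * s))) ⟩
        4 ^ (h * suc (2 * s)) * 4 ^ M                       ≡⟨ ^-distribˡ-+-* 4 (h * suc (2 * s)) M ⟨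
        4 ^ (h * suc (2 * s) + M)                           ∎
        where
        shape : ∀ x y z → x * (y * (z * y)) ≡ x * (y * y) * z
        shape = solve-∀
      ^-cancelʳ-≤ : ∀ a b → 4 ^ a ≤ 4 ^ b → a ≤ b
      ^-cancelʳ-≤ a b le with a ≤? b
      ... | yes h = h
      ... | no h = contradiction le (<⇒≱ (^-monoʳ-< 4 (s≤s (s≤s z≤n)) (≰⇒> h)))
      exponent : h * suc (2 * s) + M < n
      exponent = *-cancelˡ-< 6 _ _ (begin-strict
        6 * (h * suc (2 * s) + M)         ≡⟨ shape h (suc (2 * s)) M ⟩
        6 * h * suc (2 * s) + 2 * (3 * M) <⟨ +-mono-<-≤ few (*-monoʳ-≤ 2 3M≤2n) ⟩
        s * s + 2 * (2 * n)               ≤⟨ +-monoˡ-≤ (2 * (2 * n)) s² ⟩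
        2 * n + 2 * (2 * n)               ≡⟨ six n ⟩
        6 * n                             ∎)
        where
        shape : ∀ h x m → 6 * (h * x + m) ≡ 6 * h * x + 2 * (3 * m)
        shape = solve-∀
        six : ∀ n → 2 * n + 2 * (2 * n) ≡ 6 * n
        six = solve-∀

  13+12h≤2^h : ∀ d → 13 + (d + 7) * 12 ≤ 2 ^ (d + 7)
  13+12h≤2^h zero = ≤ᵇ⇒≤ 97 128 _
  13+12h≤2^h (suc d) = ≤-trans (double (d + 7)) (*-monoʳ-≤ 2 (13+12h≤2^h d))
    where
    double : ∀ m → 13 + suc m * 12 ≤ 2 * (13 + m * 12)
    double m = ≤-trans (m≤m+n (13 + suc m * 12) (1 + m * 12)) (≤-reflexive (lemma m))
      where
      lemma : ∀ m → 13 + suc m * 12 + (1 + m * 12) ≡ 2 * (13 + m * 12)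
      lemma = solve-∀

  -- Erdős' proof of Bertrand's postulate, with some room at the lower end.
  bertrand : ∀ {n s} → 85 ≤ s → s * s ≤ 2 * n → 2 * n < suc s * suc s → ∃ λ p → Prime p × n + s < p × p ≤ 2 * n
  bertrand {n} {s} 85≤s s² s²′ = conclude (large-prime {n} {s} 0<n s² s²′ (≤-trans (s≤s (s≤s z≤n)) 85≤s) h s<2^h few)
    where
    0<n : 0 < n
    0<n = *-cancelˡ-< 2 0 n (<-≤-trans (s≤s z≤n) (≤-trans (*-mono-≤ 85≤s 85≤s) s²))
    twelfth : ∀ m → 84 ≤ m → ∃ λ h → 7 ≤ h × h * 12 ≤ m × m ≤ h * 12 + 11
    twelfth m 84≤m = m / 12 , /-monoˡ-≤ 12 84≤m , m/n*n≤m m 12 ,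
      ≤-trans (≤-reflexive (m≡m%n+[m/n]*n m 12)) (≤-trans (≤-reflexive (+-comm (m % 12) (m / 12 * 12))) (+-monoʳ-≤ (m / 12 * 12) (≤-pred (m%n<n m 12))))
    -- Taking h as the integer part of (s - 1)/12 gives 12 h < s, whence `few`. The other condition,
    -- s + 1 ≤ 13 + 12 h ≤ 2^h, needs h ≥ 7, which is s ≥ 85.
    h-bounds = twelfth (s ∸ 1) (∸-monoˡ-≤ 1 85≤s)
    h : ℕ
    h = proj₁ h-bounds
    7≤h : 7 ≤ h
    7≤h = proj₁ (proj₂ h-bounds)
    s≡ : suc (s ∸ 1) ≡ s
    s≡ = m+[n∸m]≡n {1} (≤-trans (s≤s z≤n) 85≤s)
    12h<s : h * 12 < s
    12h<s = subst (h * 12 <_) s≡ (s≤s (proj₁ (proj₂ (proj₂ h-bounds))))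
    s<2^h : suc s ≤ 2 ^ h
    s<2^h = begin
      suc s                    ≡⟨ cong suc s≡ ⟨
      2 + (s ∸ 1)              ≤⟨ +-monoʳ-≤ 2 (proj₂ (proj₂ (proj₂ h-bounds))) ⟩
      2 + (h * 12 + 11)        ≡⟨ lemma (h * 12) ⟩
      13 + h * 12              ≤⟨ subst (λ h → 13 + h * 12 ≤ 2 ^ h) (m∸n+n≡m 7≤h) (13+12h≤2^h (h ∸ 7)) ⟩
      2 ^ h                    ∎
      where
      open ≤-Reasoning
      lemma : ∀ x → 2 + (x + 11) ≡ 13 + x
      lemma = solve-∀
    few : 6 * h * suc (2 * s) < s * s
    few = begin-strict
      6 * h * suc (2 * s)   ≡⟨ lemma h s ⟩
      h * 12 * s + 6 * h    ≤⟨ +-monoʳ-≤ (h * 12 * s) (≤-trans (*-monoˡ-≤ h (≤ᵇ⇒≤ 6 12 _)) (≤-reflexive (*-comm 12 h))) ⟩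
      h * 12 * s + h * 12   <⟨ +-monoʳ-< (h * 12 * s) 12h<s ⟩
      h * 12 * s + s        ≡⟨ +-comm (h * 12 * s) s ⟩
      suc (h * 12) * s      ≤⟨ *-monoˡ-≤ s 12h<s ⟩
      s * s                 ∎
      where
      open ≤-Reasoning
      lemma : ∀ h s → 6 * h * suc (2 * s) ≡ h * 12 * s + 6 * h
      lemma = solve-∀
    conclude : (∃ λ p → p < suc (2 * n) × (Prime p × n + s < p)) → ∃ λ p → Prime p × n + s < p × p ≤ 2 * n
    conclude (p , p≤ , pr , lt) = p , pr , lt , ≤-pred p≤

-- Reaching every large number of colours.

module Assembly where

  open Systems using (System)
  open PrimeStep using (prime-step; singleton)
  open Bertrand using (bertrand; even-or-odd; prime>1)
  open import Data.Nat
  open import Data.Nat.Properties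
  open import Data.Nat.Divisibility using (_∣?_; m∣m*n; hasNonTrivialDivisor)
  open import Data.Nat.DivMod using (m/n*n≤m; m≡m%n+[m/n]*n; m%n<n)
  open import Data.Nat.Induction using (<-rec)
  open import Data.Nat.Primality using (Prime; prime?; prime⇒irreducible; rough∧square>⇒prime)
  open import Data.Nat.Tactic.RingSolver using (solve-∀)
  open import Data.List using (map; _++_)
  open import Data.List.Relation.Unary.Any as Any using (any?)
  open import Data.List.Relation.Unary.All as All using (all?)
  import Data.List.Relation.Unary.All.Properties as All
  open import Data.List.Membership.Propositional using (find)
  open import Relation.Nullary.Decidable using (toWitness; ¬?; _×-dec_; _→-dec_)

  -- Systems with k + 4 colours and cover number k + 1, where the free points
  -- need almost half as many vertices as all points.
  Good : ℕ → ℕ → Set₁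
  Good k E = ∃ λ t₁ → System k (suc k) t₁ × 2 * t₁ ≤ suc k × suc k ≤ 2 * t₁ + E

  odd-prime : ∀ {q} → Prime q → 2 < q → ∃ λ h → q ≡ suc (2 * h)
  odd-prime {q} pr 2<q with even-or-odd q
  ... | inj₂ odd = odd
  ... | inj₁ (m , refl) with prime⇒irreducible pr (m∣m*n {2} m)
  ... | inj₁ ()
  ... | inj₂ e = contradiction e (<⇒≢ 2<q)

  -- Enlarges `singleton`. There t = t₁ = 1, so `prime-step` asks (q - 1)/2 to be at least 3, and
  -- the new `t₁` is (q - 1)/2 - 1.
  good-prime : ∀ {q} → Prime q → 7 ≤ q → Good q 4
  good-prime {q} pr 7≤q with odd-prime pr (≤-trans (s≤s (s≤s (s≤s z≤n))) 7≤q)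
  ... | zero , refl = contradiction 7≤q (<⇒≱ (s≤s (s≤s z≤n)))
  ... | suc h , refl = h , subst₂ (λ k t → System k t h) (+-identityʳ q) (+-comm q 1)
        (prime-step pr refl singleton (≤-trans (s≤s (s≤s z≤n)) (≤-trans 3≤h′ (m≤m+n (suc h) _)))
          (≤-trans (s≤s 3≤h′) (≤-reflexive (+-comm 1 (suc h)))) (s≤s (s≤s z≤n))
          (≤-reflexive (trans (+-comm q 1) (sym (*-identityʳ (suc q))))) (s≤s z≤n) (≤-reflexive (+-comm 1 (suc h)))) ,
        ≤-trans (*-monoʳ-≤ 2 (n≤1+n h)) (m≤n+m _ 2) , ≤-reflexive (lemma h)
    where
    3≤h′ : 3 ≤ suc h
    3≤h′ = *-cancelˡ-≤ 2 (≤-pred 7≤q)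
    lemma : ∀ h → suc (suc (2 * suc h)) ≡ 2 * h + 4
    lemma = solve-∀

  -- As 2 t₁ is at least t - E, the condition 3 + t ≤ h + t₁ follows from k + E + 8 ≤ q, and t < 3
  -- t₁ from 3 E + 1 ≤ k. The error grows by 5: the new `t₁` is h + t₁ - 2, which loses 4 after
  -- doubling, and q is odd.
  good-step : ∀ {q k E} → Prime q → Good k E → 1 ≤ E → 3 * E + 1 ≤ k → k + E + 8 ≤ q → Good (q + k) (E + 5)
  good-step {q} {k} {E} pr (t₁ , S , 2t₁≤ , ≤2t₁) 1≤E E≤k k≤q with odd-prime pr (≤-trans (s≤s (s≤s (s≤s z≤n))) (≤-trans (m≤n+m 8 (k + E)) k≤q))
  ... | h , refl = T₁ , subst (λ t → System (q + k) t T₁) (+-suc q k) (prime-step pr refl S c₁ c₂ c₃ c₄ c₅ (≤-reflexive T₁≡)) , below , above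
    where
    open ≤-Reasoning
    t : ℕ
    t = suc k
    T₁ : ℕ
    T₁ = h + t₁ ∸ 2
    h-bound : 6 + (t + E) ≤ 2 * h
    h-bound = ≤-pred (≤-trans (≤-reflexive (lemma k E)) k≤q)
      where
      lemma : ∀ k E → suc (6 + (suc k + E)) ≡ k + E + 8
      lemma = solve-∀
    c₁ : suc t ≤ 2 * h
    c₁ = ≤-trans (≤-trans (s≤s (m≤m+n t E)) (m≤n+m _ 5)) h-bound
    c₂ : 3 + t ≤ h + t₁
    c₂ = *-cancelˡ-≤ 2 (begin
      2 * (3 + t)          ≡⟨ l₁ t ⟩
      6 + t + t            ≤⟨ +-monoʳ-≤ (6 + t) ≤2t₁ ⟩
      6 + t + (2 * t₁ + E) ≡⟨ l₂ t (2 * t₁) E ⟩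
      6 + (t + E) + 2 * t₁ ≤⟨ +-monoˡ-≤ (2 * t₁) h-bound ⟩
      2 * h + 2 * t₁       ≡⟨ *-distribˡ-+ 2 h t₁ ⟨
      2 * (h + t₁)         ∎)
      where
      l₁ : ∀ t → 2 * (3 + t) ≡ 6 + t + t
      l₁ = solve-∀
      l₂ : ∀ t x E → 6 + t + (x + E) ≡ 6 + (t + E) + x
      l₂ = solve-∀
    c₃ : suc t ≤ 3 * t₁
    c₃ = *-cancelˡ-≤ 2 (+-cancelʳ-≤ (3 * E) _ _ (begin
      2 * suc t + 3 * E    ≡⟨ l₁ k E ⟩
      3 * E + 1 + (2 * k + 3) ≤⟨ +-monoˡ-≤ (2 * k + 3) E≤k ⟩
      k + (2 * k + 3)      ≡⟨ l₂ k ⟩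
      3 * t                ≤⟨ *-monoʳ-≤ 3 ≤2t₁ ⟩
      3 * (2 * t₁ + E)     ≡⟨ l₃ t₁ E ⟩
      2 * (3 * t₁) + 3 * E ∎))
      where
      l₁ : ∀ k E → 2 * suc (suc k) + 3 * E ≡ 3 * E + 1 + (2 * k + 3)
      l₁ = solve-∀
      l₂ : ∀ k → k + (2 * k + 3) ≡ 3 * suc k
      l₂ = solve-∀
      l₃ : ∀ x E → 3 * (2 * x + E) ≡ 2 * (3 * x) + 3 * E
      l₃ = solve-∀
    2≤t₁ : 2 ≤ t₁
    2≤t₁ = *-cancelˡ-< 3 1 t₁ (≤-trans (s≤s (≤-trans (*-monoʳ-≤ 3 1≤E) (≤-trans (m≤m+n (3 * E) 1) (≤-trans E≤k (n≤1+n k))))) c₃)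
    t≤q : t ≤ q
    t≤q = ≤-trans (≤-trans (n≤1+n t) c₁) (n≤1+n (2 * h))
    c₄ : q + t ≤ suc q * t₁
    c₄ = begin
      q + t       ≤⟨ +-mono-≤ (n≤1+n q) (≤-trans t≤q (n≤1+n q)) ⟩
      suc q + suc q ≡⟨ trans (cong (suc q +_) (sym (+-identityʳ (suc q)))) (*-comm 2 (suc q)) ⟩
      suc q * 2   ≤⟨ *-monoʳ-≤ (suc q) 2≤t₁ ⟩
      suc q * t₁  ∎
    c₅ : t₁ ≤ h
    c₅ = *-cancelˡ-≤ 2 (≤-trans 2t₁≤ (≤-trans (n≤1+n t) c₁))
    T₁≡ : suc (suc T₁) ≡ h + t₁
    T₁≡ = m+[n∸m]≡n {2} (≤-trans (s≤s (s≤s z≤n)) c₂)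
    below : 2 * T₁ ≤ suc (q + k)
    below = begin
      2 * T₁              ≤⟨ *-monoʳ-≤ 2 (m∸n≤m (h + t₁) 2) ⟩
      2 * (h + t₁)        ≡⟨ *-distribˡ-+ 2 h t₁ ⟩
      2 * h + 2 * t₁      ≤⟨ +-mono-≤ (n≤1+n (2 * h)) 2t₁≤ ⟩
      q + suc k           ≡⟨ +-suc q k ⟩
      suc (q + k)         ∎
    above : suc (q + k) ≤ 2 * T₁ + (E + 5)
    above = begin
      suc (q + k)               ≡⟨ +-suc q k ⟨
      q + suc k                 ≤⟨ +-monoʳ-≤ q ≤2t₁ ⟩
      q + (2 * t₁ + E)          ≡⟨ l₁ h t₁ E ⟩
      2 * (h + t₁) + (E + 1)    ≡⟨ cong (λ z → 2 * z + (E + 1)) T₁≡ ⟨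
      2 * suc (suc T₁) + (E + 1) ≡⟨ l₂ T₁ E ⟩
      2 * T₁ + (E + 5)          ∎
      where
      l₁ : ∀ h t E → suc (2 * h) + (2 * t + E) ≡ 2 * (h + t) + (E + 1)
      l₁ = solve-∀
      l₂ : ∀ T E → 2 * suc (suc T) + (E + 1) ≡ 2 * T + (E + 5)
      l₂ = solve-∀

  -- E grows by 5 while k more than doubles, so this bound persists and keeps E small against k.
  Reached : ℕ → Set₁
  Reached k = ∃ λ E → Good k E × 1 ≤ E × E * E ≤ k

  14E≤k : ∀ {E k} → 200 ≤ k → E * E ≤ k → 14 * E ≤ k
  14E≤k {E} {k} 200≤k E² with 14 ≤? E
  ... | yes 14≤E = ≤-trans (*-monoˡ-≤ E 14≤E) E²
  ... | no 14≰E = ≤-trans (*-monoʳ-≤ 14 (≤-pred (≰⇒> 14≰E))) (≤-trans (≤ᵇ⇒≤ 182 200 _) 200≤k)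

  reached-step : ∀ {q k} → Prime q → 200 ≤ k → ((E , _) : Reached k) → k + E + 8 ≤ q → Reached (q + k)
  reached-step {q} {k} pr 200≤k (E , good , 1≤E , E²) le =
    E + 5 , good-step pr good 1≤E 3E+1≤k le , ≤-trans 1≤E (m≤m+n E 5) , (begin
      (E + 5) * (E + 5)      ≡⟨ lemma E ⟩
      10 * E + 25 + E * E    ≤⟨ +-mono-≤ 10E≤q E² ⟩
      q + k                  ∎)
    where
    open ≤-Reasoning
    lemma : ∀ E → (E + 5) * (E + 5) ≡ 10 * E + 25 + E * E
    lemma = solve-∀
    3E+1≤k : 3 * E + 1 ≤ k
    3E+1≤k = ≤-trans (≤-trans (+-monoʳ-≤ (3 * E) 1≤E) (≤-trans (≤-reflexive (four E)) (*-monoˡ-≤ E (≤ᵇ⇒≤ 4 14 _)))) (14E≤k {E} 200≤k E²)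
      where
      four : ∀ E → 3 * E + E ≡ 4 * E
      four = solve-∀
    10E≤q : 10 * E + 25 ≤ q
    10E≤q with 17 ≤? 4 * E + E
    ... | yes 17≤5E = ≤-trans (≤-trans (≤-trans (+-monoʳ-≤ (10 * E) (+-monoˡ-≤ 8 17≤5E)) (≤-reflexive (shape E))) (+-monoˡ-≤ 8 (+-monoˡ-≤ E (14E≤k {E} 200≤k E²)))) le
      where
      shape : ∀ E → 10 * E + (4 * E + E + 8) ≡ 14 * E + E + 8
      shape = solve-∀
    ... | no 17≰5E = ≤-trans (+-monoˡ-≤ 25 (≤-trans (≤-reflexive (double E)) (*-monoʳ-≤ 2 (≤-pred (≰⇒> 17≰5E))))) (≤-trans (≤ᵇ⇒≤ 57 200 _) (≤-trans 200≤k (≤-trans (≤-trans (m≤m+n k E) (m≤m+n (k + E) 8)) le)))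
      where
      double : ∀ E → 10 * E ≡ 2 * (4 * E + E)
      double = solve-∀

  ReachedBelow : ℕ → Set₁
  ReachedBelow b = ∀ k → 200 ≤ k → k < b → Reached k

  -- A small value to which one prime is added in order to land at 200 or above. The bound by 200
  -- makes every such prime large enough for `good-step`, and E ≤ 9 yields (E + 5)² ≤ 196.
  Seed : ℕ → Set₁
  Seed k = ∃ λ E → Good k E × 1 ≤ E × 3 * E + 1 ≤ k × k + (k + E + 8) ≤ 200 × E ≤ 9

  singles : List ℕ
  singles = 13 ∷ 17 ∷ 19 ∷ 23 ∷ 29 ∷ 31 ∷ 37 ∷ 41 ∷ 43 ∷ 47 ∷ 53 ∷ 59 ∷ 61 ∷ 67 ∷ 71 ∷ 73 ∷ 79 ∷ 83 ∷ 89 ∷ []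

  -- Adding an odd prime to one of the odd `singles` gives even values only; these even sums provide
  -- the odd ones.
  pairs : List (ℕ × ℕ)
  pairs = (29 , 13) ∷ (31 , 13) ∷ (29 , 17) ∷ (31 , 17) ∷ (37 , 13) ∷ (41 , 13) ∷ (43 , 13) ∷ (41 , 17) ∷ (47 , 13) ∷ (43 , 19) ∷ (47 , 17) ∷ (53 , 13) ∷ (53 , 17) ∷
    (59 , 13) ∷ (61 , 13) ∷ (59 , 17) ∷ (61 , 17) ∷ (67 , 13) ∷ (59 , 23) ∷ (71 , 13) ∷ (73 , 13) ∷ (71 , 17) ∷ (73 , 17) ∷ []

  seeds : List ℕ
  seeds = singles ++ map (λ (q , p) → q + p) pairs

  abstract
    all-seeds : All Seed seeds
    all-seeds = All.++⁺ (All.map single (toWitness {a? = all? (λ p → prime? p ×-dec (13 ≤? p) ×-dec (p ≤? 94)) singles} _))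
      (All.map⁺ (All.map double (toWitness {a? = all? (λ (q , p) → prime? q ×-dec prime? p ×-dec (13 ≤? p) ×-dec (p + 12 ≤? q) ×-dec (q + p ≤? 91)) pairs} _)))
      where
      single : ∀ {p} → Prime p × 13 ≤ p × p ≤ 94 → Seed p
      single {p} (pr , 13≤p , p≤94) = 4 , good-prime pr (≤-trans (≤ᵇ⇒≤ 7 13 _) 13≤p) , s≤s z≤n , 13≤p , +-mono-≤ p≤94 (+-monoˡ-≤ 8 (+-monoˡ-≤ 4 p≤94)) , ≤ᵇ⇒≤ 4 9 _
      double : ∀ {qp : ℕ × ℕ} → Prime (proj₁ qp) × Prime (proj₂ qp) × 13 ≤ proj₂ qp × proj₂ qp + 12 ≤ proj₁ qp × proj₁ qp + proj₂ qp ≤ 91 → Seed (proj₁ qp + proj₂ qp)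
      double {q , p} (prq , prp , 13≤p , p≤q , q+p≤) = 9 , good-step prq (good-prime prp (≤-trans (≤ᵇ⇒≤ 7 13 _) 13≤p)) (s≤s z≤n) 13≤p (≤-trans (≤-reflexive (+-assoc p 4 8)) p≤q) ,
        s≤s z≤n , +-mono-≤ {15} (≤-trans (+-monoˡ-≤ 2 13≤p) (≤-trans (+-monoʳ-≤ p (≤ᵇ⇒≤ 2 12 _)) p≤q)) 13≤p , ≤-trans (+-mono-≤ q+p≤ (+-monoˡ-≤ 8 (+-monoˡ-≤ 9 q+p≤))) (≤ᵇ⇒≤ 199 200 _) , ≤-refl

  -- Much cheaper to evaluate than prime?.
  Trial : ℕ → ℕ → Set
  Trial m n = 1 < n × n < m * m × (∀ {d} → d < m → 1 < d → d ∤ n)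

  trial? : ∀ m n → Dec (Trial m n)
  trial? m n = (1 <? n) ×-dec (n <? m * m) ×-dec allUpTo? (λ d → (1 <? d) →-dec ¬? (d ∣? n)) m

  trial⇒prime : ∀ {m n} → Trial m n → Prime n
  trial⇒prime {m} {n} (1<n , n<m² , rough) = rough∧square>⇒prime {{n>1⇒nonTrivial 1<n}}
    (λ { (hasNonTrivialDivisor {divisor = d} d<m d∣n) → rough d<m (nonTrivial⇒n>1 d) d∣n }) n<m²

  abstract
    -- All candidates are below 650 < 26², so trial divisors below 26 suffice.
    initial-search : ∀ {i} → i < 450 → Any (λ a → Trial 26 (200 + i ∸ a)) seeds
    initial-search = toWitness {a? = allUpTo? (λ i → any? (λ a → trial? 26 (200 + i ∸ a)) seeds) 450} _

  from-seed : ∀ {k a} → 200 ≤ k → Seed a → Prime (k ∸ a) → Reached k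
  from-seed {k} {a} 200≤k (E , good , 1≤E , 3E+1≤a , small , E≤9) pr = subst Reached (m∸n+n≡m a≤k)
    (E + 5 , good-step pr good 1≤E 3E+1≤a rest≥ , ≤-trans 1≤E (m≤m+n E 5) , ≤-trans square≤ (≤-trans 200≤k (≤-reflexive (sym (m∸n+n≡m a≤k)))))
    where
    a≤k : a ≤ k
    a≤k = ≤-trans (m≤m+n a (a + E + 8)) (≤-trans small 200≤k)
    rest≥ : a + E + 8 ≤ k ∸ a
    rest≥ = m+n≤o⇒m≤o∸n (a + E + 8) (≤-trans (≤-reflexive (+-comm (a + E + 8) a)) (≤-trans small 200≤k))
    square≤ : (E + 5) * (E + 5) ≤ 200
    square≤ = ≤-trans (*-mono-≤ (+-monoˡ-≤ 5 E≤9) (+-monoˡ-≤ 5 E≤9)) (≤ᵇ⇒≤ 196 200 _)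

  initial : ReachedBelow 650
  initial k 200≤k k<650 = conclude (find (initial-search i<450))
    where
    i<450 : k ∸ 200 < 450
    i<450 = +-cancelˡ-< 200 (k ∸ 200) 450 (subst (_< 650) (sym (m+[n∸m]≡n 200≤k)) k<650)
    conclude : (∃ λ a → a ∈ seeds × Trial 26 (200 + (k ∸ 200) ∸ a)) → Reached k
    conclude (a , a∈ , tr) = from-seed 200≤k (All.lookup all-seeds a∈) (subst (λ z → Prime (z ∸ a)) (m+[n∸m]≡n 200≤k) (trial⇒prime {26} tr))

  -- A value from q + 200 on is q plus an already reached k'. By `14E≤k` the requirement k' + E + 8
  -- ≤ q follows from 15 k' + 112 ≤ 14 q.
  extend : ∀ {b} q c → Prime q → q + 200 ≤ b → c ≤ b → 15 * c + 112 ≤ 14 * q → ReachedBelow b → ReachedBelow (q + c)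
  extend q c pr q+200≤b c≤b bound below k 200≤k k<q+c with k <? q + 200
  ... | yes k< = below k 200≤k (≤-trans k< q+200≤b)
  ... | no k≮ = subst Reached (m+[n∸m]≡n q≤k) (reached-step pr 200≤k′ (below k′ 200≤k′ (<-≤-trans k′<c c≤b)) fits)
    where
    open ≤-Reasoning
    q≤k : q ≤ k
    q≤k = ≤-trans (m≤m+n q 200) (≮⇒≥ k≮)
    k′ : ℕ
    k′ = k ∸ q
    200≤k′ : 200 ≤ k′
    200≤k′ = m+n≤o⇒m≤o∸n 200 (≤-trans (≤-reflexive (+-comm 200 q)) (≮⇒≥ k≮))
    k′<c : k′ < c
    k′<c = +-cancelˡ-< q _ _ (subst (_< q + c) (sym (m+[n∸m]≡n q≤k)) k<q+c)
    reached = below k′ 200≤k′ (<-≤-trans k′<c c≤b)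
    E = proj₁ reached
    fits : k′ + E + 8 ≤ q
    fits = *-cancelˡ-≤ 14 (begin
      14 * (k′ + E + 8)        ≡⟨ shape k′ E ⟩
      14 * k′ + 112 + 14 * E   ≤⟨ +-monoʳ-≤ (14 * k′ + 112) (14E≤k {E} 200≤k′ (proj₂ (proj₂ (proj₂ reached)))) ⟩
      14 * k′ + 112 + k′       ≡⟨ collect k′ ⟩
      15 * k′ + 112            ≤⟨ +-monoˡ-≤ 112 (*-monoʳ-≤ 15 (<⇒≤ k′<c)) ⟩
      15 * c + 112             ≤⟨ bound ⟩
      14 * q                   ∎)
      where
      shape : ∀ k E → 14 * (k + E + 8) ≡ 14 * k + 112 + 14 * E
      shape = solve-∀
      collect : ∀ k → 14 * k + 112 + k ≡ 15 * k + 112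
      collect = solve-∀

  -- Greedy from the inside out: each prime is the largest one not exceeding the current bound minus
  -- 200, and `c` is the largest value its inequality admits.
  reached-small : ReachedBelow 44221
  reached-small =
    extend 22877 21344 (trial⇒prime {152} (toWitness {a? = trial? 152 22877} _)) (≤ᵇ⇒≤ 23077 23078 _) (≤ᵇ⇒≤ 21344 23078 _) (≤ᵇ⇒≤ (15 * 21344 + 112) (14 * 22877) _) (
    extend 11941 11137 (trial⇒prime {110} (toWitness {a? = trial? 110 11941} _)) (≤ᵇ⇒≤ 12141 12147 _) (≤ᵇ⇒≤ 11137 12147 _) (≤ᵇ⇒≤ (15 * 11137 + 112) (14 * 11941) _) (
    extend 6287 5860 (trial⇒prime {80} (toWitness {a? = trial? 80 6287} _)) (≤ᵇ⇒≤ 6487 6490 _) (≤ᵇ⇒≤ 5860 6490 _) (≤ᵇ⇒≤ (15 * 5860 + 112) (14 * 6287) _) (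
    extend 3361 3129 (trial⇒prime {58} (toWitness {a? = trial? 58 3361} _)) (≤ᵇ⇒≤ 3561 3563 _) (≤ᵇ⇒≤ 3129 3563 _) (≤ᵇ⇒≤ (15 * 3129 + 112) (14 * 3361) _) (
    extend 1847 1716 (trial⇒prime {43} (toWitness {a? = trial? 43 1847} _)) (≤ᵇ⇒≤ 2047 2047 _) (≤ᵇ⇒≤ 1716 2047 _) (≤ᵇ⇒≤ (15 * 1716 + 112) (14 * 1847) _) (
    extend 1063 984 (trial⇒prime {33} (toWitness {a? = trial? 33 1063} _)) (≤ᵇ⇒≤ 1263 1266 _) (≤ᵇ⇒≤ 984 1266 _) (≤ᵇ⇒≤ (15 * 984 + 112) (14 * 1063) _) (
    extend 659 607 (trial⇒prime {26} (toWitness {a? = trial? 26 659} _)) (≤ᵇ⇒≤ 859 860 _) (≤ᵇ⇒≤ 607 860 _) (≤ᵇ⇒≤ (15 * 607 + 112) (14 * 659) _) (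
    extend 449 411 (trial⇒prime {22} (toWitness {a? = trial? 22 449} _)) (≤ᵇ⇒≤ 649 650 _) (≤ᵇ⇒≤ 411 650 _) (≤ᵇ⇒≤ (15 * 411 + 112) (14 * 449) _) (
    initial))))))))

  sqrt : ∀ m → ∃ λ s → s * s ≤ m × m < suc s * suc s
  sqrt zero = 0 , z≤n , s≤s z≤n
  sqrt (suc m) with sqrt m
  ... | s , s² , s²′ with suc m <? suc s * suc s
  ... | yes lt = s , m≤n⇒m≤1+n s² , lt
  ... | no ≮ = suc s , ≮⇒≥ ≮ , <-≤-trans (s≤s s²′) (≤-trans (m≤m+n _ _) (≤-reflexive (lemma s)))
    where
    lemma : ∀ s → suc (suc s * suc s) + (2 * s + 2) ≡ suc (suc s) * suc (suc s)
    lemma = solve-∀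
  -- With n about (k - 200)/2, a prime p ≤ 2n leaves k' = k - p ≥ 200. The margin s serves twice: p
  -- > n + s lowers k' by s, which pays for E ≤ s, and it lifts p above n + 208, where 208 = 200 +
  -- 8. The threshold 44221 ensures s ≥ 209.
  reached-large : ∀ k → 44221 ≤ k → (∀ {k′} → k′ < k → 200 ≤ k′ → Reached k′) → Reached k
  reached-large k large rec = from-prime (bertrand {n} {s} (≤-trans (≤ᵇ⇒≤ 85 209 _) 209≤s) s² s²′)
    where
    open ≤-Reasoning
    n : ℕ
    n = (k ∸ 200) / 2
    200≤k : 200 ≤ k
    200≤k = ≤-trans (≤ᵇ⇒≤ 200 44221 _) large
    2n+200≤k : 2 * n + 200 ≤ k
    2n+200≤k = ≤-trans (+-monoˡ-≤ 200 (≤-trans (≤-reflexive (*-comm 2 n)) (m/n*n≤m (k ∸ 200) 2))) (≤-reflexive (m∸n+n≡m 200≤k))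
    k≤2n+201 : k ≤ 2 * n + 201
    k≤2n+201 = begin
      k                                ≡⟨ m∸n+n≡m 200≤k ⟨
      k ∸ 200 + 200                    ≡⟨ cong (_+ 200) (m≡m%n+[m/n]*n (k ∸ 200) 2) ⟩
      (k ∸ 200) % 2 + n * 2 + 200      ≤⟨ +-monoˡ-≤ 200 (+-mono-≤ (≤-pred (m%n<n (k ∸ 200) 2)) (≤-reflexive (*-comm n 2))) ⟩
      1 + 2 * n + 200                  ≡⟨ lemma (2 * n) ⟩
      2 * n + 201                      ∎
      where
      lemma : ∀ x → 1 + x + 200 ≡ x + 201
      lemma = solve-∀
    s : ℕ
    s = proj₁ (sqrt (2 * n))
    s² : s * s ≤ 2 * n
    s² = proj₁ (proj₂ (sqrt (2 * n)))
    s²′ : 2 * n < suc s * suc s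
    s²′ = proj₂ (proj₂ (sqrt (2 * n)))
    209≤s : 209 ≤ s
    209≤s = ≮⇒≥ λ s<209 → <⇒≱ (<-≤-trans s²′ (*-mono-≤ s<209 s<209)) (+-cancelʳ-≤ 201 _ _ (≤-trans (≤ᵇ⇒≤ (209 * 209 + 201) 44221 _) (≤-trans large k≤2n+201)))
    from-prime : (∃ λ p → Prime p × n + s < p × p ≤ 2 * n) → Reached k
    from-prime (p , pr , n+s<p , p≤2n) = subst Reached (m+[n∸m]≡n p≤k) (reached-step pr 200≤k′ reached fits)
      where
      p≤k : p ≤ k
      p≤k = ≤-trans p≤2n (≤-trans (m≤m+n (2 * n) 200) 2n+200≤k)
      k′ : ℕ
      k′ = k ∸ p
      200≤k′ : 200 ≤ k′
      200≤k′ = m+n≤o⇒m≤o∸n 200 (≤-trans (≤-reflexive (+-comm 200 p)) (≤-trans (+-monoˡ-≤ 200 p≤2n) 2n+200≤k))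
      reached : Reached k′
      reached = rec (∸-monoʳ-< {k} {p} {0} (<-trans (s≤s z≤n) (prime>1 pr)) p≤k) 200≤k′
      E : ℕ
      E = proj₁ reached
      k′+s≤ : k′ + s ≤ n + 200
      k′+s≤ = +-cancelʳ-≤ (suc n) _ _ (begin
        k′ + s + suc n       ≡⟨ l₁ k′ s n ⟩
        k′ + suc (n + s)     ≤⟨ +-monoʳ-≤ k′ n+s<p ⟩
        k′ + p               ≡⟨ m∸n+n≡m p≤k ⟩
        k                    ≤⟨ k≤2n+201 ⟩
        2 * n + 201          ≡⟨ l₂ n ⟩
        n + 200 + suc n      ∎)
        where
        l₁ : ∀ k s n → k + s + suc n ≡ k + suc (n + s)
        l₁ = solve-∀
        l₂ : ∀ n → 2 * n + 201 ≡ n + 200 + suc n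
        l₂ = solve-∀
      k′≤n : k′ ≤ n
      k′≤n = +-cancelʳ-≤ 200 _ _ (≤-trans (+-monoʳ-≤ k′ (≤-trans (≤ᵇ⇒≤ 200 209 _) 209≤s)) k′+s≤)
      E≤s : E ≤ s
      E≤s = ≮⇒≥ λ s<E → <⇒≱ s²′ (≤-trans (*-mono-≤ s<E s<E) (≤-trans (proj₂ (proj₂ (proj₂ reached))) (≤-trans k′≤n (m≤m+n n _))))
      fits : k′ + E + 8 ≤ p
      fits = begin
        k′ + E + 8      ≤⟨ +-monoˡ-≤ 8 (+-monoʳ-≤ k′ E≤s) ⟩
        k′ + s + 8      ≤⟨ +-monoˡ-≤ 8 k′+s≤ ⟩
        n + 200 + 8     ≡⟨ +-assoc n 200 8 ⟩
        n + 208         ≤⟨ +-monoʳ-≤ n (≤-trans (≤ᵇ⇒≤ 208 209 _) 209≤s) ⟩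
        n + s           ≤⟨ <⇒≤ n+s<p ⟩
        p               ∎

  all-reached : ∀ k → 200 ≤ k → Reached k
  all-reached = <-rec _ go
    where
    go : ∀ k → (∀ {k′} → k′ < k → 200 ≤ k′ → Reached k′) → 200 ≤ k → Reached k
    go k rec 200≤k with k <? 44221
    ... | yes k< = reached-small k 200≤k k<
    ... | no k≮ = reached-large k (≮⇒≥ k≮) rec

  realised : ∀ r → r > 203 → Σ Hypergraph λ H → Partite r H × Uniform r H × Intersecting H × τ≥ H (r ∸ 3)
  realised (suc (suc (suc (suc k)))) (s≤s (s≤s (s≤s (s≤s 200≤k)))) with all-reached k 200≤k
  ... | _ , (_ , S , _) , _ = hypergraph , hypergraph-partite , hypergraph-uniform , hypergraph-intersecting , hypergraph-τ
    where open Realisation S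

  relaxed : ∀ r → r > 203 → Σ Hypergraph λ H → Partite r H × Uniform r H × Intersecting H × τ≥ H (r ∸ 4)
  relaxed r r>203 with realised r r>203
  ... | H , partite , uniform , intersecting , τ = H , partite , uniform , intersecting ,
        λ C cover → ≤-trans (∸-monoʳ-≤ r (n≤1+n 3)) (τ C cover)

open Assembly using (realised; relaxed)

theorem6 : ∃ λ M → ∀ r → r > M →
    (2 ∣ r → Σ Hypergraph λ H →
    Partite r H × Uniform r H × Intersecting H × τ≥ H (r ∸ 3))
    × (2 ∤ r → Σ Hypergraph λ H →
    Partite r H × Uniform r H × Intersecting H × τ≥ H (r ∸ 4))
theorem6 = 203 , λ r r>203 → (λ _ → realised r r>203) , (λ _ → relaxed r r>203)
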